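{- Let $G$ be a finite simple graph and $\theta$ a real number with $\textnormal{mult}(\theta,G)\ge 2$. Let $H_1,\dots,H_q,Q_1,\dots,Q_m$ be all the connected components of $G\setminus A_\theta(G)$, where each $H_i$ is $\theta$-critical and $\textnormal{mult}(\theta,Q_j)=0$ for all $j$. Then for distinct $u,v\in V(G)$, $uv\in E(D_{0,\theta}(S_\theta(G)))$ if and only if (a) one of $u,v$ lies in $P_\theta(G)\cup A_\theta(G)$ and the other in $B_\theta(G)$, or (b) $u,v\in N_\theta(G)$ with $u\in V(Q_{j_1})$ and $v\in V(Q_{j_2})$ for some $j_1\neq j_2$, or (c) $uv\in E(D_{0,\theta}(H_{i_0}))$ for some $i_0$, or (d) $uv\in E(D_{0,\theta}(Q_{j_0}))$ for some $j_0$.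
   Context: $\mu(G,x)=\sum_{r\ge 0}(-1)^r p(G,r)x^{|V(G)|-2r}$ is the matching polynomial ($p(G,r)$ = number of $r$-matchings, $p(G,0)=1$, empty graph has $\mu=1$); $\textnormal{mult}(\theta,G)$ is the multiplicity of $\theta$ as a root of $\mu(G,x)$ ($0$ if not a root). $G\setminus X$, $G\setminus uv$ denote vertex deletion. A vertex $u$ is $\theta$-essential if $\textnormal{mult}(\theta,G\setminus u)=\textnormal{mult}(\theta,G)-1$, $\theta$-neutral if $\textnormal{mult}(\theta,G\setminus u)=\textnormal{mult}(\theta,G)$, $\theta$-positive if $\textnormal{mult}(\theta,G\setminus u)=\textnormal{mult}(\theta,G)+1$, and $\theta$-special if it is not $\theta$-essential but adjacent to a $\theta$-essential vertex. $B_\theta(G)$, $N_\theta(G)$, $A_\theta(G)$ are the sets of $\theta$-essential, $\theta$-neutral, $\theta$-special vertices, and $P_\theta(G)$ is the set of $\theta$-positive vertices that are not $\theta$-special. A connected graph is $\theta$-critical if every vertex is $\theta$-essential in it. $S_\theta(G)$ is the graph on $V(G)$ in which distinct $w,z$ are adjacent iff $wz\in E(G)$ or one of $w,z$ is in $A_\theta(G)$. For a graph $F$ and $r\in\{ -2,-1,0,1,2\}$, $D_{r,\theta}(F)$ is the graph on $V(F)$ in which distinct $u,v$ are adjacent iff $\textnormal{mult}(\theta,F\setminus uv)=\textnormal{mult}(\theta,F)+r$. -}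

module Defs where

open import Level using (Level; _⊔_)
open import Algebra.Bundles using (CommutativeRing)
open import Data.Bool using (Bool; true; false; _∧_; _∨_; not; if_then_else_)
open import Data.Nat as ℕ using (ℕ; zero; suc; _≤_; _∸_; ⌊_/2⌋)
open import Data.Integer as ℤ using (ℤ; +_; -[1+_])
open import Data.Fin as Fin using (Fin; toℕ)
open import Data.Fin.Properties using () renaming (_≟_ to _≟ᶠ_)
open import Data.List using (List; []; _∷_; length; filterᵇ; map; foldr; upTo; allFin; concatMap; replicate; _++_)
open import Data.Product using (Σ; ∃; ∃-syntax; _×_; _,_)
open import Data.Sum using (_⊎_)
open import Relation.Nullary using (¬_; does; yes; no)
open import Data.Empty using (⊥-elim)
open import Data.Bool.Properties using (∨-comm; ∧-zeroʳ)
open import Relation.Binary.PropositionalEquality using (_≡_; _≢_; refl; trans; cong; cong₂) renaming (sym to ≡-sym)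
open import Function.Bundles using (_⇔_)

record Graph (n : ℕ) : Set where
  field
    adj    : Fin n → Fin n → Bool
    sym    : ∀ u v → adj u v ≡ adj v u
    irrefl : ∀ u → adj u u ≡ false
open Graph public

VSet : ℕ → Set
VSet n = Fin n → Bool

_∈ᵥ_ : ∀ {n} → Fin n → VSet n → Set
v ∈ᵥ X = X v ≡ true

full : ∀ {n} → VSet n
full _ = true

_≠ᵇ_ : ∀ {n} → Fin n → Fin n → Bool
u ≠ᵇ v = not (does (u ≟ᶠ v))

del₁ : ∀ {n} → VSet n → Fin n → VSet n
del₁ X u w = X w ∧ (w ≠ᵇ u)

del₂ : ∀ {n} → VSet n → Fin n → Fin n → VSet n
del₂ X u v = del₁ (del₁ X u) v

_∖_ : ∀ {n} → VSet n → VSet n → VSet n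
(X ∖ Y) w = X w ∧ not (Y w)

-- A pair (G , X) stands for the induced subgraph G[X].

card : ∀ {n} → VSet n → ℕ
card {n} X = length (filterᵇ X (allFin n))

edges : ∀ {n} → Graph n → VSet n → List (Fin n × Fin n)
edges {n} G X =
  concatMap (λ i → map (λ j → (i , j))
     (filterᵇ (λ j → X i ∧ X j ∧ adj G i j ∧ does (toℕ i ℕ.<? toℕ j)) (allFin n)))
  (allFin n)

-- all r-element sublists (= r-element subsets, the list having no repetitions)
choose : ∀ {A : Set} → ℕ → List A → List (List A)
choose zero    _        = [] ∷ []
choose (suc r) []       = []
choose (suc r) (x ∷ xs) = map (x ∷_) (choose r xs) ++ choose (suc r) xs

disjointᵇ : ∀ {n} → Fin n × Fin n → Fin n × Fin n → Bool
disjointᵇ (a , b) (c , d) = (a ≠ᵇ c) ∧ (a ≠ᵇ d) ∧ (b ≠ᵇ c) ∧ (b ≠ᵇ d)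

isMatchingᵇ : ∀ {n} → List (Fin n × Fin n) → Bool
isMatchingᵇ []       = true
isMatchingᵇ (e ∷ es) = foldr (λ f b → disjointᵇ e f ∧ b) true es ∧ isMatchingᵇ es

matchings : ∀ {n} → Graph n → VSet n → ℕ → ℕ
matchings G X r = length (filterᵇ isMatchingᵇ (choose r (edges G X)))

natR : ∀ {c ℓ} (R : CommutativeRing c ℓ) → ℕ → CommutativeRing.Carrier R
natR R zero    = CommutativeRing.0# R
natR R (suc k) = CommutativeRing._+_ R (CommutativeRing.1# R) (natR R k)

record CharZeroField (c ℓ : Level) : Set (Level.suc (c ⊔ ℓ)) where
  field
    cring : CommutativeRing c ℓ
  open CommutativeRing cring public
  field
    0≉1      : ¬ (0# ≈ 1#)
    inverse  : ∀ x → ¬ (x ≈ 0#) → ∃[ y ] (x * y ≈ 1#)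
    charZero : ∀ k → ¬ (natR cring (suc k) ≈ 0#)

module Poly {c ℓ} (F : CharZeroField c ℓ) where
  open CharZeroField F

  -- polynomials as coefficient lists, lowest degree first
  Pol : Set c
  Pol = List Carrier

  coeff : Pol → ℕ → Carrier
  coeff []       _       = 0#
  coeff (a ∷ as) zero    = a
  coeff (a ∷ as) (suc i) = coeff as i

  _≈ₚ_ : Pol → Pol → Set ℓ
  p ≈ₚ q = ∀ i → coeff p i ≈ coeff q i

  _+ₚ_ : Pol → Pol → Pol
  []       +ₚ q        = q
  (a ∷ p)  +ₚ []       = a ∷ p
  (a ∷ p)  +ₚ (b ∷ q)  = (a + b) ∷ (p +ₚ q)

  scale : Carrier → Pol → Pol
  scale c p = map (c *_) p

  _*ₚ_ : Pol → Pol → Pol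
  []      *ₚ q = []
  (a ∷ p) *ₚ q = scale a q +ₚ (0# ∷ (p *ₚ q))

  _^ₚ_ : Pol → ℕ → Pol
  p ^ₚ zero  = 1# ∷ []
  p ^ₚ suc k = p *ₚ (p ^ₚ k)

  monomial : Carrier → ℕ → Pol
  monomial c k = replicate k 0# ++ (c ∷ [])

  linear : Carrier → Pol
  linear θ = (- θ) ∷ 1# ∷ []

  Divides : Carrier → ℕ → Pol → Set (c ⊔ ℓ)
  Divides θ k f = ∃[ g ] (f ≈ₚ ((linear θ ^ₚ k) *ₚ g))

  IsMult : Carrier → Pol → ℕ → Set (c ⊔ ℓ)
  IsMult θ f k = Divides θ k f × ¬ Divides θ (suc k) f

  intF : ℤ → Carrier
  intF (+ k)      = natR cring k
  intF -[1+ k ]   = - natR cring (suc k)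

  signed : ℕ → ℕ → ℤ
  signed zero    m = + m
  signed (suc r) m = ℤ.- (signed r m)

  μ : ∀ {n} → Graph n → VSet n → Pol
  μ G X = foldr _+ₚ_ []
    (map (λ r → monomial (intF (signed r (matchings G X r))) (card X ∸ (2 ℕ.* r)))
         (upTo (suc ⌊ card X /2⌋)))

module Theta {c ℓ} (F : CharZeroField c ℓ) (θ : CharZeroField.Carrier F) where
  open CharZeroField F using (Carrier)
  open Poly F

  MultIs : ∀ {n} → Graph n → VSet n → ℕ → Set (c ⊔ ℓ)
  MultIs G X k = IsMult θ (μ G X) k

  Essential : ∀ {n} → Graph n → VSet n → Fin n → Set (c ⊔ ℓ)
  Essential G X u = u ∈ᵥ X × ∃[ k ] (MultIs G X (suc k) × MultIs G (del₁ X u) k)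

  Neutral : ∀ {n} → Graph n → VSet n → Fin n → Set (c ⊔ ℓ)
  Neutral G X u = u ∈ᵥ X × ∃[ k ] (MultIs G X k × MultIs G (del₁ X u) k)

  Positive : ∀ {n} → Graph n → VSet n → Fin n → Set (c ⊔ ℓ)
  Positive G X u = u ∈ᵥ X × ∃[ k ] (MultIs G X k × MultIs G (del₁ X u) (suc k))

  Special : ∀ {n} → Graph n → VSet n → Fin n → Set (c ⊔ ℓ)
  Special G X u = u ∈ᵥ X × ¬ Essential G X u
                × ∃[ w ] (w ∈ᵥ X × adj G u w ≡ true × Essential G X w)

  PosNotSpecial : ∀ {n} → Graph n → VSet n → Fin n → Set (c ⊔ ℓ)
  PosNotSpecial G X u = Positive G X u × ¬ Special G X u

  D0Edge : ∀ {n} → Graph n → VSet n → Fin n → Fin n → Set (c ⊔ ℓ)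
  D0Edge G X u v = u ≢ v × u ∈ᵥ X × v ∈ᵥ X
                 × ∃[ k ] (MultIs G X k × MultIs G (del₂ X u v) k)

data Reach {n} (G : Graph n) (X : VSet n) : Fin n → Fin n → Set where
  here  : ∀ {u} → u ∈ᵥ X → Reach G X u u
  there : ∀ {u w v} → u ∈ᵥ X → adj G u w ≡ true → Reach G X w v → Reach G X u v

Connected : ∀ {n} → Graph n → VSet n → Set
Connected G X = ∃[ v ] (v ∈ᵥ X) × (∀ u v → u ∈ᵥ X → v ∈ᵥ X → Reach G X u v)

IsComponent : ∀ {n} → Graph n → VSet n → VSet n → Set
IsComponent G X C = (∀ w → w ∈ᵥ C → w ∈ᵥ X) × Connected G C
                  × (∀ w z → w ∈ᵥ C → z ∈ᵥ X → adj G w z ≡ true → z ∈ᵥ C)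

module _ {c ℓ} (F : CharZeroField c ℓ) (θ : CharZeroField.Carrier F) where
  open Theta F θ
  Critical : ∀ {n} → Graph n → VSet n → Set (c ⊔ ℓ)
  Critical G X = Connected G X × (∀ u → u ∈ᵥ X → Essential G X u)

≠ᵇ-sym : ∀ {n} (u v : Fin n) → (u ≠ᵇ v) ≡ (v ≠ᵇ u)
≠ᵇ-sym u v with u ≟ᶠ v | v ≟ᶠ u
... | yes _ | yes _ = refl
... | no _  | no _  = refl
... | yes p | no ¬q = ⊥-elim (¬q (≡-sym p))
... | no ¬p | yes q = ⊥-elim (¬p (≡-sym q))

≠ᵇ-irrefl : ∀ {n} (u : Fin n) → (u ≠ᵇ u) ≡ false
≠ᵇ-irrefl u with u ≟ᶠ u
... | yes _ = refl
... | no ¬p = ⊥-elim (¬p refl)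

sGraph : ∀ {n} → Graph n → VSet n → Graph n
sGraph G A = record
  { adj    = λ w z → (adj G w z ∨ A w ∨ A z) ∧ (w ≠ᵇ z)
  ; sym    = λ w z → cong₂ _∧_ (cong₂ _∨_ (Graph.sym G w z) (∨-comm (A w) (A z))) (≠ᵇ-sym w z)
  ; irrefl = λ w → trans (cong ((adj G w w ∨ A w ∨ A w) ∧_) (≠ᵇ-irrefl w)) (∧-zeroʳ _)
  }

{-# OPTIONS --safe #-}
-- Expand μ(G[X]) at θ as a power series M(X) in y, with x = θ + y; its order is mult(θ, G[X]).
--
-- Reality of θ. No order on the field is available, so positivity is replaced by the statement that a vanishing sum
-- of squares of elements of ℤ[θ] has vanishing terms. The values M(G∖P), P running over the paths from u, form an
-- eigenvector modulo y^mult of Godsil's path tree, whose adjacency operator T is symmetric and integral. If S = Σ pᵢ(T)²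
-- then S and its powers have the kernel ⋂ ker pᵢ(T) on integer vectors, so (linear algebra over ℤ) a multiple of pᵢ(T)
-- factors through a power of S; applied to the eigenvector this shows pᵢ(θ) ∈ (Σ pⱼ(θ)²). The case of one square also
-- makes p(θ) ≈ 0 stable under double negation, so one may argue as if all multiplicities were known.
--
-- Multiplicities. The vertex recursion of M gives M(X∖u) M(X∖v) − M(X) M(X∖uv) = Σ M(X∖P)² over the paths P from u to v,
-- its derivative with respect to a separate variable at a third vertex, and the analogous formula for the Wronskian
-- of M(X) and M(X∖u). Comparing orders yields interlacing, parity constraints, and the fact that for essential vertices
-- "mult(G∖uv) > mult(G) − 2" is transitive. From these follows the stability lemma: deleting a special vertex changes
-- no type of any other vertex, hence mult(G∖A) = mult(G) + |A|.
--
-- The theorem. In S_θ(G) every vertex of A is joined to everything, so putting it back lowers the multiplicity by one as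
-- long as that is positive; since mult(G) ≥ 2 this remains so after deleting u and v. Thus mult(S∖uv) is read off from
-- mult(G∖A∖uv), which is additive over the components of G∖A.
module Submission where

open import Defs renaming (sym to adj-sym)
open import Level using (Level; _⊔_)
open import Algebra.Bundles using (CommutativeMonoid; CommutativeRing)
import Algebra.Solver.Ring as RingSolver
import Algebra.Construct.Pointwise as Pointwise
open import Algebra.Solver.Ring.AlmostCommutativeRing using (fromCommutativeRing; _-Raw-AlmostCommutative⟶_)
open import Data.Bool using (Bool; true; false; if_then_else_; _∧_; not; T)
open import Data.Bool.Properties using (∧-comm; ∧-assoc; ∧-zeroʳ; ∧-identityʳ) renaming (_≟_ to _≟ᵇ_)
open import Data.Nat as ℕ using (ℕ; zero; suc; _≤_; _<_; z≤n; s≤s; ⌊_/2⌋; _∸_)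
import Data.Nat.Properties as ℕₚ
open import Data.Nat.Tactic.RingSolver using () renaming (solve-∀ to solve-∀ℕ)
import Data.Integer.Properties as ℤₚ
open import Data.Integer.Tactic.RingSolver using () renaming (solve-∀ to solve-∀ℤ)
open import Data.Fin as Fin using (Fin; zero; suc)
open import Data.Fin.Properties using (any?) renaming (_≟_ to _≟ᶠ_)
open import Data.List using (List; []; _∷_; length; map; foldr; upTo; applyUpTo; _++_)
open import Data.List.Properties using (map-applyUpTo; map-++)
open import Data.List.Membership.Propositional using (_∈_)
open import Data.List.Membership.Propositional.Properties using (∈-++⁺ˡ; ∈-++⁺ʳ; ∈-map⁺; ∈-map⁻)
open import Data.List.Relation.Unary.Any using (here; there)
open import Data.Maybe using (Maybe; just; nothing)
open import Data.Product using (∃-syntax; _×_; _,_; proj₁; proj₂)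
open import Data.Sum using (_⊎_; inj₁; inj₂)
open import Data.Empty using (⊥; ⊥-elim)
open import Function using (_∘_; id)
open import Function.Bundles using (_⇔_; mk⇔; Equivalence)
open import Relation.Nullary using (¬_; Dec; does; yes; no; _×-dec_)
open import Relation.Binary.PropositionalEquality using (_≡_; _≢_; _≗_; cong; cong₂) renaming (refl to ≡-refl; sym to ≡-sym; trans to ≡-trans; subst to ≡-subst; subst₂ to ≡-subst₂)

-- Two-vertex identities leave one case of the stability lemma open: a positive vertex x that would
-- become essential once the special vertex w is gone. They only yield that x is parallel to every
-- essential neighbour of w. Since two such neighbours exist that are not parallel to each other, it
-- is transitivity, hence the three-vertex identity, that excludes the case. Parity enters because
-- the order of these sums of squares is even. In the reality argument divisibility is obtained for
-- p(x) M(G-u), but no single M(G-u) has a known order. Summing over u gives the derivative of M(G),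
-- whose order is exactly one less than the multiplicity, so that its leading coefficient is
-- invertible. Reality is drawn from G alone and then serves S_θ(G) as well, since all coefficients
-- in question lie in the same ring ℤ[θ]. Zero cannot be tested in the field, so a function giving
-- all multiplicities is available only under double negation.

module MatchingCount where
  open import Data.Nat using (_+_)
  open import Data.Nat.Properties
  open import Data.Nat.ListAction using (sum)
  open import Data.Fin using (toℕ)
  open import Data.Fin.Properties using (toℕ-injective)
  open import Data.List using (filterᵇ; allFin; concatMap; tabulate)
  open import Data.List.Properties using (length-++; map-cong; map-∘; map-tabulate; length-map)
  open import Relation.Binary.PropositionalEquality using (refl; sym; trans; module ≡-Reasoning)

  module FinSum {a ℓ} (M : CommutativeMonoid a ℓ) where
    open CommutativeMonoid M renaming (sym to ≈-sym; trans to ≈-trans; refl to ≈-refl)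
    open import Algebra.Properties.CommutativeMonoid.Sum M public renaming (sum to ∑; sum-cong-≗ to ∑-cong-≗; sum-cong-≋ to ∑-cong)

    ∑-zero : ∀ {n} {f : Fin n → Carrier} → (∀ i → f i ≈ ε) → ∑ f ≈ ε
    ∑-zero {zero}  e = ≈-refl
    ∑-zero {suc n} e = ≈-trans (∙-cong (e zero) (∑-zero (λ i → e (suc i)))) (identityˡ ε)

    ∑-single : ∀ {n} {f : Fin n → Carrier} (u : Fin n) → (∀ i → i ≢ u → f i ≈ ε) → ∑ f ≈ f u
    ∑-single zero    e = ≈-trans (∙-congˡ (∑-zero (λ i → e (suc i) (λ ())))) (identityʳ _)
    ∑-single (suc u) e = ≈-trans
      (∙-cong (e zero (λ ())) (∑-single u (λ i p → e (suc i) (λ { refl → p refl })))) (identityˡ _)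

  module ℕΣ = FinSum +-0-commutativeMonoid
  open ℕΣ using () renaming (∑ to ∑ℕ)

  ≠ᵇ-≢ : ∀ {n} {u v : Fin n} → u ≢ v → (u ≠ᵇ v) ≡ true
  ≠ᵇ-≢ {u = u} {v} p with u ≟ᶠ v
  ... | yes q = ⊥-elim (p q)
  ... | no _  = refl

  ≢-≠ᵇ : ∀ {n} {u v : Fin n} → (u ≠ᵇ v) ≡ true → u ≢ v
  ≢-≠ᵇ {u = u} p refl with trans (sym p) (≠ᵇ-irrefl u)
  ... | ()

  ∧-true⁻ : ∀ {a b} → a ∧ b ≡ true → a ≡ true × b ≡ true
  ∧-true⁻ {true} {true} _ = refl , refl

  ∧-true⁺ : ∀ {a b} → a ≡ true → b ≡ true → a ∧ b ≡ true
  ∧-true⁺ refl refl = refl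

  true≢false : ∀ {A : Set} {b} → b ≡ true → b ≡ false → A
  true≢false refl ()

  caseᵇ : ∀ {p} {P : Set p} (b : Bool) → (b ≡ true → P) → (b ≡ false → P) → P
  caseᵇ true  t f = t refl
  caseᵇ false t f = f refl

  if-≟-off : ∀ {n} {z : ℕ} (u i : Fin n) → i ≢ u → (if does (i ≟ᶠ u) then z else 0) ≡ 0
  if-≟-off u i p with i ≟ᶠ u
  ... | yes q = ⊥-elim (p q)
  ... | no _  = refl

  if-≟-on : ∀ {n} {z : ℕ} (u : Fin n) → (if does (u ≟ᶠ u) then z else 0) ≡ z
  if-≟-on u with u ≟ᶠ u
  ... | yes _ = refl
  ... | no p  = ⊥-elim (p refl)

  <-split : ∀ {z : ℕ} a b → a ≢ b → (if does (a ℕ.<? b) then z else 0) + (if does (b ℕ.<? a) then z else 0) ≡ z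
  <-split zero zero p = ⊥-elim (p refl)
  <-split zero (suc b) p = +-identityʳ _
  <-split (suc a) zero p = refl
  <-split (suc a) (suc b) p = <-split a b (λ e → p (cong suc e))

  filterᵇ-cong : {A : Set} {p q : A → Bool} → p ≗ q → ∀ xs → filterᵇ p xs ≡ filterᵇ q xs
  filterᵇ-cong e [] = refl
  filterᵇ-cong {p = p} {q} e (x ∷ xs) with p x | q x | e x
  ... | true  | true  | _ = cong (x ∷_) (filterᵇ-cong e xs)
  ... | false | false | _ = filterᵇ-cong e xs

  filterᵇ-filterᵇ : {A : Set} (p q : A → Bool) → ∀ xs → filterᵇ p (filterᵇ q xs) ≡ filterᵇ (λ x → q x ∧ p x) xs
  filterᵇ-filterᵇ p q [] = refl
  filterᵇ-filterᵇ p q (x ∷ xs) with q x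
  ... | false = filterᵇ-filterᵇ p q xs
  ... | true with p x
  ...   | true  = cong (x ∷_) (filterᵇ-filterᵇ p q xs)
  ...   | false = filterᵇ-filterᵇ p q xs

  filterᵇ-comm : {A : Set} (p q : A → Bool) → ∀ xs → filterᵇ p (filterᵇ q xs) ≡ filterᵇ q (filterᵇ p xs)
  filterᵇ-comm p q xs = trans (filterᵇ-filterᵇ p q xs)
    (trans (filterᵇ-cong (λ x → ∧-comm (q x) (p x)) xs) (sym (filterᵇ-filterᵇ q p xs)))

  filterᵇ-map : {A B : Set} (p : B → Bool) (f : A → B) → ∀ xs → filterᵇ p (map f xs) ≡ map f (filterᵇ (p ∘ f) xs)
  filterᵇ-map p f [] = refl
  filterᵇ-map p f (x ∷ xs) with p (f x)
  ... | true  = cong (f x ∷_) (filterᵇ-map p f xs)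
  ... | false = filterᵇ-map p f xs

  filterᵇ-++ : {A : Set} (p : A → Bool) → ∀ xs ys → filterᵇ p (xs ++ ys) ≡ filterᵇ p xs ++ filterᵇ p ys
  filterᵇ-++ p [] ys = refl
  filterᵇ-++ p (x ∷ xs) ys with p x
  ... | true  = cong (x ∷_) (filterᵇ-++ p xs ys)
  ... | false = filterᵇ-++ p xs ys

  filterᵇ-none : {A : Set} {p : A → Bool} → (∀ x → p x ≡ false) → ∀ xs → filterᵇ p xs ≡ []
  filterᵇ-none e [] = refl
  filterᵇ-none e (x ∷ xs) rewrite e x = filterᵇ-none e xs

  filterᵇ-concatMap : {A B : Set} (p : B → Bool) (f : A → List B) → ∀ xs →
    filterᵇ p (concatMap f xs) ≡ concatMap (filterᵇ p ∘ f) xs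
  filterᵇ-concatMap p f [] = refl
  filterᵇ-concatMap p f (x ∷ xs) = trans (filterᵇ-++ p (f x) _) (cong (filterᵇ p (f x) ++_) (filterᵇ-concatMap p f xs))

  concatMap-cong′ : {A B : Set} {f g : A → List B} → f ≗ g → ∀ xs → concatMap f xs ≡ concatMap g xs
  concatMap-cong′ e [] = refl
  concatMap-cong′ e (x ∷ xs) = cong₂ _++_ (e x) (concatMap-cong′ e xs)

  -- The recursion at a vertex for the number of matchings.

  countᵇ : {A : Set} → (A → Bool) → List A → ℕ
  countᵇ p xs = length (filterᵇ p xs)

  -- A sublist all of whose entries satisfy `p` is a sublist of the filtered list. This turns
  -- "disjoint from e" into a deletion of edges, so that matchings can be counted by recursion on
  -- the edge list.
  countᵇ-choose : {A : Set} (p : A → Bool) (Q : List A → Bool) → ∀ r es →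
    countᵇ (λ l → foldr (λ f b → p f ∧ b) true l ∧ Q l) (choose r es) ≡ countᵇ Q (choose r (filterᵇ p es))
  countᵇ-choose p Q zero es with Q []
  ... | true  = refl
  ... | false = refl
  countᵇ-choose p Q (suc r) [] = refl
  countᵇ-choose {A = A} p Q (suc r) (x ∷ es) = trans split (rest (p x) refl)
    where
    open ≡-Reasoning
    allp : List A → Bool
    allp = foldr (λ f b → p f ∧ b) true
    split : countᵇ (λ l → allp l ∧ Q l) (choose (suc r) (x ∷ es))
          ≡ countᵇ (λ l → (p x ∧ allp l) ∧ Q (x ∷ l)) (choose r es) + countᵇ Q (choose (suc r) (filterᵇ p es))
    split = begin
      length (filterᵇ (λ l → allp l ∧ Q l) (map (x ∷_) (choose r es) ++ choose (suc r) es))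
        ≡⟨ cong length (filterᵇ-++ _ (map (x ∷_) (choose r es)) _) ⟩
      length (filterᵇ (λ l → allp l ∧ Q l) (map (x ∷_) (choose r es)) ++ filterᵇ (λ l → allp l ∧ Q l) (choose (suc r) es))
        ≡⟨ length-++ (filterᵇ (λ l → allp l ∧ Q l) (map (x ∷_) (choose r es))) ⟩
      _ ≡⟨ cong₂ _+_ (trans (cong length (filterᵇ-map _ (x ∷_) (choose r es))) (length-map (x ∷_) (filterᵇ (λ l → (p x ∧ allp l) ∧ Q (x ∷ l)) (choose r es))))
                     (countᵇ-choose p Q (suc r) es) ⟩
      _ ∎
    rest : ∀ b → p x ≡ b → countᵇ (λ l → (p x ∧ allp l) ∧ Q (x ∷ l)) (choose r es) + countᵇ Q (choose (suc r) (filterᵇ p es))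
         ≡ countᵇ Q (choose (suc r) (filterᵇ p (x ∷ es)))
    rest true e rewrite e = sym (begin
      length (filterᵇ Q (map (x ∷_) (choose r (filterᵇ p es)) ++ choose (suc r) (filterᵇ p es)))
        ≡⟨ cong length (filterᵇ-++ Q (map (x ∷_) (choose r (filterᵇ p es))) _) ⟩
      _ ≡⟨ length-++ (filterᵇ Q (map (x ∷_) (choose r (filterᵇ p es)))) ⟩
      _ ≡⟨ cong (_+ _) (trans (cong length (filterᵇ-map Q (x ∷_) (choose r (filterᵇ p es)))) (length-map (x ∷_) (filterᵇ (Q ∘ (x ∷_)) (choose r (filterᵇ p es))))) ⟩
      countᵇ (Q ∘ (x ∷_)) (choose r (filterᵇ p es)) + _
        ≡⟨ cong (_+ _) (sym (countᵇ-choose p (Q ∘ (x ∷_)) r es)) ⟩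
      _ ∎)
    rest false e rewrite e = cong (λ l → length l + countᵇ Q (choose (suc r) (filterᵇ p es))) (filterᵇ-none (λ _ → refl) (choose r es))

  module _ {n : ℕ} where

    Edge : Set
    Edge = Fin n × Fin n

    count : List Edge → ℕ → ℕ
    count es r = countᵇ isMatchingᵇ (choose r es)

    count-∷ : ∀ e es r → count (e ∷ es) (suc r) ≡ count (filterᵇ (disjointᵇ e) es) r + count es (suc r)
    count-∷ e es r = begin
      length (filterᵇ isMatchingᵇ (map (e ∷_) (choose r es) ++ choose (suc r) es))
        ≡⟨ cong length (filterᵇ-++ isMatchingᵇ (map (e ∷_) (choose r es)) _) ⟩
      _ ≡⟨ length-++ (filterᵇ isMatchingᵇ (map (e ∷_) (choose r es))) ⟩
      _ ≡⟨ cong (_+ _) (trans (cong length (filterᵇ-map isMatchingᵇ (e ∷_) (choose r es))) (length-map (e ∷_) (filterᵇ (isMatchingᵇ ∘ (e ∷_)) (choose r es)))) ⟩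
      _ ≡⟨ cong (_+ count es (suc r)) (countᵇ-choose (disjointᵇ e) isMatchingᵇ r es) ⟩
      _ ∎
      where open ≡-Reasoning

    avoids : Fin n → Edge → Bool
    avoids u (a , b) = (a ≠ᵇ u) ∧ (b ≠ᵇ u)

    ∧₄-swap : ∀ a b c d → a ∧ b ∧ c ∧ d ≡ a ∧ c ∧ b ∧ d
    ∧₄-swap false b c d = refl
    ∧₄-swap true false c d = sym (∧-zeroʳ c)
    ∧₄-swap true true true d = refl
    ∧₄-swap true true false d = refl

    disjointᵇ-sym : ∀ e f → disjointᵇ e f ≡ disjointᵇ f e
    disjointᵇ-sym (a , b) (c , d)
      rewrite ≠ᵇ-sym {n} a c | ≠ᵇ-sym {n} a d | ≠ᵇ-sym {n} b c | ≠ᵇ-sym {n} b d = ∧₄-swap (c ≠ᵇ a) (d ≠ᵇ a) (c ≠ᵇ b) (d ≠ᵇ b)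

    share⇒¬disjointᵇ : ∀ u e f → avoids u e ≡ false → avoids u f ≡ false → disjointᵇ e f ≡ false
    share⇒¬disjointᵇ u (a , b) (c , d) p q with a ≟ᶠ u | b ≟ᶠ u | c ≟ᶠ u | d ≟ᶠ u
    ... | yes refl | _ | yes refl | _ rewrite ≠ᵇ-irrefl a = refl
    ... | yes refl | _ | no _ | yes refl rewrite ≠ᵇ-irrefl a = ∧-zeroʳ _
    ... | no _ | yes refl | yes refl | _ rewrite ≠ᵇ-irrefl b = trans (cong ((a ≠ᵇ b) ∧_) (∧-zeroʳ _)) (∧-zeroʳ _)
    ... | no _ | yes refl | no _ | yes refl rewrite ≠ᵇ-irrefl b = trans (cong ((a ≠ᵇ c) ∧_) (trans (cong ((a ≠ᵇ b) ∧_) (∧-zeroʳ _)) (∧-zeroʳ _))) (∧-zeroʳ _)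

    module _ (u : Fin n) where

      -- For `L` equal to `es` this counts the matchings with r + 1 edges that cover `u`, sorted by
      -- the covering edge. The available edges `L` are kept apart from the candidates `es`, because
      -- the induction on `es` must leave `L` fixed.
      throughSum : ℕ → List Edge → List Edge → ℕ
      throughSum r L es = sum (map (λ e → if avoids u e then 0 else count (filterᵇ (disjointᵇ e) L) r) es)

      throughSum-∷-through : ∀ r L e → avoids u e ≡ false → ∀ es → throughSum r (e ∷ L) es ≡ throughSum r L es
      throughSum-∷-through r L e p [] = refl
      throughSum-∷-through r L e p (f ∷ es) with avoids u f in q
      ... | true = throughSum-∷-through r L e p es
      ... | false rewrite share⇒¬disjointᵇ u f e q p = cong (λ s → count (filterᵇ (disjointᵇ f) L) r + s) (throughSum-∷-through r L e p es)

      throughSum-∷-zero : ∀ L e es → throughSum 0 (e ∷ L) es ≡ throughSum 0 L es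
      throughSum-∷-zero L e [] = refl
      throughSum-∷-zero L e (f ∷ es) with avoids u f
      ... | true  = throughSum-∷-zero L e es
      ... | false = cong suc (throughSum-∷-zero L e es)

      -- A new edge `e` of `L` is either left out or used; in the second case the covering edge and
      -- the remaining ones must all be disjoint from `e`.
      throughSum-∷-suc : ∀ r L e es → throughSum (suc r) (e ∷ L) es
        ≡ throughSum (suc r) L es + throughSum r (filterᵇ (disjointᵇ e) L) (filterᵇ (disjointᵇ e) es)
      throughSum-∷-suc r L e [] = refl
      throughSum-∷-suc r L e (f ∷ es) with avoids u f in q
      ... | true with disjointᵇ e f
      ...   | true rewrite q = throughSum-∷-suc r L e es
      ...   | false = throughSum-∷-suc r L e es
      throughSum-∷-suc r L e (f ∷ es) | false rewrite disjointᵇ-sym f e with disjointᵇ e f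
      ...   | true rewrite q | count-∷ e (filterᵇ (disjointᵇ f) L) r | throughSum-∷-suc r L e es
                         | filterᵇ-comm (disjointᵇ e) (disjointᵇ f) L =
               rearr (count (filterᵇ (disjointᵇ f) (filterᵇ (disjointᵇ e) L)) r) _ _ _
               where
               rearr : ∀ a b c d → (a + b) + (c + d) ≡ (b + c) + (a + d)
               rearr = solve-∀ℕ
      ...   | false rewrite throughSum-∷-suc r L e es = sym (+-assoc (count (filterᵇ (disjointᵇ f) L) (suc r)) _ _)

      CountVertex : ℕ → List Edge → Set
      CountVertex r es = count es (suc r) ≡ count (filterᵇ (avoids u) es) (suc r) + throughSum r es es

      count-vertex-through : ∀ r e es → avoids u e ≡ false → CountVertex r es → CountVertex r (e ∷ es)
      count-vertex-through r e es q ih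
        rewrite q | share⇒¬disjointᵇ u e e q q | count-∷ e es r | ih | throughSum-∷-through r es e q es =
          rearr (count (filterᵇ (disjointᵇ e) es) r) (count (filterᵇ (avoids u) es) (suc r)) (throughSum r es es)
        where
        rearr : ∀ a b c → a + (b + c) ≡ b + (a + c)
        rearr = solve-∀ℕ

      count-vertex-avoid-zero : ∀ e es → avoids u e ≡ true → CountVertex 0 es → CountVertex 0 (e ∷ es)
      count-vertex-avoid-zero e es q ih
        rewrite q | count-∷ e es 0 | count-∷ e (filterᵇ (avoids u) es) 0 | ih | throughSum-∷-zero es e es = refl

      count-vertex-avoid-suc : ∀ r e es → avoids u e ≡ true → CountVertex r (filterᵇ (disjointᵇ e) es) →
        CountVertex (suc r) es → CountVertex (suc r) (e ∷ es)
      count-vertex-avoid-suc r e es q ih₁ ih₂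
        rewrite q | count-∷ e es (suc r) | count-∷ e (filterᵇ (avoids u) es) (suc r)
              | ih₂ | throughSum-∷-suc r es e es | ih₁
              | filterᵇ-comm (avoids u) (disjointᵇ e) es =
        rearr (count (filterᵇ (disjointᵇ e) (filterᵇ (avoids u) es)) (suc r)) _ (count (filterᵇ (avoids u) es) (suc (suc r))) _
        where
        rearr : ∀ a b c d → (a + b) + (c + d) ≡ (a + c) + (d + b)
        rearr = solve-∀ℕ

      -- Splits the matchings by the edge covering u, if there is one.
      count-vertex : ∀ r es → CountVertex r es
      count-vertex r [] = refl
      count-vertex zero (e ∷ es) = caseᵇ (avoids u e)
        (λ q → count-vertex-avoid-zero e es q (count-vertex 0 es))
        (λ q → count-vertex-through 0 e es q (count-vertex 0 es))
      count-vertex (suc r) (e ∷ es) = caseᵇ (avoids u e)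
        (λ q → count-vertex-avoid-suc r e es q (count-vertex r (filterᵇ (disjointᵇ e) es)) (count-vertex (suc r) es))
        (λ q → count-vertex-through (suc r) e es q (count-vertex (suc r) es))

  sum-map-filterᵇ : {A : Set} (p : A → Bool) (f : A → ℕ) → ∀ xs → sum (map f (filterᵇ p xs)) ≡ sum (map (λ x → if p x then f x else 0) xs)
  sum-map-filterᵇ p f [] = refl
  sum-map-filterᵇ p f (x ∷ xs) with p x
  ... | true  = cong (f x +_) (sum-map-filterᵇ p f xs)
  ... | false = sum-map-filterᵇ p f xs

  sum-map-++ : {A : Set} (f : A → ℕ) → ∀ xs ys → sum (map f (xs ++ ys)) ≡ sum (map f xs) + sum (map f ys)
  sum-map-++ f [] ys = refl
  sum-map-++ f (x ∷ xs) ys = trans (cong (f x +_) (sum-map-++ f xs ys)) (sym (+-assoc (f x) _ _))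

  sum-map-concatMap : {A B : Set} (f : B → ℕ) (g : A → List B) → ∀ xs →
    sum (map f (concatMap g xs)) ≡ sum (map (λ x → sum (map f (g x))) xs)
  sum-map-concatMap f g [] = refl
  sum-map-concatMap f g (x ∷ xs) = trans (sum-map-++ f (g x) _) (cong (sum (map f (g x)) +_) (sum-map-concatMap f g xs))

  sum-tabulate : ∀ {n} (f : Fin n → ℕ) → sum (tabulate f) ≡ ∑ℕ f
  sum-tabulate {zero}  f = refl
  sum-tabulate {suc n} f = cong (f zero +_) (sum-tabulate (f ∘ suc))

  sum-allFin : ∀ {n} (f : Fin n → ℕ) → sum (map f (allFin n)) ≡ ∑ℕ f
  sum-allFin f = trans (cong sum (map-tabulate id f)) (sum-tabulate f)

  nbr : ∀ {n} → Graph n → VSet n → Fin n → VSet n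
  nbr G X u w = del₁ X u w ∧ adj G u w

  del₁-≗ : ∀ {n} {X Y : VSet n} → X ≗ Y → ∀ u → del₁ X u ≗ del₁ Y u
  del₁-≗ e u w = cong (_∧ (w ≠ᵇ u)) (e w)

  del₂-comm : ∀ {n} (X : VSet n) u v → del₂ X u v ≗ del₂ X v u
  del₂-comm X u v w = trans (∧-assoc (X w) _ _) (trans (cong (X w ∧_) (∧-comm (w ≠ᵇ u) (w ≠ᵇ v))) (sym (∧-assoc (X w) _ _)))

  edgeᵇ : ∀ {n} → Graph n → VSet n → Fin n → Fin n → Bool
  edgeᵇ G X i j = X i ∧ X j ∧ adj G i j ∧ does (toℕ i ℕ.<? toℕ j)

  edges-cong : ∀ {n} {G G′ : Graph n} {X X′ : VSet n} →
    (∀ i j → X i ∧ X j ∧ adj G i j ≡ X′ i ∧ X′ j ∧ adj G′ i j) → edges G X ≡ edges G′ X′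
  edges-cong {n} {G} {G′} {X} {X′} e = concatMap-cong′
    (λ i → cong (map (λ j → (i , j))) (filterᵇ-cong (λ j → e′ i j) (allFin n))) (allFin n)
    where
    assoc₃ : ∀ a b c d → a ∧ b ∧ c ∧ d ≡ (a ∧ b ∧ c) ∧ d
    assoc₃ false b c d = refl
    assoc₃ true b c d = sym (∧-assoc b c d)
    e′ : ∀ i j → edgeᵇ G X i j ≡ edgeᵇ G′ X′ i j
    e′ i j = trans (assoc₃ (X i) (X j) (adj G i j) _) (trans (cong (_∧ does (toℕ i ℕ.<? toℕ j)) (e i j)) (sym (assoc₃ (X′ i) (X′ j) (adj G′ i j) _)))

  edges-filterᵇ : ∀ {n} (G : Graph n) (X a : VSet n) (p : Fin n × Fin n → Bool) → (∀ i j → p (i , j) ≡ a i ∧ a j) →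
    filterᵇ p (edges G X) ≡ edges G (λ w → X w ∧ a w)
  edges-filterᵇ {n} G X a p e = trans (filterᵇ-concatMap p _ (allFin n)) (concatMap-cong′ row (allFin n))
    where
    bool : ∀ x y e a b → (x ∧ y ∧ e) ∧ (a ∧ b) ≡ (x ∧ a) ∧ (y ∧ b) ∧ e
    bool false y e a b = refl
    bool true false e a b = sym (∧-zeroʳ a)
    bool true true e a b = trans (∧-comm e (a ∧ b)) (∧-assoc a b e)
    row : ∀ i → filterᵇ p (map (λ j → (i , j)) (filterᵇ (edgeᵇ G X i) (allFin n)))
              ≡ map (λ j → (i , j)) (filterᵇ (edgeᵇ G (λ w → X w ∧ a w) i) (allFin n))
    row i = trans (filterᵇ-map p (λ j → (i , j)) (filterᵇ (edgeᵇ G X i) (allFin n)))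
      (cong (map (λ j → (i , j))) (trans (filterᵇ-filterᵇ (p ∘ (λ j → (i , j))) (edgeᵇ G X i) (allFin n))
        (filterᵇ-cong (λ j → trans (cong (edgeᵇ G X i j ∧_) (e i j)) (bool (X i) (X j) _ (a i) (a j))) (allFin n))))

  matchings-cong : ∀ {n} {G G′ : Graph n} {X X′ : VSet n} →
    (∀ i j → X i ∧ X j ∧ adj G i j ≡ X′ i ∧ X′ j ∧ adj G′ i j) → ∀ r → matchings G X r ≡ matchings G′ X′ r
  matchings-cong {G = G} {G′} {X} {X′} e r = cong (λ es → count es r) (edges-cong {G = G} {G′} {X} {X′} e)

  matchings-≗ : ∀ {n} (G : Graph n) {X Y : VSet n} → X ≗ Y → ∀ r → matchings G X r ≡ matchings G Y r
  matchings-≗ G {X} {Y} e = matchings-cong {G = G} {G} {X} {Y} (λ i j → cong₂ (λ a b → a ∧ b ∧ adj G i j) (e i) (e j))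

  module _ {n : ℕ} (G : Graph n) (X : VSet n) (u : Fin n) (u∈X : u ∈ᵥ X) (r : ℕ) where
    private
      φ : Fin n → Fin n → ℕ
      φ i j = matchings G (del₂ X i j) r

      φ-sym : ∀ i j → φ i j ≡ φ j i
      φ-sym i j = matchings-≗ G (del₂-comm X i j) r

      disjoint-edges : ∀ c d → count (filterᵇ (disjointᵇ (c , d)) (edges G X)) r ≡ φ c d
      disjoint-edges c d = trans
        (cong (λ es → count es r) (edges-filterᵇ G X (λ i → (i ≠ᵇ c) ∧ (i ≠ᵇ d)) (disjointᵇ (c , d)) dis))
        (matchings-≗ G (λ w → sym (∧-assoc (X w) _ _)) r)
        where
        dis : ∀ i j → disjointᵇ (c , d) (i , j) ≡ ((i ≠ᵇ c) ∧ (i ≠ᵇ d)) ∧ ((j ≠ᵇ c) ∧ (j ≠ᵇ d))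
        dis i j rewrite ≠ᵇ-sym c i | ≠ᵇ-sym c j | ≠ᵇ-sym d i | ≠ᵇ-sym d j =
          trans (∧₄-swap {n} (i ≠ᵇ c) (j ≠ᵇ c) (i ≠ᵇ d) (j ≠ᵇ d)) (sym (∧-assoc (i ≠ᵇ c) _ _))

      g : Fin n → Fin n → ℕ
      g i j = if edgeᵇ G X i j then φ i j else 0

      g-diag : ∀ i → g i i ≡ 0
      g-diag i rewrite irrefl G i with X i
      ... | true = refl
      ... | false = refl

      h : Fin n → Fin n → ℕ
      h i j = if edgeᵇ G X i j then (if avoids u (i , j) then 0 else count (filterᵇ (disjointᵇ (i , j)) (edges G X)) r) else 0

      h-avoids : ∀ i j → i ≢ u → j ≢ u → h i j ≡ 0
      h-avoids i j p q rewrite ≠ᵇ-≢ p | ≠ᵇ-≢ q with edgeᵇ G X i j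
      ... | true  = refl
      ... | false = refl

      h-through : ∀ i j → avoids u (i , j) ≡ false → h i j ≡ g i j
      h-through i j p rewrite p | disjoint-edges i j = refl

      -- An edge is listed once, smaller end first, so the edges at `u` fill both row `u` and column
      -- `u` of the table. The diagonal entry appears in both, harmlessly, because it is 0.
      row : ∀ i → ∑ℕ (h i) ≡ (if does (i ≟ᶠ u) then ∑ℕ (g u) else 0) + g i u
      row i = by (i ≟ᶠ u)
        where
        by : Dec (i ≡ u) → ∑ℕ (h i) ≡ (if does (i ≟ᶠ u) then ∑ℕ (g u) else 0) + g i u
        by (yes refl) = trans (ℕΣ.∑-cong-≗ {n} (λ j → h-through u j (cong (_∧ (j ≠ᵇ u)) (≠ᵇ-irrefl u))))
          (sym (trans (cong₂ _+_ (if-≟-on u) (g-diag u)) (+-identityʳ _)))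
        by (no i≢u) = trans (ℕΣ.∑-single u (λ j j≢u → h-avoids i j i≢u j≢u))
          (trans (h-through i u (trans (cong ((i ≠ᵇ u) ∧_) (≠ᵇ-irrefl u)) (∧-zeroʳ _)))
                 (sym (cong (_+ g i u) (if-≟-off u i i≢u))))

      pair : ∀ j → g u j + g j u ≡ (if nbr G X u j then φ u j else 0)
      pair j with j ≟ᶠ u
      ... | yes refl rewrite g-diag u | irrefl G u with X u
      ...   | true  = refl
      ...   | false = refl
      pair j | no j≢u rewrite u∈X | adj-sym G j u | φ-sym j u with X j | adj G u j
      ... | false | _ = refl
      ... | true | false = refl
      ... | true | true = <-split (toℕ u) (toℕ j) (λ e → j≢u (toℕ-injective (sym e)))

      throughSum-edges : throughSum u r (edges G X) (edges G X) ≡ ∑ℕ (λ w → if nbr G X u w then φ u w else 0)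
      throughSum-edges = begin
        throughSum u r (edges G X) (edges G X)
          ≡⟨ sum-map-concatMap _ _ (allFin n) ⟩
        _ ≡⟨ cong sum (map-cong (λ i → trans (trans (cong sum (sym (map-∘ (filterᵇ (edgeᵇ G X i) (allFin n)))))
                (sum-map-filterᵇ (edgeᵇ G X i) _ (allFin n))) (sum-allFin (h i))) (allFin n)) ⟩
        _ ≡⟨ sum-allFin (λ i → ∑ℕ (h i)) ⟩
        ∑ℕ (λ i → ∑ℕ (h i))
          ≡⟨ ℕΣ.∑-cong-≗ {n} row ⟩
        ∑ℕ (λ i → (if does (i ≟ᶠ u) then ∑ℕ (g u) else 0) + g i u)
          ≡⟨ ℕΣ.∑-distrib-+ (λ i → if does (i ≟ᶠ u) then ∑ℕ (g u) else 0) (λ i → g i u) ⟩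
        _ ≡⟨ cong (_+ ∑ℕ (λ i → g i u)) (trans (ℕΣ.∑-single u (if-≟-off u)) (if-≟-on u)) ⟩
        ∑ℕ (g u) + ∑ℕ (λ i → g i u)
          ≡⟨ ℕΣ.∑-distrib-+ (g u) (λ i → g i u) ⟨
        _ ≡⟨ ℕΣ.∑-cong-≗ {n} pair ⟩
        _ ∎
        where
        open ≡-Reasoning

    matchings-rec : matchings G X (suc r)
      ≡ matchings G (del₁ X u) (suc r) + ∑ℕ (λ w → if nbr G X u w then matchings G (del₂ X u w) r else 0)
    matchings-rec = trans (count-vertex u r (edges G X))
      (cong₂ _+_ (cong (λ es → count es (suc r)) (edges-filterᵇ G X (_≠ᵇ u) (avoids u) (λ _ _ → refl))) throughSum-edges)

  card-∑ : ∀ {n} (X : VSet n) → card X ≡ ∑ℕ (λ i → if X i then 1 else 0)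
  card-∑ {n} X = trans (trans (len (filterᵇ X (allFin n))) (sum-map-filterᵇ X (λ _ → 1) (allFin n))) (sum-allFin (λ i → if X i then 1 else 0))
    where
    len : ∀ xs → length xs ≡ sum (map (λ _ → 1) xs)
    len [] = refl
    len (x ∷ xs) = cong suc (len xs)

  card-≗ : ∀ {n} {X Y : VSet n} → X ≗ Y → card X ≡ card Y
  card-≗ {n} e = cong length (filterᵇ-cong e (allFin n))

  card-del₁ : ∀ {n} (X : VSet n) u → u ∈ᵥ X → card X ≡ suc (card (del₁ X u))
  card-del₁ {n} X u u∈X = begin
    card X ≡⟨ card-∑ X ⟩
    ∑ℕ (λ i → if X i then 1 else 0) ≡⟨ ℕΣ.∑-cong-≗ {n} split ⟩
    ∑ℕ (λ i → (if does (i ≟ᶠ u) then 1 else 0) + (if del₁ X u i then 1 else 0))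
      ≡⟨ ℕΣ.∑-distrib-+ (λ i → if does (i ≟ᶠ u) then 1 else 0) (λ i → if del₁ X u i then 1 else 0) ⟩
    ∑ℕ (λ i → if does (i ≟ᶠ u) then 1 else 0) + ∑ℕ (λ i → if del₁ X u i then 1 else 0)
      ≡⟨ cong₂ _+_ (trans (ℕΣ.∑-single u (if-≟-off u)) (if-≟-on u)) (sym (card-∑ (del₁ X u))) ⟩
    suc (card (del₁ X u)) ∎
    where
    open ≡-Reasoning
    split : ∀ i → (if X i then 1 else 0) ≡ (if does (i ≟ᶠ u) then 1 else 0) + (if del₁ X u i then 1 else 0)
    split i with i ≟ᶠ u
    ... | yes refl rewrite u∈X = refl
    ... | no _ rewrite ∧-identityʳ (X i) = refl

  card-positive : ∀ {n} (X : VSet n) c → card X ≡ suc c → ∃[ u ] u ∈ᵥ X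
  card-positive {n} X c e = go (allFin n) e
    where
    go : ∀ xs → length (filterᵇ X xs) ≡ suc c → ∃[ u ] u ∈ᵥ X
    go (x ∷ xs) e with X x in p
    ... | true  = x , p
    ... | false = go xs e

  card-empty : ∀ {n} (X : VSet n) → card X ≡ 0 → ∀ u → X u ≡ false
  card-empty X e u with X u in p
  ... | false = refl
  ... | true with trans (sym e) (card-del₁ X u p)
  ...   | ()

  matchings-empty : ∀ {n} (G : Graph n) (X : VSet n) → card X ≡ 0 → ∀ r → matchings G X (suc r) ≡ 0
  matchings-empty {n} G X e r = cong (λ es → count es (suc r))
    (trans (concatMap-cong′ (λ i → cong (map (λ j → (i , j))) (filterᵇ-none (none i) (allFin n))) (allFin n)) (nil (allFin n)))
    where
    none : ∀ i j → edgeᵇ G X i j ≡ false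
    none i j rewrite card-empty X e i = refl
    nil : ∀ (xs : List (Fin n)) → concatMap {B = Fin n × Fin n} (λ i → map (λ j → (i , j)) []) xs ≡ []
    nil [] = refl
    nil (x ∷ xs) = nil xs

  -- An r-matching covers 2r vertices. Needed because the matching polynomial stops at half the
  -- number of vertices, so that the sum for X-u may lack a term that the sum for X has.
  matchings-vanish : ∀ {n} (G : Graph n) c (X : VSet n) → card X ≡ c → ∀ r → c < r + r → matchings G X r ≡ 0
  matchings-vanish G zero X e (suc r) _ = matchings-empty G X e r
  matchings-vanish {n} G (suc c) X e (suc r) (s≤s c<) with card-positive X c e
  ... | u , u∈X = trans (matchings-rec G X u u∈X r) (cong₂ _+_
          (matchings-vanish G c (del₁ X u) ce (suc r) (≤-trans (n≤1+n _) (s≤s c<)))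
          (ℕΣ.∑-zero {n} pairs))
    where
    ce : card (del₁ X u) ≡ c
    ce = suc-injective (trans (sym (card-del₁ X u u∈X)) e)
    pairs : ∀ w → (if nbr G X u w then matchings G (del₂ X u w) r else 0) ≡ 0
    pairs w with nbr G X u w in p
    ... | false = refl
    ... | true = go c ce c<
      where
      c₂ = card-del₁ (del₁ X u) w (proj₁ (∧-true⁻ p))
      go : ∀ c → card (del₁ X u) ≡ c → suc c ≤ r + suc r → matchings G (del₂ X u w) r ≡ 0
      go zero ce _ with trans (sym ce) c₂
      ... | ()
      go (suc c) ce le = matchings-vanish G c (del₂ X u w) (suc-injective (trans (sym c₂) ce)) r
        (≤-pred (≤-trans le (≤-reflexive (+-suc r r))))

open MatchingCount
open import Data.Integer as ℤ using (ℤ; +_; -[1+_])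

-- Integers in a commutative ring, power series and their orders.

module CRing {c ℓ} (R : CommutativeRing c ℓ) where
  open CommutativeRing R
  open import Algebra.Properties.Ring ring using (-‿distribˡ-*; -‿distribʳ-*)
  open import Algebra.Properties.AbelianGroup +-abelianGroup using (⁻¹-∙-comm; ⁻¹-involutive; ε⁻¹≈ε)
  open import Relation.Binary.Reasoning.Setoid setoid

  natR-+ : ∀ a b → natR R (a ℕ.+ b) ≈ natR R a + natR R b
  natR-+ zero b = sym (+-identityˡ _)
  natR-+ (suc a) b = trans (+-congˡ (natR-+ a b)) (sym (+-assoc _ _ _))

  natR-* : ∀ a b → natR R (a ℕ.* b) ≈ natR R a * natR R b
  natR-* zero b = sym (zeroˡ _)
  natR-* (suc a) b = begin
    natR R (b ℕ.+ a ℕ.* b)             ≈⟨ natR-+ b (a ℕ.* b) ⟩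
    natR R b + natR R (a ℕ.* b)        ≈⟨ +-cong (sym (*-identityˡ _)) (natR-* a b) ⟩
    1# * natR R b + natR R a * natR R b ≈⟨ distribʳ _ _ _ ⟨
    (1# + natR R a) * natR R b         ∎

  ι : ℤ → Carrier
  ι (+ k)    = natR R k
  ι -[1+ k ] = - natR R (suc k)

  ι-cong : ∀ {a b} → a ≡ b → ι a ≈ ι b
  ι-cong ≡-refl = refl

  ι-1 : ι (+ 1) ≈ 1#
  ι-1 = +-identityʳ 1#

  ι-neg : ∀ a → ι (ℤ.- a) ≈ - ι a
  ι-neg (+ zero)  = sym ε⁻¹≈ε
  ι-neg (+ suc k) = refl
  ι-neg -[1+ k ]  = sym (⁻¹-involutive _)

  ι-⊖ : ∀ a b → ι (a ℤ.⊖ b) ≈ natR R a - natR R b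
  ι-⊖ a zero = sym (trans (+-congˡ ε⁻¹≈ε) (+-identityʳ _))
  ι-⊖ zero (suc b) = sym (+-identityˡ _)
  ι-⊖ (suc a) (suc b) = begin
    ι (suc a ℤ.⊖ suc b)                     ≈⟨ ι-cong (ℤₚ.[1+m]⊖[1+n]≡m⊖n a b) ⟩
    ι (a ℤ.⊖ b)                             ≈⟨ ι-⊖ a b ⟩
    natR R a - natR R b                     ≈⟨ +-identityʳ _ ⟨
    (natR R a - natR R b) + 0#              ≈⟨ +-congˡ (-‿inverseʳ 1#) ⟨
    (natR R a - natR R b) + (1# - 1#)       ≈⟨ +-comm _ _ ⟩
    (1# - 1#) + (natR R a - natR R b)       ≈⟨ +-assoc _ _ _ ⟩
    1# + (- 1# + (natR R a - natR R b))     ≈⟨ +-congˡ (sym (+-assoc _ _ _)) ⟩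
    1# + ((- 1# + natR R a) - natR R b)     ≈⟨ +-congˡ (+-congʳ (+-comm _ _)) ⟩
    1# + ((natR R a - 1#) - natR R b)       ≈⟨ +-congˡ (+-assoc _ _ _) ⟩
    1# + (natR R a + (- 1# - natR R b))     ≈⟨ +-assoc _ _ _ ⟨
    (1# + natR R a) + (- 1# - natR R b)     ≈⟨ +-congˡ (⁻¹-∙-comm _ _) ⟩
    (1# + natR R a) - (1# + natR R b)       ∎

  ι-+ : ∀ a b → ι (a ℤ.+ b) ≈ ι a + ι b
  ι-+ (+ a) (+ b) = natR-+ a b
  ι-+ (+ a) -[1+ b ] = ι-⊖ a (suc b)
  ι-+ -[1+ a ] (+ b) = trans (ι-⊖ b (suc a)) (+-comm _ _)
  ι-+ -[1+ a ] -[1+ b ] = begin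
    - natR R (suc (suc (a ℕ.+ b)))        ≈⟨ -‿cong (reflexive (cong (natR R) (cong suc (≡-sym (ℕₚ.+-suc a b))))) ⟩
    - natR R (suc a ℕ.+ suc b)            ≈⟨ -‿cong (natR-+ (suc a) (suc b)) ⟩
    - (natR R (suc a) + natR R (suc b))   ≈⟨ ⁻¹-∙-comm _ _ ⟨
    - natR R (suc a) - natR R (suc b)     ∎

  ι-*-pos : ∀ a b → ι (+ a ℤ.* b) ≈ natR R a * ι b
  ι-*-pos a (+ b) = trans (ι-cong (≡-sym (ℤₚ.pos-* a b))) (natR-* a b)
  ι-*-pos a -[1+ b ] = begin
    ι (+ a ℤ.* -[1+ b ])          ≈⟨ ι-cong (≡-sym (ℤₚ.neg-distribʳ-* (+ a) (+ suc b))) ⟩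
    ι (ℤ.- (+ a ℤ.* + suc b))     ≈⟨ ι-neg (+ a ℤ.* + suc b) ⟩
    - ι (+ a ℤ.* + suc b)         ≈⟨ -‿cong (ι-*-pos a (+ suc b)) ⟩
    - (natR R a * natR R (suc b)) ≈⟨ -‿distribʳ-* _ _ ⟩
    natR R a * - natR R (suc b)   ∎

  ι-* : ∀ a b → ι (a ℤ.* b) ≈ ι a * ι b
  ι-* (+ a) b = ι-*-pos a b
  ι-* -[1+ a ] b = begin
    ι (-[1+ a ] ℤ.* b)            ≈⟨ ι-cong (≡-sym (ℤₚ.neg-distribˡ-* (+ suc a) b)) ⟩
    ι (ℤ.- (+ suc a ℤ.* b))       ≈⟨ ι-neg (+ suc a ℤ.* b) ⟩
    - ι (+ suc a ℤ.* b)           ≈⟨ -‿cong (ι-*-pos (suc a) b) ⟩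
    - (natR R (suc a) * ι b)      ≈⟨ -‿distribˡ-* _ _ ⟩
    - natR R (suc a) * ι b        ∎

  ι-≟ : ∀ a b → Maybe (ι a ≈ ι b)
  ι-≟ a b with a ℤ.≟ b
  ... | yes ≡-refl = just refl
  ... | no _ = nothing

  ι-morphism : ℤ.+-*-rawRing -Raw-AlmostCommutative⟶ fromCommutativeRing R
  ι-morphism = record { ⟦_⟧ = ι ; +-homo = ι-+ ; *-homo = ι-* ; -‿homo = ι-neg ; 0-homo = refl ; 1-homo = ι-1 }

  module Solver = RingSolver ℤ.+-*-rawRing (fromCommutativeRing R)
    ι-morphism ι-≟

  open FinSum +-commutativeMonoid public


module Series {c ℓ} (R : CommutativeRing c ℓ) where
  open CommutativeRing R
  open CRing R using (module Solver)
  open Solver using (solve; _:+_; _:*_; _:=_)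
  open import Relation.Binary.Reasoning.Setoid setoid

  Ser : Set c
  Ser = ℕ → Carrier

  infix 4 _≋_
  infixl 6 _⊞_
  infixl 7 _⊛_
  _≋_ : Ser → Ser → Set ℓ
  f ≋ g = ∀ i → f i ≈ g i

  _⊞_ : Ser → Ser → Ser
  (f ⊞ g) i = f i + g i

  _⊛_ : Ser → Ser → Ser
  (f ⊛ g) zero    = f 0 * g 0
  (f ⊛ g) (suc n) = f 0 * g (suc n) + ((f ∘ suc) ⊛ g) n

  const : Carrier → Ser
  const a zero    = a
  const a (suc n) = 0#

  𝟘 : Ser
  𝟘 _ = 0#

  ⊛-cong : ∀ {f f′ g g′} → f ≋ f′ → g ≋ g′ → (f ⊛ g) ≋ (f′ ⊛ g′)
  ⊛-cong p q zero    = *-cong (p 0) (q 0)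
  ⊛-cong p q (suc n) = +-cong (*-cong (p 0) (q (suc n))) (⊛-cong (p ∘ suc) q n)

  ⊛-zeroˡ : ∀ f → (𝟘 ⊛ f) ≋ 𝟘
  ⊛-zeroˡ f zero    = zeroˡ _
  ⊛-zeroˡ f (suc n) = trans (+-cong (zeroˡ _) (⊛-zeroˡ f n)) (+-identityˡ _)

  const-⊛ : ∀ a f n → (const a ⊛ f) n ≈ a * f n
  const-⊛ a f zero    = refl
  const-⊛ a f (suc n) = trans (+-congˡ (⊛-zeroˡ f n)) (+-identityʳ _)

  ⊛-identityˡ : ∀ f → (const 1# ⊛ f) ≋ f
  ⊛-identityˡ f n = trans (const-⊛ 1# f n) (*-identityˡ _)

  ⊛-distribʳ : ∀ h f g → ((f ⊞ g) ⊛ h) ≋ ((f ⊛ h) ⊞ (g ⊛ h))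
  ⊛-distribʳ h f g zero = distribʳ _ _ _
  ⊛-distribʳ h f g (suc n) = trans (+-cong (distribʳ _ _ _) (⊛-distribʳ h (f ∘ suc) (g ∘ suc) n))
    (solve 4 (λ a b c d → (a :+ b) :+ (c :+ d) := (a :+ c) :+ (b :+ d)) refl _ _ _ _)

  ⊛-last : ∀ f g n → (f ⊛ g) (suc n) ≈ (f ⊛ (g ∘ suc)) n + f (suc n) * g 0
  ⊛-last f g zero = refl
  ⊛-last f g (suc n) = trans (+-congˡ (⊛-last (f ∘ suc) g n)) (sym (+-assoc _ _ _))

  ⊛-comm : ∀ f g → (f ⊛ g) ≋ (g ⊛ f)
  ⊛-comm f g zero = *-comm _ _
  ⊛-comm f g (suc n) = begin
    f 0 * g (suc n) + ((f ∘ suc) ⊛ g) n  ≈⟨ +-cong (*-comm _ _) (⊛-comm (f ∘ suc) g n) ⟩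
    g (suc n) * f 0 + (g ⊛ (f ∘ suc)) n  ≈⟨ +-comm _ _ ⟩
    (g ⊛ (f ∘ suc)) n + g (suc n) * f 0  ≈⟨ ⊛-last g f n ⟨
    (g ⊛ f) (suc n)                      ∎

  ⊛-scale : ∀ a f g n → ((λ i → a * f i) ⊛ g) n ≈ a * (f ⊛ g) n
  ⊛-scale a f g zero = *-assoc _ _ _
  ⊛-scale a f g (suc n) = trans (+-cong (*-assoc _ _ _) (⊛-scale a (f ∘ suc) g n)) (sym (distribˡ _ _ _))

  ⊛-assoc : ∀ f g h → ((f ⊛ g) ⊛ h) ≋ (f ⊛ (g ⊛ h))
  ⊛-assoc f g h zero = *-assoc _ _ _
  ⊛-assoc f g h (suc n) = begin
    (f 0 * g 0) * h (suc n) + (((λ i → f 0 * g (suc i)) ⊞ ((f ∘ suc) ⊛ g)) ⊛ h) n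
      ≈⟨ +-congˡ (⊛-distribʳ h (λ i → f 0 * g (suc i)) ((f ∘ suc) ⊛ g) n) ⟩
    (f 0 * g 0) * h (suc n) + (((λ i → f 0 * g (suc i)) ⊛ h) n + (((f ∘ suc) ⊛ g) ⊛ h) n)
      ≈⟨ +-congˡ (+-cong (⊛-scale (f 0) (g ∘ suc) h n) (⊛-assoc (f ∘ suc) g h n)) ⟩
    (f 0 * g 0) * h (suc n) + (f 0 * ((g ∘ suc) ⊛ h) n + ((f ∘ suc) ⊛ (g ⊛ h)) n)
      ≈⟨ solve 5 (λ a b c d e → (a :* b) :* c :+ (a :* d :+ e) := a :* (b :* c :+ d) :+ e) refl _ _ _ _ _ ⟩
    f 0 * (g 0 * h (suc n) + ((g ∘ suc) ⊛ h) n) + ((f ∘ suc) ⊛ (g ⊛ h)) n ∎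

  seriesRing : CommutativeRing c ℓ
  seriesRing = record
    { Carrier = Ser ; _≈_ = _≋_ ; _+_ = _⊞_ ; _*_ = _⊛_ ; -_ = λ f i → - f i ; 0# = 𝟘 ; 1# = const 1#
    ; isCommutativeRing = record
      { isRing = record
        { +-isAbelianGroup = Pointwise.isAbelianGroup ℕ +-isAbelianGroup
        ; *-cong = ⊛-cong
        ; *-assoc = ⊛-assoc
        ; *-identity = ⊛-identityˡ , λ f i → trans (⊛-comm f (const 1#) i) (⊛-identityˡ f i)
        ; distrib = (λ h f g i → trans (⊛-comm h (f ⊞ g) i) (trans (⊛-distribʳ h f g i) (+-cong (⊛-comm f h i) (⊛-comm g h i))))
                  , ⊛-distribʳ
        }
      ; *-comm = ⊛-comm
      }
    }

  Ord : ℕ → Ser → Set ℓ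
  Ord m f = ∀ i → i < m → f i ≈ 0#

  Ord-cong : ∀ {m f g} → f ≋ g → Ord m f → Ord m g
  Ord-cong e o i p = trans (sym (e i)) (o i p)

  Ord-≤ : ∀ {m m′ f} → m′ ≤ m → Ord m f → Ord m′ f
  Ord-≤ le o i p = o i (ℕₚ.≤-trans p le)

  Ord-suc : ∀ {m f} → Ord m f → f m ≈ 0# → Ord (suc m) f
  Ord-suc {m} o e i (s≤s p) with ℕₚ.m≤n⇒m<n∨m≡n p
  ... | inj₁ i<m = o i i<m
  ... | inj₂ ≡-refl = e

  Ord-⊞ : ∀ {m f g} → Ord m f → Ord m g → Ord m (f ⊞ g)
  Ord-⊞ o o′ i p = trans (+-cong (o i p) (o′ i p)) (+-identityˡ _)

  Ord-neg : ∀ {m f} → Ord m f → Ord m (λ i → - f i)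
  Ord-neg o i p = trans (-‿cong (o i p)) ε⁻¹≈ε
    where open import Algebra.Properties.AbelianGroup +-abelianGroup using (ε⁻¹≈ε)

  private
    ⊛-vanish : ∀ f g b → Ord (suc b) g → (f ⊛ g) b ≈ 0#
    ⊛-vanish f g zero o = trans (*-congˡ (o 0 (s≤s z≤n))) (zeroʳ _)
    ⊛-vanish f g (suc b) o = trans (+-cong (trans (*-congˡ (o (suc b) ℕₚ.≤-refl)) (zeroʳ _))
      (⊛-vanish (f ∘ suc) g b (Ord-≤ (ℕₚ.n≤1+n _) o))) (+-identityˡ _)

    ⊛-tail : ∀ f g n → f 0 ≈ 0# → (f ⊛ g) (suc n) ≈ ((f ∘ suc) ⊛ g) n
    ⊛-tail f g n e = trans (+-congʳ (trans (*-congʳ e) (zeroˡ _))) (+-identityˡ _)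

  ⊛-lead : ∀ {a b f g} → Ord a f → Ord b g → (f ⊛ g) (a ℕ.+ b) ≈ f a * g b
  ⊛-lead {zero} {zero} o o′ = refl
  ⊛-lead {zero} {suc b} {f} {g} o o′ = trans (+-congˡ (⊛-vanish (f ∘ suc) g b o′)) (+-identityʳ _)
  ⊛-lead {suc a} {b} {f} {g} o o′ = trans (⊛-tail f g (a ℕ.+ b) (o 0 (s≤s z≤n))) (⊛-lead {a} {b} (λ i p → o (suc i) (s≤s p)) o′)

  Ord-⊛ : ∀ {a b f g} → Ord a f → Ord b g → Ord (a ℕ.+ b) (f ⊛ g)
  Ord-⊛ {zero} {b} {f} {g} o o′ i p = ⊛-vanish f g i (Ord-≤ p o′)
  Ord-⊛ {suc a} {b} {f} {g} o o′ zero p = trans (*-congʳ (o 0 (s≤s z≤n))) (zeroˡ _)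
  Ord-⊛ {suc a} {b} {f} {g} o o′ (suc i) (s≤s p) =
    trans (⊛-tail f g i (o 0 (s≤s z≤n))) (Ord-⊛ {a} {b} (λ i p → o (suc i) (s≤s p)) o′ i p)

  𝕪 : Ser
  𝕪 zero    = 0#
  𝕪 (suc n) = const 1# n

  𝕪⊛-zero : ∀ f → (𝕪 ⊛ f) 0 ≈ 0#
  𝕪⊛-zero f = zeroˡ _

  𝕪⊛-suc : ∀ f n → (𝕪 ⊛ f) (suc n) ≈ f n
  𝕪⊛-suc f n = trans (⊛-tail 𝕪 f n refl) (⊛-identityˡ f n)

  D : Ser → Ser
  D f n = natR R (suc n) * f (suc n)

  Ord-D : ∀ {m f} → Ord (suc m) f → Ord m (D f)
  Ord-D o i p = trans (*-congˡ (o (suc i) (s≤s p))) (zeroʳ _)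

-- Expansion at θ, and multiplicity as order.

module Taylor {c ℓ} (F : CharZeroField c ℓ) (θ : CharZeroField.Carrier F) where
  open CharZeroField F hiding (zero)
  open Poly F
  open Series cring public
  module S = CommutativeRing seriesRing
  open CRing seriesRing using (module Solver)
  open Solver using (solve; _:+_; _:*_; _:=_; :-_)
  open import Algebra.Properties.Ring ring using (-‿distribˡ-*; -1*x≈-x)
  open import Algebra.Properties.AbelianGroup +-abelianGroup using (ε⁻¹≈ε; x∙y⁻¹≈ε⇒x≈y)

  𝕩 : Ser
  𝕩 = const θ ⊞ 𝕪

  𝕩⊛-zero : ∀ f → (𝕩 ⊛ f) 0 ≈ θ * f 0
  𝕩⊛-zero f = *-congʳ (+-identityʳ θ)

  𝕩⊛-suc : ∀ f n → (𝕩 ⊛ f) (suc n) ≈ θ * f (suc n) + f n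
  𝕩⊛-suc f n = trans (⊛-distribʳ f (const θ) 𝕪 (suc n)) (+-cong (const-⊛ θ f (suc n)) (𝕪⊛-suc f n))

  -- The product rule for the factor x alone; M is built from 1 by sums, signs and multiplication by
  -- x, so its derivative meets no other product.
  D-𝕩 : ∀ f → D (𝕩 ⊛ f) ≋ (f ⊞ (𝕩 ⊛ D f))
  D-𝕩 f zero = begin
    (1# + 0#) * (𝕩 ⊛ f) 1      ≈⟨ *-cong (+-identityʳ 1#) (𝕩⊛-suc f 0) ⟩
    1# * (θ * f 1 + f 0)       ≈⟨ *-identityˡ _ ⟩
    θ * f 1 + f 0              ≈⟨ +-comm _ _ ⟩
    f 0 + θ * f 1              ≈⟨ +-congˡ (*-congˡ (trans (*-congʳ (+-identityʳ 1#)) (*-identityˡ _))) ⟨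
    f 0 + θ * ((1# + 0#) * f 1) ≈⟨ +-congˡ (𝕩⊛-zero (D f)) ⟨
    f 0 + (𝕩 ⊛ D f) 0          ∎
    where open import Relation.Binary.Reasoning.Setoid setoid
  D-𝕩 f (suc n) = begin
    natR cring (suc (suc n)) * (𝕩 ⊛ f) (suc (suc n))      ≈⟨ *-congˡ (𝕩⊛-suc f (suc n)) ⟩
    (1# + k) * (θ * f (suc (suc n)) + f (suc n))
      ≈⟨ F.solve 5 (λ o k t a b → (o F.:+ k) F.:* (t F.:* a F.:+ b)
           F.:= o F.:* b F.:+ (t F.:* ((o F.:+ k) F.:* a) F.:+ k F.:* b)) refl _ _ _ _ _ ⟩
    1# * f (suc n) + (θ * ((1# + k) * f (suc (suc n))) + k * f (suc n)) ≈⟨ +-congʳ (*-identityˡ _) ⟩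
    f (suc n) + (θ * D f (suc n) + D f n)                 ≈⟨ +-congˡ (𝕩⊛-suc (D f) n) ⟨
    f (suc n) + (𝕩 ⊛ D f) (suc n)                         ∎
    where
    open import Relation.Binary.Reasoning.Setoid setoid
    module F = CRing.Solver cring
    k = natR cring (suc n)

  taylor : Pol → Ser
  taylor []      = 𝟘
  taylor (a ∷ p) = const a ⊞ (𝕩 ⊛ taylor p)

  const-⊞ : ∀ a b → const (a + b) ≋ (const a ⊞ const b)
  const-⊞ a b zero    = refl
  const-⊞ a b (suc n) = sym (+-identityˡ _)

  const-* : ∀ a b → const (a * b) ≋ (const a ⊛ const b)
  const-* a b zero    = refl
  const-* a b (suc n) = sym (trans (const-⊛ a (const b) (suc n)) (zeroʳ a))

  const-cong : ∀ {a b} → a ≈ b → const a ≋ const b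
  const-cong e zero    = e
  const-cong e (suc n) = refl

  const-0 : const 0# ≋ 𝟘
  const-0 zero    = refl
  const-0 (suc n) = refl

  open import Relation.Binary.Reasoning.Setoid S.setoid

  taylor-+ : ∀ p q → taylor (p +ₚ q) ≋ (taylor p ⊞ taylor q)
  taylor-+ [] q = S.sym (S.+-identityˡ _)
  taylor-+ (a ∷ p) [] = S.sym (S.+-identityʳ _)
  taylor-+ (a ∷ p) (b ∷ q) = begin
    const (a + b) ⊞ (𝕩 ⊛ taylor (p +ₚ q))              ≈⟨ S.+-cong (const-⊞ a b) (S.*-congˡ (taylor-+ p q)) ⟩
    (const a ⊞ const b) ⊞ (𝕩 ⊛ (taylor p ⊞ taylor q))
      ≈⟨ solve 5 (λ a b x p q → (a :+ b) :+ x :* (p :+ q) := (a :+ x :* p) :+ (b :+ x :* q)) S.refl _ _ _ _ _ ⟩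
    (const a ⊞ (𝕩 ⊛ taylor p)) ⊞ (const b ⊞ (𝕩 ⊛ taylor q)) ∎

  taylor-scale : ∀ a p → taylor (scale a p) ≋ (const a ⊛ taylor p)
  taylor-scale a [] = S.sym (S.zeroʳ _)
  taylor-scale a (b ∷ p) = begin
    const (a * b) ⊞ (𝕩 ⊛ taylor (scale a p))     ≈⟨ S.+-cong (const-* a b) (S.*-congˡ (taylor-scale a p)) ⟩
    (const a ⊛ const b) ⊞ (𝕩 ⊛ (const a ⊛ taylor p))
      ≈⟨ solve 4 (λ a b x p → a :* b :+ x :* (a :* p) := a :* (b :+ x :* p)) S.refl _ _ _ _ ⟩
    const a ⊛ (const b ⊞ (𝕩 ⊛ taylor p))         ∎

  taylor-0∷ : ∀ p → taylor (0# ∷ p) ≋ (𝕩 ⊛ taylor p)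
  taylor-0∷ p = S.trans (S.+-congʳ const-0) (S.+-identityˡ _)

  taylor-* : ∀ p q → taylor (p *ₚ q) ≋ (taylor p ⊛ taylor q)
  taylor-* [] q = S.sym (S.zeroˡ _)
  taylor-* (a ∷ p) q = begin
    taylor (scale a q +ₚ (0# ∷ (p *ₚ q)))           ≈⟨ taylor-+ (scale a q) (0# ∷ (p *ₚ q)) ⟩
    taylor (scale a q) ⊞ taylor (0# ∷ (p *ₚ q))     ≈⟨ S.+-cong (taylor-scale a q) (S.trans (taylor-0∷ (p *ₚ q)) (S.*-congˡ (taylor-* p q))) ⟩
    (const a ⊛ taylor q) ⊞ (𝕩 ⊛ (taylor p ⊛ taylor q))
      ≈⟨ solve 4 (λ a q x p → a :* q :+ x :* (p :* q) := (a :+ x :* p) :* q) S.refl _ _ _ _ ⟩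
    (const a ⊞ (𝕩 ⊛ taylor p)) ⊛ taylor q           ∎

  taylor-≈0 : ∀ p → (∀ i → coeff p i ≈ 0#) → taylor p ≋ 𝟘
  taylor-≈0 [] e = S.refl
  taylor-≈0 (a ∷ p) e = S.trans (S.+-cong (S.trans (const-cong (e 0)) const-0)
    (S.trans (S.*-congˡ (taylor-≈0 p (e ∘ suc))) (S.zeroʳ _))) (S.+-identityˡ _)

  taylor-cong : ∀ p q → p ≈ₚ q → taylor p ≋ taylor q
  taylor-cong [] q e = S.sym (taylor-≈0 q (λ i → sym (e i)))
  taylor-cong (a ∷ p) [] e = taylor-≈0 (a ∷ p) e
  taylor-cong (a ∷ p) (b ∷ q) e = S.+-cong (const-cong (e 0)) (S.*-congˡ (taylor-cong p q (e ∘ suc)))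

  taylor-∷-suc : ∀ a p n → taylor (a ∷ p) (suc n) ≈ θ * taylor p (suc n) + taylor p n
  taylor-∷-suc a p n = trans (+-identityˡ _) (𝕩⊛-suc (taylor p) n)

  taylor-degree : ∀ p n → length p ≤ n → taylor p n ≈ 0#
  taylor-degree [] n le = refl
  taylor-degree (a ∷ p) (suc n) (s≤s le) = trans (taylor-∷-suc a p n)
    (trans (+-cong (trans (*-congˡ (taylor-degree p (suc n) (ℕₚ.m≤n⇒m≤1+n le))) (zeroʳ θ)) (taylor-degree p n le)) (+-identityˡ _))

  -- The coefficients vanish from the top degree downwards.
  taylor-injective₀ : ∀ p → taylor p ≋ 𝟘 → ∀ i → coeff p i ≈ 0#
  taylor-injective₀ [] e i = refl
  taylor-injective₀ (a ∷ p) e = λ { zero → a≈0 ; (suc i) → taylor-injective₀ p tp≈0 i }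
    where
    step : ∀ n → taylor p (suc n) ≈ 0# → taylor p n ≈ 0#
    step n h = trans (trans (sym (+-identityˡ _)) (+-congʳ (sym (trans (*-congˡ h) (zeroʳ θ)))))
                     (trans (sym (taylor-∷-suc a p n)) (e (suc n)))
    down : ∀ d n → length p ≤ d ℕ.+ n → taylor p n ≈ 0#
    down zero n le = taylor-degree p n le
    down (suc d) n le = step n (down d (suc n) (≡-subst (length p ≤_) (≡-sym (ℕₚ.+-suc d n)) le))
    tp≈0 : taylor p ≋ 𝟘
    tp≈0 n = down (length p) n (ℕₚ.m≤m+n _ n)
    a≈0 : a ≈ 0#
    a≈0 = trans (trans (sym (+-identityʳ a)) (+-congˡ (sym (trans (𝕩⊛-zero (taylor p)) (trans (*-congˡ (tp≈0 0)) (zeroʳ θ)))))) (e 0)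

  coeff-+ : ∀ p q i → coeff (p +ₚ q) i ≈ coeff p i + coeff q i
  coeff-+ [] q i = sym (+-identityˡ _)
  coeff-+ (a ∷ p) [] i = sym (+-identityʳ _)
  coeff-+ (a ∷ p) (b ∷ q) zero = refl
  coeff-+ (a ∷ p) (b ∷ q) (suc i) = coeff-+ p q i

  coeff-scale : ∀ a p i → coeff (scale a p) i ≈ a * coeff p i
  coeff-scale a [] i = sym (zeroʳ a)
  coeff-scale a (b ∷ p) zero = refl
  coeff-scale a (b ∷ p) (suc i) = coeff-scale a p i

  taylor-injective : ∀ p q → taylor p ≋ taylor q → p ≈ₚ q
  taylor-injective p q e i = x∙y⁻¹≈ε⇒x≈y _ _ (trans
    (sym (trans (coeff-+ p (scale (- 1#) q) i) (+-congˡ (trans (coeff-scale (- 1#) q i) (-1*x≈-x _)))))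
    (taylor-injective₀ (p +ₚ scale (- 1#) q) zer i))
    where
    zer : taylor (p +ₚ scale (- 1#) q) ≋ 𝟘
    zer n = trans (taylor-+ p (scale (- 1#) q) n) (trans (+-cong (e n)
      (trans (taylor-scale (- 1#) q n) (trans (const-⊛ (- 1#) (taylor q) n) (-1*x≈-x _)))) (-‿inverseʳ _))

  taylor-linear : taylor (linear θ) ≋ 𝕪
  taylor-linear zero = trans (+-congˡ (trans (𝕩⊛-zero (taylor (1# ∷ []))) (trans (*-congˡ (trans (+-congˡ (zeroʳ _)) (+-identityʳ 1#))) (*-identityʳ θ)))) (-‿inverseˡ θ)
  taylor-linear (suc n) = trans (taylor-∷-suc (- θ) (1# ∷ []) n)
    (trans (+-cong (trans (*-congˡ (trans (+-congˡ (S.zeroʳ 𝕩 (suc n))) (+-identityʳ _))) (zeroʳ θ)) (trans (+-congˡ (S.zeroʳ 𝕩 n)) (+-identityʳ _))) (+-identityˡ _))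

  -- Synthetic division by the linear factor, which expands to y.
  quotient : ∀ p → ∃[ g ] ∃[ r ] (taylor p ≋ ((𝕪 ⊛ taylor g) ⊞ const r))
  quotient [] = [] , 0# , S.sym (S.trans (S.+-cong (S.zeroʳ 𝕪) const-0) (S.+-identityˡ _))
  quotient (a ∷ p) with quotient p
  ... | g , r , e = r ∷ g , a + θ * r , (begin
    const a ⊞ (𝕩 ⊛ taylor p)    ≈⟨ S.+-congˡ (S.*-congˡ e) ⟩
    const a ⊞ ((const θ ⊞ 𝕪) ⊛ ((𝕪 ⊛ taylor g) ⊞ const r))
      ≈⟨ solve 5 (λ a t y g r → a :+ (t :+ y) :* (y :* g :+ r) := y :* (r :+ (t :+ y) :* g) :+ (a :+ t :* r)) S.refl _ _ _ _ _ ⟩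
    (𝕪 ⊛ (const r ⊞ (𝕩 ⊛ taylor g))) ⊞ (const a ⊞ (const θ ⊛ const r))
      ≈⟨ S.+-congˡ (S.trans (const-⊞ a (θ * r)) (S.+-congˡ (const-* θ r))) ⟨
    (𝕪 ⊛ taylor (r ∷ g)) ⊞ const (a + θ * r) ∎)

  taylor-1∷[] : taylor (1# ∷ []) ≋ const 1#
  taylor-1∷[] = S.trans (S.+-congˡ (S.zeroʳ 𝕩)) (S.+-identityʳ _)

  Ord-linear^ : ∀ k → Ord k (taylor (linear θ ^ₚ k))
  Ord-linear^ zero i ()
  Ord-linear^ (suc k) = Ord-cong (S.sym (taylor-* (linear θ) (linear θ ^ₚ k)))
    (Ord-⊛ {1} {k} (Ord-cong (S.sym taylor-linear) (λ { zero _ → refl ; (suc _) (s≤s ()) })) (Ord-linear^ k))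

  Divides⇒Ord : ∀ k p → Divides θ k p → Ord k (taylor p)
  Divides⇒Ord k p (g , e) = ≡-subst (λ m → Ord m (taylor p)) (ℕₚ.+-identityʳ k)
    (Ord-cong (S.sym (S.trans (taylor-cong p ((linear θ ^ₚ k) *ₚ g) e) (taylor-* (linear θ ^ₚ k) g))) (Ord-⊛ {k} {0} (Ord-linear^ k) (λ _ ())))

  -- A positive order makes the remainder vanish, so one linear factor splits off and leaves a
  -- quotient of order one less. Injectivity of the expansion turns equality of series into equality
  -- of coefficients.
  Ord⇒Divides : ∀ k p → Ord k (taylor p) → Divides θ k p
  Ord⇒Divides zero p o = p , taylor-injective p ((1# ∷ []) *ₚ p)
    (S.sym (S.trans (taylor-* (1# ∷ []) p) (S.trans (S.*-congʳ taylor-1∷[]) (S.*-identityˡ _))))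
  Ord⇒Divides (suc k) p o with quotient p
  ... | g , r , e = h , taylor-injective p ((linear θ ^ₚ suc k) *ₚ h) (begin
        taylor p                                              ≈⟨ e′ ⟩
        𝕪 ⊛ taylor g                                          ≈⟨ S.*-cong (S.sym taylor-linear) (taylor-cong g ((linear θ ^ₚ k) *ₚ h) g≈) ⟩
        taylor (linear θ) ⊛ taylor ((linear θ ^ₚ k) *ₚ h)      ≈⟨ S.*-congˡ (taylor-* (linear θ ^ₚ k) h) ⟩
        taylor (linear θ) ⊛ (taylor (linear θ ^ₚ k) ⊛ taylor h) ≈⟨ S.*-assoc _ _ _ ⟨
        (taylor (linear θ) ⊛ taylor (linear θ ^ₚ k)) ⊛ taylor h ≈⟨ S.*-congʳ (taylor-* (linear θ) (linear θ ^ₚ k)) ⟨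
        taylor (linear θ ^ₚ suc k) ⊛ taylor h                 ≈⟨ taylor-* (linear θ ^ₚ suc k) h ⟨
        taylor ((linear θ ^ₚ suc k) *ₚ h)                     ∎)
    where
    r≈0 : r ≈ 0#
    r≈0 = trans (sym (trans (e 0) (trans (+-congʳ (𝕪⊛-zero (taylor g))) (+-identityˡ r)))) (o 0 (s≤s z≤n))
    e′ : taylor p ≋ (𝕪 ⊛ taylor g)
    e′ = S.trans e (S.trans (S.+-congˡ (S.trans (const-cong r≈0) const-0)) (S.+-identityʳ _))
    d : Divides θ k g
    d = Ord⇒Divides k g (λ i i<k → trans (sym (𝕪⊛-suc (taylor g) i)) (trans (sym (e′ (suc i))) (o (suc i) (s≤s i<k))))
    h = proj₁ d
    g≈ = proj₂ d

  HasVal : Ser → ℕ → Set ℓ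
  HasVal f k = Ord k f × ¬ (f k ≈ 0#)

  IsMult⇒HasVal : ∀ p k → IsMult θ p k → HasVal (taylor p) k
  IsMult⇒HasVal p k (d , ¬d) = Divides⇒Ord k p d , λ e → ¬d (Ord⇒Divides (suc k) p (Ord-suc (Divides⇒Ord k p d) e))

  HasVal⇒IsMult : ∀ p k → HasVal (taylor p) k → IsMult θ p k
  HasVal⇒IsMult p k (o , ne) = Ord⇒Divides k p o , λ d → ne (Divides⇒Ord (suc k) p d k ℕₚ.≤-refl)

-- The vertex recursion of the expanded matching polynomial.

module MatchingSeries {c ℓ} (F : CharZeroField c ℓ) (θ : CharZeroField.Carrier F) where
  open CharZeroField F hiding (zero)
  open Poly F
  open Taylor F θ
  open CRing seriesRing using (module Solver; ∑; ∑-zero; ∑-cong)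
  open CRing cring using (ι; ι-neg; natR-+)
  open Solver using (solve; _:+_; _:*_; _:=_; :-_; _:-_)
  open import Relation.Binary.Reasoning.Setoid S.setoid
  open import Algebra.Properties.AbelianGroup S.+-abelianGroup using (ε⁻¹≈ε; ⁻¹-∙-comm)

  nat : ℕ → Ser
  nat k = const (natR cring k)

  𝕩^ : ℕ → Ser
  𝕩^ zero    = const 1#
  𝕩^ (suc k) = 𝕩 ⊛ 𝕩^ k

  -- The sum of (-1)^r m_r x^(c-2r) over 2r ≤ c. Recursion in steps of two avoids the truncated
  -- subtraction in `μ`.
  altSum : ℕ → (ℕ → ℕ) → Ser
  altSum 0 m = nat (m 0)
  altSum 1 m = 𝕩 ⊛ nat (m 0)
  altSum (suc (suc c)) m = (𝕩^ (suc (suc c)) ⊛ nat (m 0)) ⊞ (S.- altSum c (m ∘ suc))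

  nat-≡ : ∀ {a b} → a ≡ b → nat a ≋ nat b
  nat-≡ ≡-refl = S.refl

  altSum-cong : ∀ c {m m′} → m ≗ m′ → altSum c m ≋ altSum c m′
  altSum-cong 0 e = nat-≡ (e 0)
  altSum-cong 1 e = S.*-congˡ (nat-≡ (e 0))
  altSum-cong (suc (suc c)) e = S.+-cong (S.*-congˡ (nat-≡ (e 0))) (S.-‿cong (altSum-cong c (e ∘ suc)))

  altSum-+ : ∀ c m m′ → altSum c (λ r → m r ℕ.+ m′ r) ≋ (altSum c m ⊞ altSum c m′)
  altSum-+ 0 m m′ = S.trans (const-cong (natR-+ (m 0) (m′ 0))) (const-⊞ _ _)
  altSum-+ 1 m m′ = S.trans (S.*-congˡ (altSum-+ 0 m m′)) (S.distribˡ _ _ _)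
  altSum-+ (suc (suc c)) m m′ = S.trans
    (S.+-cong (S.*-congˡ (altSum-+ 0 m m′)) (S.-‿cong (altSum-+ c (m ∘ suc) (m′ ∘ suc))))
    (solve 5 (λ x a b p q → x :* (a :+ b) :+ (:- (p :+ q)) := (x :* a :+ (:- p)) :+ (x :* b :+ (:- q))) S.refl _ _ _ _ _)

  altSum-0 : ∀ c → altSum c (λ _ → 0) ≋ 𝟘
  altSum-0 0 = const-0
  altSum-0 1 = S.trans (S.*-congˡ const-0) (S.zeroʳ _)
  altSum-0 (suc (suc c)) = S.trans (S.+-cong (S.trans (S.*-congˡ const-0) (S.zeroʳ _)) (S.trans (S.-‿cong (altSum-0 c)) ε⁻¹≈ε)) (S.+-identityˡ _)

  altSum-∑ : ∀ c {n} (m : Fin n → ℕ → ℕ) → altSum c (λ r → ℕΣ.∑ (λ w → m w r)) ≋ ∑ (λ w → altSum c (m w))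
  altSum-∑ c {zero} m = altSum-0 c
  altSum-∑ c {suc n} m = S.trans (altSum-+ c (m Fin.zero) (λ r → ℕΣ.∑ (λ w → m (suc w) r))) (S.+-congˡ (altSum-∑ c (m ∘ suc)))

  -- The left side has one term more exactly when `c` is odd, namely that with 2r = c + 1, and the
  -- hypothesis makes its coefficient 0.
  altSum-suc : ∀ c m → (∀ r → c < r ℕ.+ r → m r ≡ 0) → altSum (suc c) m ≋ (𝕩 ⊛ altSum c m)
  altSum-suc 0 m v = S.refl
  altSum-suc 1 m v = S.trans (S.+-cong (S.trans (S.*-congʳ (S.*-congˡ (S.trans (S.*-comm _ _) (S.*-identityˡ _)))) (S.*-assoc _ _ _))
    (S.trans (S.-‿cong (S.trans (nat-≡ (v 1 ℕₚ.≤-refl)) const-0)) ε⁻¹≈ε)) (S.+-identityʳ _)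
  altSum-suc (suc (suc c)) m v = S.trans
    (S.+-congˡ (S.-‿cong (altSum-suc c (m ∘ suc) (λ r p → v (suc r) (s≤s (≡-subst (suc (suc c) ≤_) (≡-sym (ℕₚ.+-suc r r)) (s≤s p)))))))
    (solve 4 (λ x y a p → (x :* y) :* a :+ (:- (x :* p)) := x :* (y :* a :+ (:- p))) S.refl _ _ _ _)

  taylor-monomial : ∀ a k → taylor (monomial a k) ≋ (𝕩^ k ⊛ const a)
  taylor-monomial a zero = S.trans (S.trans (S.+-congˡ (S.zeroʳ 𝕩)) (S.+-identityʳ _)) (S.sym (S.*-identityˡ _))
  taylor-monomial a (suc k) = S.trans (taylor-0∷ (monomial a k)) (S.trans (S.*-congˡ (taylor-monomial a k)) (S.sym (S.*-assoc _ _ _)))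

  upToSum : (ℕ → Pol) → ℕ → Ser
  upToSum h k = taylor (foldr _+ₚ_ [] (map h (upTo k)))

  upToSum-suc : ∀ h k → upToSum h (suc k) ≋ (taylor (h 0) ⊞ upToSum (h ∘ suc) k)
  upToSum-suc h k = S.trans (taylor-+ (h 0) (foldr _+ₚ_ [] (map h (applyUpTo suc k))))
    (S.+-congˡ (S.reflexive (cong (λ l → taylor (foldr _+ₚ_ [] l))
      (≡-trans (map-applyUpTo suc h k) (≡-sym (map-applyUpTo id (h ∘ suc) k))))))

  upToSum-neg : ∀ k h h′ → (∀ r → taylor (h r) ≋ (S.- taylor (h′ r))) → upToSum h k ≋ (S.- upToSum h′ k)
  upToSum-neg zero h h′ e = S.sym ε⁻¹≈ε
  upToSum-neg (suc k) h h′ e = begin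
    upToSum h (suc k)                                   ≈⟨ upToSum-suc h k ⟩
    taylor (h 0) ⊞ upToSum (h ∘ suc) k                  ≈⟨ S.+-cong (e 0) (upToSum-neg k (h ∘ suc) (h′ ∘ suc) (e ∘ suc)) ⟩
    (S.- taylor (h′ 0)) ⊞ (S.- upToSum (h′ ∘ suc) k)    ≈⟨ ⁻¹-∙-comm _ _ ⟩
    S.- (taylor (h′ 0) ⊞ upToSum (h′ ∘ suc) k)          ≈⟨ S.-‿cong (upToSum-suc h′ k) ⟨
    S.- upToSum h′ (suc k)                              ∎

  term : ℕ → (ℕ → ℕ) → ℕ → Pol
  term c m r = monomial (intF (signed r (m r))) (c ∸ (2 ℕ.* r))

  intF-neg : ∀ z → intF (ℤ.- z) ≈ - intF z
  intF-neg (+ zero)  = ι-neg (+ zero)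
  intF-neg (+ suc k) = ι-neg (+ suc k)
  intF-neg -[1+ k ]  = ι-neg -[1+ k ]

  const-neg : ∀ a → const (- a) ≋ (S.- const a)
  const-neg a zero = refl
  const-neg a (suc n) = sym F-ε
    where open import Algebra.Properties.AbelianGroup +-abelianGroup using () renaming (ε⁻¹≈ε to F-ε)

  term-suc : ∀ c m r → taylor (term (suc (suc c)) m (suc r)) ≋ (S.- taylor (term c (m ∘ suc) r))
  term-suc c m r = begin
    taylor (term (suc (suc c)) m (suc r))
      ≈⟨ S.reflexive (cong (λ e → taylor (monomial (intF (ℤ.- signed r (m (suc r)))) (suc (suc c) ∸ e))) (ℕₚ.*-suc 2 r)) ⟩
    taylor (monomial (intF (ℤ.- signed r (m (suc r)))) (c ∸ 2 ℕ.* r))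
      ≈⟨ taylor-monomial _ (c ∸ 2 ℕ.* r) ⟩
    𝕩^ (c ∸ 2 ℕ.* r) ⊛ const (intF (ℤ.- signed r (m (suc r))))
      ≈⟨ S.*-congˡ (S.trans (const-cong (intF-neg (signed r (m (suc r))))) (const-neg _)) ⟩
    𝕩^ (c ∸ 2 ℕ.* r) ⊛ (S.- const (intF (signed r (m (suc r)))))
      ≈⟨ solve 2 (λ x a → x :* (:- a) := :- (x :* a)) S.refl _ _ ⟩
    S.- (𝕩^ (c ∸ 2 ℕ.* r) ⊛ const (intF (signed r (m (suc r)))))
      ≈⟨ S.-‿cong (taylor-monomial _ (c ∸ 2 ℕ.* r)) ⟨
    S.- taylor (term c (m ∘ suc) r) ∎

  altSum-upTo : ∀ c m → upToSum (term c m) (suc ⌊ c /2⌋) ≋ altSum c m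
  altSum-upTo 0 m = S.trans (upToSum-suc (term 0 m) 0) (S.trans (S.+-identityʳ _)
    (S.trans (taylor-monomial _ 0) (S.*-identityˡ _)))
  altSum-upTo 1 m = S.trans (upToSum-suc (term 1 m) 0) (S.trans (S.+-identityʳ _)
    (S.trans (taylor-monomial _ 1) (S.*-congʳ (S.trans (S.*-comm _ _) (S.*-identityˡ _)))))
  altSum-upTo (suc (suc c)) m = S.trans (upToSum-suc (term (suc (suc c)) m) (suc ⌊ c /2⌋))
    (S.+-cong (taylor-monomial _ (suc (suc c)))
      (S.trans (upToSum-neg (suc ⌊ c /2⌋) (term (suc (suc c)) m ∘ suc) (term c (m ∘ suc)) (term-suc c m)) (S.-‿cong (altSum-upTo c (m ∘ suc)))))

  module _ {n : ℕ} (G : Graph n) where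

    M : VSet n → Ser
    M X = taylor (μ G X)

    M-altSum : ∀ X c → card X ≡ c → M X ≋ altSum c (matchings G X)
    M-altSum X c ≡-refl = altSum-upTo (card X) (matchings G X)

    M-cong : ∀ {X Y} → X ≗ Y → M X ≋ M Y
    M-cong {X} {Y} e = begin
      M X                              ≈⟨ M-altSum X _ ≡-refl ⟩
      altSum (card X) (matchings G X)  ≈⟨ altSum-cong (card X) (matchings-≗ G e) ⟩
      altSum (card X) (matchings G Y)  ≈⟨ M-altSum Y _ (card-≗ (λ w → ≡-sym (e w))) ⟨
      M Y                              ∎

    M-empty : ∀ X → card X ≡ 0 → M X ≋ const 1#
    M-empty X e = S.trans (M-altSum X 0 e) (const-cong (+-identityʳ 1#))

    nbrSum : VSet n → Fin n → Ser
    nbrSum X u = ∑ (λ w → if nbr G X u w then M (del₂ X u w) else 𝟘)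

    M-rec : ∀ X u → u ∈ᵥ X → M X ≋ ((𝕩 ⊛ M (del₁ X u)) ⊞ (S.- nbrSum X u))
    M-rec X u u∈X = by (card (del₁ X u)) ≡-refl
      where
      Y = del₁ X u
      cX : ∀ {c} → card Y ≡ c → card X ≡ suc c
      cX e = ≡-trans (card-del₁ X u u∈X) (cong suc e)
      cZ : ∀ {c} w → nbr G X u w ≡ true → card Y ≡ suc c → card (del₂ X u w) ≡ c
      cZ w p e = ℕₚ.suc-injective (≡-trans (≡-sym (card-del₁ Y w (proj₁ (∧-true⁻ p)))) e)
      m-if : ∀ c w → altSum c (λ r → if nbr G X u w then matchings G (del₂ X u w) r else 0)
           ≋ (if nbr G X u w then altSum c (matchings G (del₂ X u w)) else 𝟘)
      m-if c w with nbr G X u w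
      ... | true  = S.refl
      ... | false = altSum-0 c
      by : ∀ c → card Y ≡ c → M X ≋ ((𝕩 ⊛ M Y) ⊞ (S.- nbrSum X u))
      by zero e = begin
        M X                   ≈⟨ M-altSum X 1 (cX e) ⟩
        𝕩 ⊛ nat 1             ≈⟨ S.*-congˡ (M-altSum Y 0 e) ⟨
        𝕩 ⊛ M Y               ≈⟨ S.+-identityʳ _ ⟨
        (𝕩 ⊛ M Y) ⊞ 𝟘         ≈⟨ S.+-congˡ (S.trans (S.-‿cong (∑-zero none)) ε⁻¹≈ε) ⟨
        (𝕩 ⊛ M Y) ⊞ (S.- nbrSum X u) ∎
        where
        none : ∀ w → (if nbr G X u w then M (del₂ X u w) else 𝟘) ≋ 𝟘
        none w rewrite card-empty Y e w = S.refl
      by (suc c) e = begin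
        M X ≈⟨ M-altSum X (suc (suc c)) (cX e) ⟩
        (𝕩^ (suc (suc c)) ⊛ nat 1) ⊞ (S.- altSum c (matchings G X ∘ suc))
          ≈⟨ S.+-congˡ (S.-‿cong (S.trans (altSum-cong c (matchings-rec G X u u∈X))
               (altSum-+ c (matchings G Y ∘ suc) (λ r → ℕΣ.∑ (λ w → if nbr G X u w then matchings G (del₂ X u w) r else 0))))) ⟩
        (𝕩^ (suc (suc c)) ⊛ nat 1) ⊞ (S.- (altSum c (matchings G Y ∘ suc) ⊞ altSum c (λ r → ℕΣ.∑ (λ w → if nbr G X u w then matchings G (del₂ X u w) r else 0))))
          ≈⟨ solve 3 (λ a b d → a :+ (:- (b :+ d)) := (a :+ (:- b)) :+ (:- d)) S.refl _ _ _ ⟩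
        altSum (suc (suc c)) (matchings G Y) ⊞ (S.- altSum c (λ r → ℕΣ.∑ (λ w → if nbr G X u w then matchings G (del₂ X u w) r else 0)))
          ≈⟨ S.+-cong (altSum-suc (suc c) (matchings G Y) (matchings-vanish G (suc c) Y e))
                      (S.-‿cong (S.trans (altSum-∑ c (λ w r → if nbr G X u w then matchings G (del₂ X u w) r else 0)) (∑-cong {n} tm))) ⟩
        (𝕩 ⊛ altSum (suc c) (matchings G Y)) ⊞ (S.- nbrSum X u)
          ≈⟨ S.+-congʳ (S.*-congˡ (M-altSum Y (suc c) e)) ⟨
        (𝕩 ⊛ M Y) ⊞ (S.- nbrSum X u) ∎
        where
        tm : ∀ w → altSum c (λ r → if nbr G X u w then matchings G (del₂ X u w) r else 0)
                 ≋ (if nbr G X u w then M (del₂ X u w) else 𝟘)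
        tm w = S.trans (m-if c w) (caseᵇ (nbr G X u w)
          (λ p → ≡-subst (λ b → (if b then altSum c (matchings G (del₂ X u w)) else 𝟘) ≋ (if b then M (del₂ X u w) else 𝟘))
                   (≡-sym p) (S.sym (M-altSum (del₂ X u w) c (cZ w p e))))
          (λ p → ≡-subst (λ b → (if b then altSum c (matchings G (del₂ X u w)) else 𝟘) ≋ (if b then M (del₂ X u w) else 𝟘))
                   (≡-sym p) S.refl))

  M-graph : ∀ {n} (G G′ : Graph n) X → (∀ i j → X i ∧ X j ∧ adj G i j ≡ X i ∧ X j ∧ adj G′ i j) → M G X ≋ M G′ X
  M-graph G G′ X e = S.trans (M-altSum G X _ ≡-refl)
    (S.trans (altSum-cong (card X) (matchings-cong {G = G} {G′} {X} {X} e)) (S.sym (M-altSum G′ X _ ≡-refl)))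

-- Vertex sets under deletion, and paths through the vertices that they leave.

nbr-del₁ : ∀ {n} (G : Graph n) X v u w → nbr G (del₁ X v) u w ≡ nbr G X u w ∧ (w ≠ᵇ v)
nbr-del₁ G X v u w = bool (X w) (w ≠ᵇ v) (w ≠ᵇ u) (adj G u w)
  where
  bool : ∀ a b c d → ((a ∧ b) ∧ c) ∧ d ≡ ((a ∧ c) ∧ d) ∧ b
  bool false b c d = ≡-refl
  bool true b c d = ≡-trans (∧-assoc b c d) (∧-comm b (c ∧ d))

_∩ᵥ_ : ∀ {n} → VSet n → VSet n → VSet n
(X ∩ᵥ C) w = X w ∧ C w

∧-rotate : ∀ a b c → (a ∧ b) ∧ c ≡ (a ∧ c) ∧ b
∧-rotate a b c = ≡-trans (∧-assoc a b c) (≡-trans (cong (a ∧_) (∧-comm b c)) (≡-sym (∧-assoc a c b)))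

del₁-∩ : ∀ {n} (X C : VSet n) u → (del₁ X u ∩ᵥ C) ≗ del₁ (X ∩ᵥ C) u
del₁-∩ X C u w = ∧-rotate (X w) (w ≠ᵇ u) (C w)

del₁-∖ : ∀ {n} (X C : VSet n) u → C u ≡ true → (del₁ X u ∖ C) ≗ (X ∖ C)
del₁-∖ X C u u∈C w with w ≟ᶠ u
... | yes ≡-refl rewrite u∈C | ∧-zeroʳ (X w) = ≡-refl
... | no _ = cong (_∧ not (C w)) (∧-identityʳ (X w))

nbr-∩ : ∀ {n} (G : Graph n) (X C : VSet n) u w → nbr G (X ∩ᵥ C) u w ≡ nbr G X u w ∧ C w
nbr-∩ G X C u w = ≡-trans (cong (_∧ adj G u w) (∧-rotate (X w) (C w) (w ≠ᵇ u))) (∧-rotate (del₁ X u w) (C w) (adj G u w))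

concatFin : ∀ {A : Set} {n} → (Fin n → List A) → List A
concatFin {n = zero}  f = []
concatFin {n = suc n} f = f zero ++ concatFin (f ∘ suc)

∈-concatFin : ∀ {A : Set} {n} {a : A} (f : Fin n → List A) w → a ∈ f w → a ∈ concatFin f
∈-concatFin f zero    p = ∈-++⁺ˡ p
∈-concatFin f (suc w) p = ∈-++⁺ʳ (f zero) (∈-concatFin (f ∘ suc) w p)

∈-del₁ : ∀ {n} (X : VSet n) {u w} → w ∈ᵥ X → w ≢ u → w ∈ᵥ del₁ X u
∈-del₁ X w∈X w≢u = ∧-true⁺ w∈X (≠ᵇ-≢ w≢u)

module _ {n : ℕ} (G : Graph n) where

  -- PathTo X u v Z: some path from u to v in G[X] has exactly the vertices of X outside Z.
  data PathTo : VSet n → Fin n → Fin n → VSet n → Set where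
    last : ∀ {X u v} → nbr G X u v ≡ true → PathTo X u v (del₂ X u v)
    step : ∀ {X u v w Z} → nbr G X u w ≡ true → w ≢ v → PathTo (del₁ X u) w v Z → PathTo X u v Z

  PathTo-≗ : ∀ {X X′ u v Z} → X ≗ X′ → PathTo X u v Z → ∃[ Z′ ] (Z ≗ Z′ × PathTo X′ u v Z′)
  PathTo-≗ {X′ = X′} {u} {v} e (last p) = del₂ X′ u v , del₁-≗ (del₁-≗ e u) v ,
    last (≡-trans (≡-sym (cong (_∧ adj G u v) (del₁-≗ e u v))) p)
  PathTo-≗ {u = u} e (step {w = w} p w≢v q) with PathTo-≗ (del₁-≗ e u) q
  ... | Z′ , eq , q′ = Z′ , eq , step (≡-trans (≡-sym (cong (_∧ adj G u w) (del₁-≗ e u w))) p) w≢v q′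

module RingSums {c ℓ} (R : CommutativeRing c ℓ) where
  open CommutativeRing R hiding (zero)
  open CRing R public using (module Solver; ∑; ∑-zero; ∑-single; ∑-cong; ∑-comm) renaming (∑-distrib-+ to ∑-+)
  open import Algebra.Properties.Semiring.Sum semiring using (*-distribˡ-sum; *-distribʳ-sum)
  open import Algebra.Properties.AbelianGroup +-abelianGroup using (ε⁻¹≈ε; ⁻¹-∙-comm)

  ∑-neg : ∀ {n} (f : Fin n → Carrier) → - ∑ f ≈ ∑ (λ i → - f i)
  ∑-neg {zero}  f = ε⁻¹≈ε
  ∑-neg {suc n} f = trans (sym (⁻¹-∙-comm _ _)) (+-congˡ (∑-neg (f ∘ suc)))

  ∑-- : ∀ {n} (f g : Fin n → Carrier) → ∑ f - ∑ g ≈ ∑ (λ i → f i - g i)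
  ∑-- f g = trans (+-congˡ (∑-neg g)) (sym (∑-+ f (λ i → - g i)))

  ∑-*ˡ : ∀ {n} a (f : Fin n → Carrier) → a * ∑ f ≈ ∑ (λ i → a * f i)
  ∑-*ˡ = *-distribˡ-sum

  ∑-*ʳ : ∀ {n} a (f : Fin n → Carrier) → ∑ f * a ≈ ∑ (λ i → f i * a)
  ∑-*ʳ = *-distribʳ-sum

  on : Bool → Carrier → Carrier
  on b a = if b then a else 0#

  on-true : ∀ {b a} → b ≡ true → on b a ≈ a
  on-true ≡-refl = refl

  on-false : ∀ {b a} → b ≡ false → on b a ≈ 0#
  on-false ≡-refl = refl

  on-cong : ∀ {b a a′} → (b ≡ true → a ≈ a′) → on b a ≈ on b a′
  on-cong {true}  e = e ≡-refl
  on-cong {false} e = refl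

  on-cong₂ : ∀ {b b′ a a′} → b ≡ b′ → (b′ ≡ true → a ≈ a′) → on b a ≈ on b′ a′
  on-cong₂ ≡-refl = on-cong

  on-*ʳ : ∀ b a d → on b a * d ≈ on b (a * d)
  on-*ʳ true  a d = refl
  on-*ʳ false a d = zeroˡ d

  on-*ˡ : ∀ b a d → d * on b a ≈ on b (d * a)
  on-*ˡ true  a d = refl
  on-*ˡ false a d = zeroʳ d

  on-- : ∀ b a d → on b a - on b d ≈ on b (a - d)
  on-- true  a d = refl
  on-- false a d = -‿inverseʳ 0#

  on-∑ : ∀ {n} b (f : Fin n → Carrier) → on b (∑ f) ≈ ∑ (λ i → on b (f i))
  on-∑ true  f = refl
  on-∑ {n} false f = sym (∑-zero {n} (λ _ → refl))

  on-∧ : ∀ b b′ a → on (b ∧ b′) a ≈ on b (on b′ a)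
  on-∧ true  b′ a = refl
  on-∧ false b′ a = refl

-- Path identities that follow from the vertex recursion in any commutative ring.

module Identities {c ℓ} (R : CommutativeRing c ℓ) (x : CommutativeRing.Carrier R) {n : ℕ} (G : Graph n)
  (M : VSet n → CommutativeRing.Carrier R)
  (M-cong : ∀ {X Y} → X ≗ Y → CommutativeRing._≈_ R (M X) (M Y))
  (M-empty : ∀ X → card X ≡ 0 → CommutativeRing._≈_ R (M X) (CommutativeRing.1# R))
  (M-rec : ∀ X u → u ∈ᵥ X → CommutativeRing._≈_ R (M X)
     (CommutativeRing._-_ R (CommutativeRing._*_ R x (M (del₁ X u)))
       (RingSums.∑ R (λ w → RingSums.on R (nbr G X u w) (M (del₂ X u w))))))
  where
  open CommutativeRing R hiding (zero)
  open RingSums R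
  open Solver using (solve; _:+_; _:*_; _:=_; :-_; _:-_)
  open import Relation.Binary.Reasoning.Setoid setoid

  M-rec-del : ∀ {Z Y u} {b : Fin n → Bool} → u ∈ᵥ Z → del₁ Z u ≗ Y → (∀ w → nbr G Z u w ≡ b w) →
    M Z ≈ x * M Y - ∑ (λ w → on (b w) (M (del₁ Y w)))
  M-rec-del {Z} {Y} {u} u∈Z e eb = trans (M-rec Z u u∈Z) (+-cong (*-congˡ (M-cong e))
    (-‿cong (∑-cong {n} (λ w → on-cong₂ (eb w) (λ _ → M-cong (del₁-≗ e w))))))

  sqs : List (VSet n) → Carrier
  sqs []       = 0#
  sqs (Z ∷ Zs) = M Z * M Z + sqs Zs

  sqs-++ : ∀ Ys Zs → sqs (Ys ++ Zs) ≈ sqs Ys + sqs Zs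
  sqs-++ [] Zs = sym (+-identityˡ _)
  sqs-++ (Y ∷ Ys) Zs = trans (+-congˡ (sqs-++ Ys Zs)) (sym (+-assoc _ _ _))

  sqs-concatFin : ∀ {m} (f : Fin m → List (VSet n)) → ∑ (λ w → sqs (f w)) ≈ sqs (concatFin f)
  sqs-concatFin {zero} f = refl
  sqs-concatFin {suc m} f = trans (+-congˡ (sqs-concatFin (f ∘ suc))) (sym (sqs-++ (f Fin.zero) _))

  -- The left side of the Heilmann-Lieb path identity.
  rayleigh : VSet n → Fin n → Fin n → Carrier
  rayleigh X u v = M (del₁ X u) * M (del₁ X v) - M X * M (del₂ X u v)

  -- The number `m` only bounds the recursion and suffices once it is at least |X|. A path is
  -- recorded by the set of vertices that it leaves, and repetitions are kept because each path
  -- contributes its own square.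
  pathRests : ℕ → VSet n → Fin n → Fin n → List (VSet n)
  pathRests zero    X u v = []
  pathRests (suc m) X u v = concatFin (λ w → if nbr G X u w then
    (if does (w ≟ᶠ v) then del₂ X u v ∷ [] else pathRests m (del₁ X u) w v) else [])

  PathTo⇒∈ : ∀ m {X u v Z} → card X ≤ m → u ∈ᵥ X → PathTo G X u v Z → Z ∈ pathRests m X u v
  PathTo⇒∈ zero {X} {u} le u∈X p with ≡-trans (≡-sym (ℕₚ.n≤0⇒n≡0 le)) (card-del₁ X u u∈X)
  ... | ()
  PathTo⇒∈ (suc m) {X} {u} {v} le u∈X (last p) = ∈-concatFin _ v found
    where
    found : del₂ X u v ∈ (if nbr G X u v then (if does (v ≟ᶠ v) then del₂ X u v ∷ [] else pathRests m (del₁ X u) v v) else [])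
    found rewrite p with v ≟ᶠ v
    ... | yes _ = here ≡-refl
    ... | no q  = ⊥-elim (q ≡-refl)
  PathTo⇒∈ (suc m) {X} {u} {v} {Z} le u∈X (step {w = w} p w≢v q) = ∈-concatFin _ w found
    where
    found : Z ∈ (if nbr G X u w then (if does (w ≟ᶠ v) then del₂ X u v ∷ [] else pathRests m (del₁ X u) w v) else [])
    found rewrite p with w ≟ᶠ v
    ... | yes e = ⊥-elim (w≢v e)
    ... | no _  = PathTo⇒∈ m (ℕₚ.≤-pred (≡-subst (_≤ suc m) (card-del₁ X u u∈X) le)) (proj₁ (∧-true⁻ p)) q

  private
    rayleigh-term : VSet n → Fin n → Fin n → Fin n → Carrier
    rayleigh-term X u v w = if does (w ≟ᶠ v) then M (del₂ X u v) * M (del₂ X u v) else rayleigh (del₁ X u) w v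

  -- M(X) and M(X-v) are both expanded at `u`, and the terms with x cancel. The neighbour w = v is
  -- missing from the expansion of M(X-v), so it leaves the square of M(X-u-v); every other
  -- neighbour leaves the same difference in X-u.
  rayleigh-step : ∀ X u v → u ∈ᵥ X → v ∈ᵥ X → u ≢ v →
    rayleigh X u v ≈ ∑ (λ w → on (nbr G X u w) (rayleigh-term X u v w))
  rayleigh-step X u v u∈X v∈X u≢v = begin
    p * M (del₁ X v) - M X * r ≈⟨ +-cong (*-congˡ recv) (-‿cong (*-congʳ (M-rec X u u∈X))) ⟩
    p * (x * r - ∑ f) - (x * p - ∑ g) * r
      ≈⟨ solve 5 (λ p x r f g → p :* (x :* r :- f) :- (x :* p :- g) :* r := g :* r :- p :* f) refl p x r (∑ f) (∑ g) ⟩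
    ∑ g * r - p * ∑ f ≈⟨ +-cong (∑-*ʳ r g) (-‿cong (∑-*ˡ p f)) ⟩
    ∑ (λ w → g w * r) - ∑ (λ w → p * f w) ≈⟨ ∑-- (λ w → g w * r) (λ w → p * f w) ⟩
    ∑ (λ w → g w * r - p * f w) ≈⟨ ∑-cong {n} termwise ⟩
    ∑ (λ w → on (nbr G X u w) (rayleigh-term X u v w)) ∎
    where
    p = M (del₁ X u)
    r = M (del₂ X u v)
    f g : Fin n → Carrier
    f w = on (nbr G X u w ∧ (w ≠ᵇ v)) (M (del₁ (del₂ X u v) w))
    g w = on (nbr G X u w) (M (del₂ X u w))
    recv : M (del₁ X v) ≈ x * r - ∑ f
    recv = M-rec-del (∈-del₁ X u∈X u≢v) (del₂-comm X v u) (nbr-del₁ G X v u)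
    termwise : ∀ w → g w * r - p * f w ≈ on (nbr G X u w) (rayleigh-term X u v w)
    termwise w with nbr G X u w
    ... | false = trans (+-cong (zeroˡ r) (-‿cong (zeroʳ p))) (-‿inverseʳ 0#)
    ... | true with w ≟ᶠ v
    ...   | yes ≡-refl = trans (+-congˡ (trans (-‿cong (zeroʳ p)) ε⁻¹≈ε)) (+-identityʳ _)
      where open import Algebra.Properties.AbelianGroup +-abelianGroup using (ε⁻¹≈ε)
    ...   | no _ = +-congˡ (-‿cong (*-congˡ (M-cong (del₂-comm (del₁ X u) v w))))

  rayleigh-sqs : ∀ m X u v → card X ≤ m → u ∈ᵥ X → v ∈ᵥ X → u ≢ v → rayleigh X u v ≈ sqs (pathRests m X u v)
  rayleigh-sqs zero X u v le u∈X _ _ with ≡-trans (≡-sym (ℕₚ.n≤0⇒n≡0 le)) (card-del₁ X u u∈X)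
  ... | ()
  rayleigh-sqs (suc m) X u v le u∈X v∈X u≢v = trans (rayleigh-step X u v u∈X v∈X u≢v)
    (trans (∑-cong {n} termwise) (sqs-concatFin {n} _))
    where
    termwise : ∀ w → on (nbr G X u w) (rayleigh-term X u v w)
      ≈ sqs (if nbr G X u w then (if does (w ≟ᶠ v) then del₂ X u v ∷ [] else pathRests m (del₁ X u) w v) else [])
    termwise w with nbr G X u w in p
    ... | false = refl
    ... | true with w ≟ᶠ v
    ...   | yes ≡-refl = sym (+-identityʳ _)
    ...   | no w≢v = rayleigh-sqs m (del₁ X u) w v (ℕₚ.≤-pred (≡-subst (_≤ suc m) (card-del₁ X u u∈X) le))
                       (proj₁ (∧-true⁻ p)) (∈-del₁ X v∈X (λ e → u≢v (≡-sym e))) w≢v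

  -- The derivative of rayleigh X u v with respect to a separate variable at w.
  rayleigh′ : VSet n → Fin n → Fin n → Fin n → Carrier
  rayleigh′ X u v w = ((M (del₁ X u) * M (del₂ X v w) + M (del₂ X u w) * M (del₁ X v))
    - M X * M (del₁ (del₂ X u v) w)) - M (del₁ X w) * M (del₂ X u v)

  module _ {j} (J : Carrier → Set j) (J-cong : ∀ {a b} → a ≈ b → J a → J b) (J-0 : J 0#)
           (J-+ : ∀ {a b} → J a → J b → J (a + b)) where

    J-∑ : ∀ {m} (f : Fin m → Carrier) → (∀ i → J (f i)) → J (∑ f)
    J-∑ {zero} f h = J-0
    J-∑ {suc m} f h = J-+ (h Fin.zero) (J-∑ (f ∘ suc) (h ∘ suc))

    -- Written out, `rayleigh′` is twice the sum of M(X-P) M(X-w-P) over the paths P from u to v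
    -- that avoid w. Only a property `J` closed under sums has to be transported, so the hypothesis
    -- may speak of any two paths, one in X and one in X-w. Among the first steps, the one to `w`
    -- cancels and the one to `v` gives such a product twice.
    rayleigh′-J : ∀ m X u v w → card X ≤ m → u ∈ᵥ X → v ∈ᵥ X → w ∈ᵥ X → u ≢ v → u ≢ w → v ≢ w →
      (∀ {Z Z′} → PathTo G X u v Z → PathTo G (del₁ X w) u v Z′ → J (M Z * M Z′)) → J (rayleigh′ X u v w)
    rayleigh′-J zero X u v w le u∈X _ _ _ _ _ _ with ≡-trans (≡-sym (ℕₚ.n≤0⇒n≡0 le)) (card-del₁ X u u∈X)
    ... | ()
    rayleigh′-J (suc m) X u v w le u∈X v∈X w∈X u≢v u≢w v≢w hyp = J-cong (sym expand) (J-∑ t each)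
      where
      Y = del₁ X u
      p = M Y
      q = M (del₁ Y w)
      r = M (del₁ Y v)
      s = M (del₂ Y v w)
      f₁ f₂ f₃ f₄ t : Fin n → Carrier
      f₁ z = on ((nbr G X u z ∧ (z ≠ᵇ v)) ∧ (z ≠ᵇ w)) (M (del₁ (del₂ Y v w) z))
      f₂ z = on (nbr G X u z ∧ (z ≠ᵇ v)) (M (del₂ Y v z))
      f₃ z = on (nbr G X u z) (M (del₁ Y z))
      f₄ z = on (nbr G X u z ∧ (z ≠ᵇ w)) (M (del₂ Y w z))
      t z = ((f₃ z * s + f₄ z * r) - p * f₁ z) - q * f₂ z
      rec₁ : M (del₂ X v w) ≈ x * s - ∑ f₁
      rec₁ = M-rec-del (∈-del₁ (del₁ X v) (∈-del₁ X u∈X u≢v) u≢w)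
        (λ z → ≡-trans (del₂-comm (del₁ X v) w u z) (del₁-≗ (del₂-comm X v u) w z))
        (λ z → ≡-trans (nbr-del₁ G (del₁ X v) w u z) (cong (_∧ (z ≠ᵇ w)) (nbr-del₁ G X v u z)))
      rec₂ : M (del₁ X v) ≈ x * r - ∑ f₂
      rec₂ = M-rec-del (∈-del₁ X u∈X u≢v) (del₂-comm X v u) (nbr-del₁ G X v u)
      rec₄ : M (del₁ X w) ≈ x * q - ∑ f₄
      rec₄ = M-rec-del (∈-del₁ X u∈X u≢w) (del₂-comm X w u) (nbr-del₁ G X w u)
      expand : rayleigh′ X u v w ≈ ∑ t
      expand = begin
        ((p * M (del₂ X v w) + q * M (del₁ X v)) - M X * s) - M (del₁ X w) * r
          ≈⟨ +-cong (+-cong (+-cong (*-congˡ rec₁) (*-congˡ rec₂)) (-‿cong (*-congʳ (M-rec X u u∈X)))) (-‿cong (*-congʳ rec₄)) ⟩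
        ((p * (x * s - ∑ f₁) + q * (x * r - ∑ f₂)) - (x * p - ∑ f₃) * s) - (x * q - ∑ f₄) * r
          ≈⟨ solve 9 (λ x p q r s a b c d →
               ((p :* (x :* s :- a) :+ q :* (x :* r :- b)) :- (x :* p :- c) :* s) :- (x :* q :- d) :* r
               := ((c :* s :+ d :* r) :- p :* a) :- q :* b) refl x p q r s (∑ f₁) (∑ f₂) (∑ f₃) (∑ f₄) ⟩
        ((∑ f₃ * s + ∑ f₄ * r) - p * ∑ f₁) - q * ∑ f₂
          ≈⟨ +-cong (+-cong (+-cong (∑-*ʳ s f₃) (∑-*ʳ r f₄)) (-‿cong (∑-*ˡ p f₁))) (-‿cong (∑-*ˡ q f₂)) ⟩
        ((∑ (λ z → f₃ z * s) + ∑ (λ z → f₄ z * r)) - ∑ (λ z → p * f₁ z)) - ∑ (λ z → q * f₂ z)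
          ≈⟨ +-congʳ (+-congʳ (∑-+ (λ z → f₃ z * s) (λ z → f₄ z * r))) ⟨
        (∑ (λ z → f₃ z * s + f₄ z * r) - ∑ (λ z → p * f₁ z)) - ∑ (λ z → q * f₂ z)
          ≈⟨ +-congʳ (∑-- (λ z → f₃ z * s + f₄ z * r) (λ z → p * f₁ z)) ⟩
        ∑ (λ z → (f₃ z * s + f₄ z * r) - p * f₁ z) - ∑ (λ z → q * f₂ z)
          ≈⟨ ∑-- (λ z → (f₃ z * s + f₄ z * r) - p * f₁ z) (λ z → q * f₂ z) ⟩
        ∑ t ∎
      leY : card Y ≤ m
      leY = ℕₚ.≤-pred (≡-subst (_≤ suc m) (card-del₁ X u u∈X) le)
      v∈Y = ∈-del₁ X v∈X (λ e → u≢v (≡-sym e))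
      w∈Y = ∈-del₁ X w∈X (λ e → u≢w (≡-sym e))
      t-off : ∀ z → nbr G X u z ≡ false → t z ≈ 0#
      t-off z e rewrite e = begin
        ((0# * s + 0# * r) - p * 0#) - q * 0#
          ≈⟨ solve 5 (λ o p q r s → ((o :* s :+ o :* r) :- p :* o) :- q :* o := o :* (s :+ r :- p :- q)) refl 0# p q r s ⟩
        0# * (s + r - p - q) ≈⟨ zeroˡ _ ⟩
        0# ∎
      t-v : ∀ z → nbr G X u z ≡ true → z ≡ v → t z ≈ r * s + r * s
      t-v z e ≡-refl rewrite e | ≠ᵇ-irrefl z | ≠ᵇ-≢ v≢w = begin
        ((r * s + M (del₂ Y w v) * r) - p * 0#) - q * 0#
          ≈⟨ +-cong (+-cong (+-congˡ (trans (*-congʳ (M-cong (del₂-comm Y w v))) (*-comm s r))) (-‿cong (zeroʳ p))) (-‿cong (zeroʳ q)) ⟩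
        ((r * s + r * s) - 0#) - 0#
          ≈⟨ solve 2 (λ a o → (a :- o) :- o := a :- (o :+ o)) refl (r * s + r * s) 0# ⟩
        (r * s + r * s) - (0# + 0#) ≈⟨ +-congˡ (trans (-‿cong (+-identityʳ 0#)) ε⁻¹≈ε) ⟩
        (r * s + r * s) + 0# ≈⟨ +-identityʳ _ ⟩
        r * s + r * s ∎
        where open import Algebra.Properties.AbelianGroup +-abelianGroup using (ε⁻¹≈ε)
      t-w : ∀ z → nbr G X u z ≡ true → z ≡ w → t z ≈ 0#
      t-w z e ≡-refl rewrite e | ≠ᵇ-irrefl z | ≠ᵇ-≢ (λ e → v≢w (≡-sym e)) = begin
        ((q * s + 0# * r) - p * 0#) - q * s
          ≈⟨ solve 5 (λ o p q r s → ((q :* s :+ o :* r) :- p :* o) :- q :* s := o :* (r :- p)) refl 0# p q r s ⟩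
        0# * (r - p) ≈⟨ zeroˡ _ ⟩
        0# ∎
      t-step : ∀ z → nbr G X u z ≡ true → z ≢ v → z ≢ w → t z ≈ rayleigh′ Y z v w
      t-step z e z≢v z≢w rewrite e | ≠ᵇ-≢ z≢v | ≠ᵇ-≢ z≢w = +-cong
        (+-cong (+-congˡ (*-congʳ (M-cong (del₂-comm Y w z))))
          (-‿cong (*-congˡ (M-cong (λ a → ≡-trans (del₂-comm (del₁ Y v) w z a) (del₁-≗ (del₂-comm Y v z) w a))))))
        (-‿cong (*-congˡ (M-cong (del₂-comm Y v z))))
      hyp′ : ∀ z → nbr G X u z ≡ true → z ≢ v → z ≢ w →
        ∀ {Z Z′} → PathTo G Y z v Z → PathTo G (del₁ Y w) z v Z′ → J (M Z * M Z′)
      hyp′ z e z≢v z≢w pth pth′ with PathTo-≗ G (del₂-comm X u w) pth′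
      ... | Z″ , eq , pth″ = J-cong (*-congˡ (M-cong (λ a → ≡-sym (eq a))))
        (hyp (step e z≢v pth) (step (≡-trans (nbr-del₁ G X w u z) (∧-true⁺ e (≠ᵇ-≢ z≢w))) z≢v pth″))
      each : ∀ z → J (t z)
      each z = caseᵇ (nbr G X u z) onCase (λ e → J-cong (sym (t-off z e)) J-0)
        where
        rs : z ≡ v → nbr G X u z ≡ true → J (r * s)
        rs ≡-refl e = J-cong (*-congˡ (M-cong (λ a → ≡-trans (del₁-≗ (del₂-comm X w u) v a) (del₂-comm Y w v a))))
          (hyp (last e) (last (≡-trans (nbr-del₁ G X w u v) (∧-true⁺ e (≠ᵇ-≢ v≢w)))))
        onCase′ : nbr G X u z ≡ true → Dec (z ≡ v) → Dec (z ≡ w) → J (t z)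
        onCase′ e (yes e′) _ = J-cong (sym (t-v z e e′)) (J-+ (rs e′ e) (rs e′ e))
        onCase′ e (no _) (yes e′) = J-cong (sym (t-w z e e′)) J-0
        onCase′ e (no z≢v) (no z≢w) = J-cong (sym (t-step z e z≢v z≢w))
          (rayleigh′-J m Y z v w leY (proj₁ (∧-true⁻ e)) v∈Y w∈Y z≢v z≢w v≢w (hyp′ z e z≢v z≢w))
        onCase : nbr G X u z ≡ true → J (t z)
        onCase e = onCase′ e (z ≟ᶠ v) (z ≟ᶠ w)

  module Derivation (D : Carrier → Carrier) (D-cong : ∀ {a b} → a ≈ b → D a ≈ D b)
    (D-+ : ∀ a b → D (a + b) ≈ D a + D b) (D-0 : D 0# ≈ 0#) (D-neg : ∀ a → D (- a) ≈ - D a)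
    (D-1 : D 1# ≈ 0#) (D-x : ∀ a → D (x * a) ≈ a + x * D a) where

    D-∑ : ∀ {m} (f : Fin m → Carrier) → D (∑ f) ≈ ∑ (λ i → D (f i))
    D-∑ {zero} f = D-0
    D-∑ {suc m} f = trans (D-+ _ _) (+-congˡ (D-∑ (f ∘ suc)))

    D-on : ∀ b a → D (on b a) ≈ on b (D a)
    D-on true  a = refl
    D-on false a = D-0

    D-rec : ∀ X u → u ∈ᵥ X → D (M X) ≈
      (M (del₁ X u) + x * D (M (del₁ X u))) - ∑ (λ w → on (nbr G X u w) (D (M (del₂ X u w))))
    D-rec X u u∈X = trans (D-cong (M-rec X u u∈X)) (trans (D-+ _ _) (+-cong (D-x _)
      (trans (D-neg _) (-‿cong (trans (D-∑ {n} _) (∑-cong {n} (λ w → D-on (nbr G X u w) _)))))))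

    wronskian : VSet n → Fin n → Carrier
    wronskian X u = D (M X) * M (del₁ X u) - M X * D (M (del₁ X u))

    -- The rests of all paths that start at `u` and have at least one edge, whatever their end; the
    -- trivial path is added in `wronskian-sqs`.
    walkRests : ℕ → VSet n → Fin n → List (VSet n)
    walkRests zero    X u = []
    walkRests (suc m) X u = concatFin (λ w → if nbr G X u w then del₂ X u w ∷ walkRests m (del₁ X u) w else [])

    -- Differentiating the factor x leaves the square of M(X-u). The other terms with x cancel, and
    -- each neighbour contributes the same expression one vertex further along.
    wronskian-step : ∀ X u → u ∈ᵥ X →
      wronskian X u ≈ M (del₁ X u) * M (del₁ X u) + ∑ (λ w → on (nbr G X u w) (wronskian (del₁ X u) w))
    wronskian-step X u u∈X = begin
      D (M X) * p - M X * D p ≈⟨ +-cong (*-congʳ (D-rec X u u∈X)) (-‿cong (*-congʳ (M-rec X u u∈X))) ⟩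
      ((p + x * D p) - ∑ Dg) * p - (x * p - ∑ g) * D p
        ≈⟨ solve 5 (λ x p d a b → ((p :+ x :* d) :- a) :* p :- (x :* p :- b) :* d := p :* p :+ (d :* b :- p :* a)) refl x p (D p) (∑ Dg) (∑ g) ⟩
      p * p + (D p * ∑ g - p * ∑ Dg) ≈⟨ +-congˡ (trans (+-cong (∑-*ˡ (D p) g) (-‿cong (∑-*ˡ p Dg))) (∑-- (λ w → D p * g w) (λ w → p * Dg w))) ⟩
      p * p + ∑ (λ w → D p * g w - p * Dg w) ≈⟨ +-congˡ (∑-cong {n} (λ w →
          trans (+-cong (on-*ˡ (nbr G X u w) _ (D p)) (-‿cong (on-*ˡ (nbr G X u w) _ p))) (on-- (nbr G X u w) _ _))) ⟩
      p * p + ∑ (λ w → on (nbr G X u w) (wronskian (del₁ X u) w)) ∎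
      where
      p = M (del₁ X u)
      g Dg : Fin n → Carrier
      g w = on (nbr G X u w) (M (del₂ X u w))
      Dg w = on (nbr G X u w) (D (M (del₂ X u w)))

    wronskian-sqs : ∀ m X u → card X ≤ m → u ∈ᵥ X → wronskian X u ≈ sqs (del₁ X u ∷ walkRests m X u)
    wronskian-sqs zero X u le u∈X with ≡-trans (≡-sym (ℕₚ.n≤0⇒n≡0 le)) (card-del₁ X u u∈X)
    ... | ()
    wronskian-sqs (suc m) X u le u∈X = trans (wronskian-step X u u∈X)
      (+-congˡ (trans (∑-cong {n} termwise) (sqs-concatFin {n} _)))
      where
      termwise : ∀ w → on (nbr G X u w) (wronskian (del₁ X u) w)
        ≈ sqs (if nbr G X u w then del₂ X u w ∷ walkRests m (del₁ X u) w else [])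
      termwise w with nbr G X u w in p
      ... | false = refl
      ... | true = wronskian-sqs m (del₁ X u) w (ℕₚ.≤-pred (≡-subst (_≤ suc m) (card-del₁ X u u∈X) le)) (proj₁ (∧-true⁻ p))

    -- Both sides satisfy the same recursion at a vertex `u`: the summand z = u arises from
    -- differentiating x, and for z other than u deleting z commutes with expanding at u.
    D-M : ∀ k X → card X ≡ k → D (M X) ≈ ∑ (λ z → on (X z) (M (del₁ X z)))
    D-M zero X e = trans (trans (D-cong (M-empty X e)) D-1) (sym (∑-zero {n} (λ z → on-false (card-empty X e z))))
    D-M (suc k) X e with card-positive X k e
    ... | u , u∈X = begin
      D (M X) ≈⟨ D-rec X u u∈X ⟩
      (p + x * D p) - ∑ (λ w → on (nbr G X u w) (D (M (del₁ Y w))))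
        ≈⟨ +-cong (+-congˡ (*-congˡ (D-M k Y cY))) (-‿cong (∑-cong {n} (λ w → on-cong (λ q → trans (D-pred w q)
              (∑-cong {n} (λ z → on-∧ (Y z) (z ≠ᵇ w) _)))))) ⟩
      (p + x * ∑ a) - ∑ (λ w → on (nbr G X u w) (∑ (λ z → on (Y z) (on (z ≠ᵇ w) (M (del₂ Y w z))))))
        ≈⟨ +-cong (+-congˡ (∑-*ˡ x a)) (-‿cong (trans (∑-cong {n} (λ w → on-∑ {n} (nbr G X u w) (λ z → on (Y z) (on (z ≠ᵇ w) (M (del₂ Y w z)))))) (∑-comm {n} {n} _))) ⟩
      (p + ∑ (λ z → x * a z)) - ∑ (λ z → ∑ (λ w → on (nbr G X u w) (on (Y z) (on (z ≠ᵇ w) (M (del₂ Y w z))))))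
        ≈⟨ trans (+-assoc _ _ _) (+-congˡ (∑-- {n} _ _)) ⟩
      p + ∑ (λ z → x * a z - ∑ (λ w → on (nbr G X u w) (on (Y z) (on (z ≠ᵇ w) (M (del₂ Y w z))))))
        ≈⟨ +-cong (trans (sym single-u) (sym (∑-single {n} u off-u))) (∑-cong {n} termwise) ⟩
      ∑ (λ z → on (does (z ≟ᶠ u)) (M (del₁ X z))) + ∑ (λ z → on (Y z) (M (del₁ X z)))
        ≈⟨ ∑-+ {n} _ _ ⟨
      ∑ (λ z → on (does (z ≟ᶠ u)) (M (del₁ X z)) + on (Y z) (M (del₁ X z)))
        ≈⟨ ∑-cong {n} merge ⟩
      ∑ (λ z → on (X z) (M (del₁ X z))) ∎
      where
      Y = del₁ X u
      p = M Y
      a : Fin n → Carrier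
      a z = on (Y z) (M (del₁ Y z))
      cY : card Y ≡ k
      cY = ℕₚ.suc-injective (≡-trans (≡-sym (card-del₁ X u u∈X)) e)
      D-pred : ∀ w → nbr G X u w ≡ true → D (M (del₁ Y w)) ≈ ∑ (λ z → on (del₁ Y w z) (M (del₂ Y w z)))
      D-pred w q = go k cY
        where
        c₂ = card-del₁ Y w (proj₁ (∧-true⁻ q))
        go : ∀ k → card Y ≡ k → D (M (del₁ Y w)) ≈ ∑ (λ z → on (del₁ Y w z) (M (del₂ Y w z)))
        go zero cY with ≡-trans (≡-sym cY) c₂
        ... | ()
        go (suc k) cY = D-M k (del₁ Y w) (ℕₚ.suc-injective (≡-trans (≡-sym c₂) cY))
      off-u : ∀ z → z ≢ u → on (does (z ≟ᶠ u)) (M (del₁ X z)) ≈ 0#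
      off-u z z≢u with z ≟ᶠ u
      ... | yes q = ⊥-elim (z≢u q)
      ... | no _  = refl
      single-u : on (does (u ≟ᶠ u)) (M (del₁ X u)) ≈ p
      single-u with u ≟ᶠ u
      ... | yes _ = refl
      ... | no q  = ⊥-elim (q ≡-refl)
      merge : ∀ z → on (does (z ≟ᶠ u)) (M (del₁ X z)) + on (Y z) (M (del₁ X z)) ≈ on (X z) (M (del₁ X z))
      merge z with z ≟ᶠ u
      ... | yes ≡-refl rewrite u∈X = +-identityʳ _
      ... | no _ rewrite ∧-identityʳ (X z) = +-identityˡ _
      swap-on : ∀ b₁ b₂ b₃ d → on b₁ (on b₂ (on b₃ d)) ≈ on b₂ (on (b₁ ∧ b₃) d)
      swap-on true b₂ b₃ d = refl
      swap-on false true b₃ d = refl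
      swap-on false false b₃ d = refl
      termwise : ∀ z → x * a z - ∑ (λ w → on (nbr G X u w) (on (Y z) (on (z ≠ᵇ w) (M (del₂ Y w z)))))
        ≈ on (Y z) (M (del₁ X z))
      termwise z = begin
        x * a z - ∑ (λ w → on (nbr G X u w) (on (Y z) (on (z ≠ᵇ w) (M (del₂ Y w z)))))
          ≈⟨ +-cong (on-*ˡ (Y z) _ x) (-‿cong (trans (∑-cong {n} (λ w → trans (swap-on (nbr G X u w) (Y z) (z ≠ᵇ w) _)
               (on-cong {Y z} (λ _ → on-cong₂ (cong (nbr G X u w ∧_) (≠ᵇ-sym z w)) (λ _ → M-cong (del₂-comm Y w z))))))
               (sym (on-∑ (Y z) (λ w → on (nbr G X u w ∧ (w ≠ᵇ z)) (M (del₂ Y z w))))))) ⟩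
        on (Y z) (x * M (del₁ Y z)) - on (Y z) (∑ (λ w → on (nbr G X u w ∧ (w ≠ᵇ z)) (M (del₂ Y z w))))
          ≈⟨ on-- (Y z) _ _ ⟩
        on (Y z) (x * M (del₁ Y z) - ∑ (λ w → on (nbr G X u w ∧ (w ≠ᵇ z)) (M (del₂ Y z w))))
          ≈⟨ on-cong (λ q → sym (M-rec-del (∈-del₁ X u∈X (λ e → ≢-≠ᵇ (proj₂ (∧-true⁻ {X z} q)) (≡-sym e))) (del₂-comm X z u) (nbr-del₁ G X z u))) ⟩
        on (Y z) (M (del₁ X z)) ∎

  NoEdges : VSet n → VSet n → Set
  NoEdges C X = ∀ w z → w ∈ᵥ X → z ∈ᵥ X → C w ≡ true → C z ≡ false → adj G w z ≡ false

  private
    disjoint : ∀ C X → card (X ∩ᵥ C) ≡ 0 → M X ≈ M (X ∩ᵥ C) * M (X ∖ C)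
    disjoint C X e = trans (M-cong same) (trans (sym (*-identityˡ _)) (*-congʳ (sym (M-empty (X ∩ᵥ C) e))))
      where
      same : X ≗ (X ∖ C)
      same w with X w | C w | card-empty (X ∩ᵥ C) e w
      ... | false | _ | _ = ≡-refl
      ... | true | false | _ = ≡-refl

  -- At a vertex of X inside `C` all neighbours in X lie in `C` too, so the recursion there affects
  -- the first factor only.
  M-∩∖ : ∀ k C X → card (X ∩ᵥ C) ≤ k → NoEdges C X → M X ≈ M (X ∩ᵥ C) * M (X ∖ C)
  M-∩∖ zero C X le hyp = disjoint C X (ℕₚ.n≤0⇒n≡0 le)
  M-∩∖ (suc k) C X le hyp = by (card (X ∩ᵥ C)) ≡-refl
    where
    factor : ∀ u → u ∈ᵥ (X ∩ᵥ C) → M X ≈ M (X ∩ᵥ C) * M (X ∖ C)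
    factor u u∈XC = begin
      M X ≈⟨ M-rec X u u∈X ⟩
      x * M (del₁ X u) - ∑ (λ w → on (nbr G X u w) (M (del₂ X u w)))
        ≈⟨ +-cong (*-congˡ part₁) (-‿cong (∑-cong {n} termwise)) ⟩
      x * (M (del₁ (X ∩ᵥ C) u) * M (X ∖ C)) - ∑ (λ w → on (nbr G (X ∩ᵥ C) u w) (M (del₂ (X ∩ᵥ C) u w)) * M (X ∖ C))
        ≈⟨ +-cong (sym (*-assoc _ _ _)) (-‿cong (sym (∑-*ʳ (M (X ∖ C)) (λ w → on (nbr G (X ∩ᵥ C) u w) (M (del₂ (X ∩ᵥ C) u w)))))) ⟩
      x * M (del₁ (X ∩ᵥ C) u) * M (X ∖ C) - ∑ (λ w → on (nbr G (X ∩ᵥ C) u w) (M (del₂ (X ∩ᵥ C) u w))) * M (X ∖ C)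
        ≈⟨ solve 3 (λ a b d → a :* d :- b :* d := (a :- b) :* d) refl _ _ _ ⟩
      (x * M (del₁ (X ∩ᵥ C) u) - ∑ (λ w → on (nbr G (X ∩ᵥ C) u w) (M (del₂ (X ∩ᵥ C) u w)))) * M (X ∖ C)
        ≈⟨ *-congʳ (M-rec (X ∩ᵥ C) u u∈XC) ⟨
      M (X ∩ᵥ C) * M (X ∖ C) ∎
      where
      u∈X = proj₁ (∧-true⁻ {X u} u∈XC)
      u∈C = proj₂ (∧-true⁻ {X u} u∈XC)
      le₁ : card (del₁ (X ∩ᵥ C) u) ≤ k
      le₁ = ℕₚ.≤-pred (≡-subst (_≤ suc k) (card-del₁ (X ∩ᵥ C) u u∈XC) le)
      sub : ∀ Z → (∀ w → w ∈ᵥ Z → w ∈ᵥ X) → NoEdges C Z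
      sub Z ⊆ w z w∈ z∈ = hyp w z (⊆ w w∈) (⊆ z z∈)
      part₁ : M (del₁ X u) ≈ M (del₁ (X ∩ᵥ C) u) * M (X ∖ C)
      part₁ = trans (M-∩∖ k C (del₁ X u) (≡-subst (_≤ k) (card-≗ (λ w → ≡-sym (del₁-∩ X C u w))) le₁)
                (sub _ (λ w p → proj₁ (∧-true⁻ p))))
              (*-cong (M-cong (del₁-∩ X C u)) (M-cong (del₁-∖ X C u u∈C)))
      termwise : ∀ w → on (nbr G X u w) (M (del₂ X u w)) ≈ on (nbr G (X ∩ᵥ C) u w) (M (del₂ (X ∩ᵥ C) u w)) * M (X ∖ C)
      termwise w = caseᵇ (nbr G X u w) yesNbr noNbr
        where
        noNbr : nbr G X u w ≡ false → on (nbr G X u w) (M (del₂ X u w)) ≈ on (nbr G (X ∩ᵥ C) u w) (M (del₂ (X ∩ᵥ C) u w)) * M (X ∖ C)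
        noNbr p = trans (on-false p) (sym (trans (*-congʳ (on-false (≡-trans (nbr-∩ G X C u w) (cong (_∧ C w) p)))) (zeroˡ _)))
        yesNbr : nbr G X u w ≡ true → on (nbr G X u w) (M (del₂ X u w)) ≈ on (nbr G (X ∩ᵥ C) u w) (M (del₂ (X ∩ᵥ C) u w)) * M (X ∖ C)
        yesNbr p = trans (on-true p) (trans part₂ (*-congʳ (sym (on-true (≡-trans (nbr-∩ G X C u w) (∧-true⁺ p w∈C))))))
          where
          w∈Y = proj₁ (∧-true⁻ {del₁ X u w} p)
          w∈C : C w ≡ true
          w∈C = caseᵇ (C w) id (λ q → true≢false (proj₂ (∧-true⁻ {del₁ X u w} p)) (hyp u w u∈X (proj₁ (∧-true⁻ w∈Y)) u∈C q))
          le₂ : card (del₂ (X ∩ᵥ C) u w) ≤ k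
          le₂ = ℕₚ.≤-trans (ℕₚ.n≤1+n _) (≡-subst (_≤ k) (card-del₁ (del₁ (X ∩ᵥ C) u) w
                  (≡-trans (≡-sym (del₁-∩ X C u w)) (∧-true⁺ w∈Y w∈C))) le₁)
          cap₂ : (del₂ X u w ∩ᵥ C) ≗ del₂ (X ∩ᵥ C) u w
          cap₂ z = ≡-trans (del₁-∩ (del₁ X u) C w z) (del₁-≗ (del₁-∩ X C u) w z)
          part₂ : M (del₂ X u w) ≈ M (del₂ (X ∩ᵥ C) u w) * M (X ∖ C)
          part₂ = trans (M-∩∖ k C (del₂ X u w) (≡-subst (_≤ k) (card-≗ (λ z → ≡-sym (cap₂ z))) le₂)
                    (sub _ (λ z q → proj₁ (∧-true⁻ (proj₁ (∧-true⁻ {del₁ X u z} q))))))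
                  (*-cong (M-cong cap₂) (M-cong (λ z → ≡-trans (del₁-∖ (del₁ X u) C w w∈C z) (del₁-∖ X C u u∈C z))))
    by : ∀ c → card (X ∩ᵥ C) ≡ c → M X ≈ M (X ∩ᵥ C) * M (X ∖ C)
    by zero e = disjoint C X e
    by (suc c) e with card-positive (X ∩ᵥ C) c e
    ... | u , u∈ = factor u u∈

-- Godsil's path tree and its adjacency operator.

ℤring : CommutativeRing _ _
ℤring = ℤₚ.+-*-commutativeRing

-- Words of length at most m over the vertices. Words that are not paths are kept, so that the index
-- type does not depend on the graph; the operator switches off the edge by which such a word
-- departs from being a path.
data Idx (n : ℕ) : ℕ → Set where
  root  : ∀ {m} → Idx n m
  child : ∀ {m} → Fin n → Idx n m → Idx n (suc m)

isRoot : ∀ {n m} → Idx n m → Bool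
isRoot root        = true
isRoot (child _ _) = false

-- The operator is needed over ℤ, where squares are non-negative, and over the power series, where
-- the eigenvector lives. The map from ℤ lets the same integer polynomials and integer vectors be
-- used in both.
record Hom {c ℓ} (R : CommutativeRing c ℓ) : Set (c ⊔ ℓ) where
  open CommutativeRing R
  field
    hom   : ℤ → Carrier
    hom-0 : hom (+ 0) ≈ 0#
    hom-1 : hom (+ 1) ≈ 1#
    hom-+ : ∀ a b → hom (a ℤ.+ b) ≈ hom a + hom b
    hom-* : ∀ a b → hom (a ℤ.* b) ≈ hom a * hom b

idHom : Hom ℤring
idHom = record { hom = id ; hom-0 = ≡-refl ; hom-1 = ≡-refl ; hom-+ = λ _ _ → ≡-refl ; hom-* = λ _ _ → ≡-refl }

ιHom : ∀ {c ℓ} (R : CommutativeRing c ℓ) → Hom R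
ιHom R = record { hom = ι ; hom-0 = CommutativeRing.refl R ; hom-1 = ι-1 ; hom-+ = ι-+ ; hom-* = ι-* }
  where open CRing R

module PolyEval {c ℓ} (R : CommutativeRing c ℓ) (φ : Hom R) (x : CommutativeRing.Carrier R) where
  open CommutativeRing R hiding (zero)
  open Hom φ

  eval : List ℤ → Carrier
  eval []      = 0#
  eval (a ∷ p) = hom a + x * eval p

  evalSq : List (List ℤ) → Carrier
  evalSq []       = 0#
  evalSq (p ∷ ps) = eval p * eval p + evalSq ps

  pow : Carrier → ℕ → Carrier
  pow a zero    = 1#
  pow a (suc k) = a * pow a k

-- Vectors on the tree of sequences of vertices; the operator A is the adjacency operator of Godsil's path tree.
module TreeOps {c ℓ} (R : CommutativeRing c ℓ) {n : ℕ} (G : Graph n) (φ : Hom R) where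
  open CommutativeRing R hiding (zero)
  open Hom φ
  open RingSums R
  open Solver using (solve; _:+_; _:*_; _:=_; :-_; _:-_)

  Vec : ℕ → Set c
  Vec m = Idx n m → Carrier

  -- `X` is what is still available and `u` the current end of the path, so descending to `child z`
  -- removes `u` and makes `z` the end. The first summand at `child z i` is the edge up to the root,
  -- present only if `i` is itself a root.
  A : ∀ {m} → VSet n → Fin n → Vec m → Vec m
  A {zero}  X u v root = 0#
  A {suc m} X u v root = ∑ (λ z → on (nbr G X u z) (v (child z root)))
  A {suc m} X u v (child z i) = on (isRoot i) (on (nbr G X u z) (v root)) + A (del₁ X u) z (v ∘ child z) i

  A-cong : ∀ {m} X u {v v′ : Vec m} → (∀ i → v i ≈ v′ i) → ∀ i → A X u v i ≈ A X u v′ i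
  A-cong {zero} X u e root = refl
  A-cong {suc m} X u e root = ∑-cong {n} (λ z → on-cong {nbr G X u z} (λ _ → e (child z root)))
  A-cong {suc m} X u e (child z i) = +-cong (on-cong {isRoot i} (λ _ → on-cong {nbr G X u z} (λ _ → e root)))
    (A-cong (del₁ X u) z (e ∘ child z) i)

  on-+ : ∀ b a d → on b (a + d) ≈ on b a + on b d
  on-+ true  a d = refl
  on-+ false a d = sym (+-identityˡ 0#)

  on-on-+ : ∀ b b′ a d → on b (on b′ (a + d)) ≈ on b (on b′ a) + on b (on b′ d)
  on-on-+ b b′ a d = trans (on-cong {b} (λ _ → on-+ b′ a d)) (on-+ b _ _)

  A-+ : ∀ {m} X u (v v′ : Vec m) i → A X u (λ i → v i + v′ i) i ≈ A X u v i + A X u v′ i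
  A-+ {zero} X u v v′ root = sym (+-identityˡ 0#)
  A-+ {suc m} X u v v′ root = trans (∑-cong {n} (λ z → on-+ (nbr G X u z) _ _)) (∑-+ {n} _ _)
  A-+ {suc m} X u v v′ (child z i) = trans
    (+-cong (on-on-+ (isRoot i) (nbr G X u z) (v root) (v′ root)) (A-+ (del₁ X u) z (v ∘ child z) (v′ ∘ child z) i))
    (solve 4 (λ a b c d → (a :+ b) :+ (c :+ d) := (a :+ c) :+ (b :+ d)) refl _ _ _ _)

  A-* : ∀ {m} X u a (v : Vec m) i → A X u (λ i → a * v i) i ≈ a * A X u v i
  A-* {zero} X u a v root = sym (zeroʳ a)
  A-* {suc m} X u a v root = trans (∑-cong {n} (λ z → sym (on-*ˡ (nbr G X u z) _ a))) (sym (∑-*ˡ {n} a _))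
  A-* {suc m} X u a v (child z i) = trans
    (+-cong (sym (trans (on-*ˡ (isRoot i) _ a) (on-cong {isRoot i} (λ _ → on-*ˡ (nbr G X u z) _ a)))) (A-* (del₁ X u) z a (v ∘ child z) i))
    (sym (distribˡ a _ _))

  pair : ∀ {m} → (Idx n m → ℤ) → Vec m → Carrier
  pair {zero}  w v = hom (w root) * v root
  pair {suc m} w v = hom (w root) * v root + ∑ (λ z → pair (w ∘ child z) (v ∘ child z))

  pair-congʳ : ∀ {m} (w : Idx n m → ℤ) {v v′ : Vec m} → (∀ i → v i ≈ v′ i) → pair w v ≈ pair w v′
  pair-congʳ {zero} w e = *-congˡ (e root)
  pair-congʳ {suc m} w e = +-cong (*-congˡ (e root)) (∑-cong {n} (λ z → pair-congʳ (w ∘ child z) (e ∘ child z)))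

  pair-+ʳ : ∀ {m} (w : Idx n m → ℤ) (v v′ : Vec m) → pair w (λ i → v i + v′ i) ≈ pair w v + pair w v′
  pair-+ʳ {zero} w v v′ = distribˡ _ _ _
  pair-+ʳ {suc m} w v v′ = trans (+-cong (distribˡ _ _ _)
      (trans (∑-cong {n} (λ z → pair-+ʳ (w ∘ child z) (v ∘ child z) (v′ ∘ child z))) (∑-+ {n} _ _)))
    (solve 4 (λ a b c d → (a :+ b) :+ (c :+ d) := (a :+ c) :+ (b :+ d)) refl _ _ _ _)

  pair-+ˡ : ∀ {m} (w w′ : Idx n m → ℤ) (v : Vec m) → pair (λ i → w i ℤ.+ w′ i) v ≈ pair w v + pair w′ v
  pair-+ˡ {zero} w w′ v = trans (*-congʳ (hom-+ _ _)) (distribʳ _ _ _)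
  pair-+ˡ {suc m} w w′ v = trans (+-cong (trans (*-congʳ (hom-+ _ _)) (distribʳ _ _ _))
      (trans (∑-cong {n} (λ z → pair-+ˡ (w ∘ child z) (w′ ∘ child z) (v ∘ child z))) (∑-+ {n} _ _)))
    (solve 4 (λ a b c d → (a :+ b) :+ (c :+ d) := (a :+ c) :+ (b :+ d)) refl _ _ _ _)

  pair-*ʳ : ∀ {m} (w : Idx n m → ℤ) a (v : Vec m) → pair w (λ i → a * v i) ≈ a * pair w v
  pair-*ʳ {zero} w a v = solve 3 (λ w a v → w :* (a :* v) := a :* (w :* v)) refl _ _ _
  pair-*ʳ {suc m} w a v = trans (+-cong (solve 3 (λ w a v → w :* (a :* v) := a :* (w :* v)) refl _ _ _)
      (trans (∑-cong {n} (λ z → pair-*ʳ (w ∘ child z) a (v ∘ child z))) (sym (∑-*ˡ {n} a _))))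
    (sym (distribˡ a _ _))

  pair-*ˡ : ∀ {m} a (w : Idx n m → ℤ) (v : Vec m) → pair (λ i → a ℤ.* w i) v ≈ hom a * pair w v
  pair-*ˡ {zero} a w v = trans (*-congʳ (hom-* _ _)) (*-assoc _ _ _)
  pair-*ˡ {suc m} a w v = trans (+-cong (trans (*-congʳ (hom-* _ _)) (*-assoc _ _ _))
      (trans (∑-cong {n} (λ z → pair-*ˡ a (w ∘ child z) (v ∘ child z))) (sym (∑-*ˡ {n} (hom a) _))))
    (sym (distribˡ (hom a) _ _))

  pair-0ˡ : ∀ {m} {w : Idx n m → ℤ} (v : Vec m) → (∀ i → w i ≡ + 0) → pair w v ≈ 0#
  pair-0ˡ {zero} v e = trans (*-congʳ (trans (reflexive (cong hom (e root))) hom-0)) (zeroˡ _)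
  pair-0ˡ {suc m} v e = trans (+-cong (trans (*-congʳ (trans (reflexive (cong hom (e root))) hom-0)) (zeroˡ _))
    (∑-zero {n} (λ z → pair-0ˡ (v ∘ child z) (e ∘ child z)))) (+-identityˡ _)

  pair-0ʳ : ∀ {m} (w : Idx n m → ℤ) {v : Vec m} → (∀ i → v i ≈ 0#) → pair w v ≈ 0#
  pair-0ʳ {zero} w e = trans (*-congˡ (e root)) (zeroʳ _)
  pair-0ʳ {suc m} w e = trans (+-cong (trans (*-congˡ (e root)) (zeroʳ _))
    (∑-zero {n} (λ z → pair-0ʳ (w ∘ child z) (e ∘ child z)))) (+-identityˡ _)

  pair-rootʳ : ∀ {m} (w : Idx n m → ℤ) d → pair w (λ i → on (isRoot i) d) ≈ hom (w root) * d
  pair-rootʳ {zero} w d = refl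
  pair-rootʳ {suc m} w d = trans (+-congˡ (∑-zero {n} (λ z → pair-0ʳ (w ∘ child z) (λ _ → refl)))) (+-identityʳ _)

  act : ∀ {m} → VSet n → Fin n → List ℤ → Vec m → Vec m
  act X u []      v i = 0#
  act X u (a ∷ p) v i = hom a * v i + A X u (act X u p v) i

  act-A : ∀ {m} X u p (v : Vec m) i → act X u p (A X u v) i ≈ A X u (act X u p v) i
  act-A X u [] v i = sym (trans (A-cong X u {v′ = λ i → 0# * v i} (λ i → sym (zeroˡ _)) i) (trans (A-* X u 0# v i) (zeroˡ _)))
  act-A X u (a ∷ p) v i = trans (+-cong (sym (A-* X u (hom a) v i)) (A-cong X u (act-A X u p v) i))
    (sym (A-+ X u (λ i → hom a * v i) (A X u (act X u p v)) i))

  sumSq : ∀ {m} → VSet n → Fin n → List (List ℤ) → Vec m → Vec m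
  sumSq X u []       v i = 0#
  sumSq X u (p ∷ ps) v i = act X u p (act X u p v) i + sumSq X u ps v i

  iter : ∀ {m} → VSet n → Fin n → List (List ℤ) → ℕ → Vec m → Vec m
  iter X u ps zero    v = v
  iter X u ps (suc k) v = sumSq X u ps (iter X u ps k v)

module _ {n : ℕ} (G : Graph n) where
  private module Z = TreeOps ℤring G idHom

  module Adjoint {c ℓ} (R : CommutativeRing c ℓ) (φ : Hom R) where
    open CommutativeRing R hiding (zero)
    open Hom φ
    open RingSums R
    open TreeOps R G φ
    open Solver using (solve; _:+_; _:*_; _:=_; :-_; _:-_)
    open import Relation.Binary.Reasoning.Setoid setoid

    hom-on : ∀ b a → hom (RingSums.on ℤring b a) ≈ on b (hom a)
    hom-on true  a = refl
    hom-on false a = hom-0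

    hom-∑ : ∀ {m} (f : Fin m → ℤ) → hom (RingSums.∑ ℤring f) ≈ ∑ (λ i → hom (f i))
    hom-∑ {zero}  f = hom-0
    hom-∑ {suc m} f = trans (hom-+ _ _) (+-congˡ (hom-∑ (f ∘ suc)))

    pair-rootˡ : ∀ {m} d (v : Vec m) → pair (λ i → RingSums.on ℤring (isRoot i) d) v ≈ hom d * v root
    pair-rootˡ {zero} d v = refl
    pair-rootˡ {suc m} d v = trans (+-congˡ (∑-zero {n} (λ z → pair-0ˡ (v ∘ child z) (λ _ → ≡-refl)))) (+-identityʳ _)

    -- Symmetry of the adjacency operator: each tree edge yields the same two terms on both sides.
    A-adjoint : ∀ {m} X u (w : Idx n m → ℤ) (v : Vec m) → pair (Z.A X u w) v ≈ pair w (A X u v)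
    A-adjoint {zero} X u w v = trans (trans (*-congʳ hom-0) (zeroˡ _)) (sym (zeroʳ _))
    A-adjoint {suc m} X u w v = begin
      hom (RingSums.∑ ℤring (λ z → RingSums.on ℤring (b z) (w (child z root)))) * v root
        + ∑ (λ z → pair (λ i → RingSums.on ℤring (isRoot i) (RingSums.on ℤring (b z) (w root)) ℤ.+ Z.A (del₁ X u) z (w ∘ child z) i) (v ∘ child z))
          ≈⟨ +-cong (trans (*-congʳ (trans (hom-∑ {n} _) (∑-cong {n} (λ z → hom-on (b z) (w (child z root))))))
                      (trans (∑-*ʳ {n} (v root) (λ z → on (b z) (hom (w (child z root)))))
                             (∑-cong {n} (λ z → trans (on-*ʳ (b z) _ _) (sym (on-*ˡ (b z) _ _))))))
               (∑-cong {n} (λ z → trans (pair-+ˡ (λ i → RingSums.on ℤring (isRoot i) (RingSums.on ℤring (b z) (w root))) (Z.A (del₁ X u) z (w ∘ child z)) (v ∘ child z))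
                 (+-cong (trans (pair-rootˡ (RingSums.on ℤring (b z) (w root)) (v ∘ child z))
                           (trans (*-congʳ (hom-on (b z) (w root))) (trans (on-*ʳ (b z) _ _) (sym (on-*ˡ (b z) _ _)))))
                   (A-adjoint (del₁ X u) z (w ∘ child z) (v ∘ child z))))) ⟩
      ∑ (λ z → hom (w (child z root)) * on (b z) (v root))
        + ∑ (λ z → hom (w root) * on (b z) (v (child z root)) + pair (w ∘ child z) (A (del₁ X u) z (v ∘ child z)))
          ≈⟨ +-congˡ (∑-+ {n} (λ z → hom (w root) * on (b z) (v (child z root))) _) ⟩
      ∑ (λ z → hom (w (child z root)) * on (b z) (v root))
        + (∑ (λ z → hom (w root) * on (b z) (v (child z root))) + ∑ (λ z → pair (w ∘ child z) (A (del₁ X u) z (v ∘ child z))))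
          ≈⟨ solve 3 (λ a b c → a :+ (b :+ c) := b :+ (a :+ c)) refl _ _ _ ⟩
      ∑ (λ z → hom (w root) * on (b z) (v (child z root)))
        + (∑ (λ z → hom (w (child z root)) * on (b z) (v root)) + ∑ (λ z → pair (w ∘ child z) (A (del₁ X u) z (v ∘ child z))))
          ≈⟨ +-cong (sym (∑-*ˡ {n} (hom (w root)) (λ z → on (b z) (v (child z root)))))
               (trans (sym (∑-+ {n} (λ z → hom (w (child z root)) * on (b z) (v root)) _))
                 (∑-cong {n} (λ z → sym (trans (pair-+ʳ (w ∘ child z) (λ i → on (isRoot i) (on (b z) (v root))) (A (del₁ X u) z (v ∘ child z)))
                    (+-congʳ (pair-rootʳ (w ∘ child z) (on (b z) (v root)))))))) ⟩
      hom (w root) * ∑ (λ z → on (b z) (v (child z root)))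
        + ∑ (λ z → pair (w ∘ child z) (λ i → on (isRoot i) (on (b z) (v root)) + A (del₁ X u) z (v ∘ child z) i)) ∎
      where
      b : Fin n → Bool
      b = nbr G X u

    act-adjoint : ∀ {m} X u p (w : Idx n m → ℤ) (v : Vec m) → pair (Z.act X u p w) v ≈ pair w (act X u p v)
    act-adjoint X u [] w v = trans (pair-0ˡ v (λ _ → ≡-refl)) (sym (pair-0ʳ w (λ _ → refl)))
    act-adjoint X u (a ∷ p) w v = begin
      pair (λ i → a ℤ.* w i ℤ.+ Z.A X u (Z.act X u p w) i) v
        ≈⟨ pair-+ˡ (λ i → a ℤ.* w i) (Z.A X u (Z.act X u p w)) v ⟩
      pair (λ i → a ℤ.* w i) v + pair (Z.A X u (Z.act X u p w)) v
        ≈⟨ +-cong (trans (pair-*ˡ a w v) (sym (pair-*ʳ w (hom a) v)))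
             (trans (A-adjoint X u (Z.act X u p w) v) (trans (act-adjoint X u p w (A X u v)) (pair-congʳ w (act-A X u p v)))) ⟩
      pair w (λ i → hom a * v i) + pair w (A X u (act X u p v))
        ≈⟨ pair-+ʳ w (λ i → hom a * v i) (A X u (act X u p v)) ⟨
      pair w (act X u (a ∷ p) v) ∎

    sumSq-adjoint : ∀ {m} X u ps (w : Idx n m → ℤ) (v : Vec m) → pair (Z.sumSq X u ps w) v ≈ pair w (sumSq X u ps v)
    sumSq-adjoint X u [] w v = trans (pair-0ˡ v (λ _ → ≡-refl)) (sym (pair-0ʳ w (λ _ → refl)))
    sumSq-adjoint X u (p ∷ ps) w v = trans (pair-+ˡ (Z.act X u p (Z.act X u p w)) (Z.sumSq X u ps w) v)
      (trans (+-cong (trans (act-adjoint X u p (Z.act X u p w) v) (act-adjoint X u p w (act X u p v))) (sumSq-adjoint X u ps w v))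
        (sym (pair-+ʳ w (act X u p (act X u p v)) (sumSq X u ps v))))

    sumSq-cong : ∀ {m} X u ps {v v′ : Vec m} → (∀ i → v i ≈ v′ i) → ∀ i → sumSq X u ps v i ≈ sumSq X u ps v′ i
    sumSq-cong X u [] e i = refl
    sumSq-cong X u (p ∷ ps) e i = +-cong (act-cong p (act-cong p e) i) (sumSq-cong X u ps e i)
      where
      act-cong : ∀ p {v v′} → (∀ i → v i ≈ v′ i) → ∀ i → act X u p v i ≈ act X u p v′ i
      act-cong [] e i = refl
      act-cong (a ∷ p) e i = +-cong (*-congˡ (e i)) (A-cong X u (act-cong p e) i)

    sumSq-iter : ∀ {m} X u ps k (v : Vec m) i → sumSq X u ps (iter X u ps k v) i ≈ iter X u ps k (sumSq X u ps v) i
    sumSq-iter X u ps zero v i = refl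
    sumSq-iter X u ps (suc k) v i = sumSq-cong X u ps (sumSq-iter X u ps k v) i

    iter-adjoint : ∀ {m} X u ps k (w : Idx n m → ℤ) (v : Vec m) → pair (Z.iter X u ps k w) v ≈ pair w (iter X u ps k v)
    iter-adjoint X u ps zero w v = refl
    iter-adjoint X u ps (suc k) w v = trans (sumSq-adjoint X u ps (Z.iter X u ps k w) v)
      (trans (iter-adjoint X u ps k w (sumSq X u ps v)) (pair-congʳ w (λ i → sym (sumSq-iter X u ps k v i))))

-- Positivity over ℤ and kernels of sums of squares.

data NonNeg : ℤ → Set where
  pos : ∀ k → NonNeg (+ k)

NonNeg-+ : ∀ {a b} → NonNeg a → NonNeg b → NonNeg (a ℤ.+ b)
NonNeg-+ (pos k) (pos l) = pos (k ℕ.+ l)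

NonNeg-sq : ∀ a → NonNeg (a ℤ.* a)
NonNeg-sq (+ k)    = ≡-subst NonNeg (ℤₚ.pos-* k k) (pos (k ℕ.* k))
NonNeg-sq -[1+ k ] = pos _

NonNeg-+≡0 : ∀ {a b} → NonNeg a → NonNeg b → a ℤ.+ b ≡ + 0 → a ≡ + 0 × b ≡ + 0
NonNeg-+≡0 (pos zero) (pos zero) e = ≡-refl , ≡-refl

sq≡0 : ∀ a → a ℤ.* a ≡ + 0 → a ≡ + 0
sq≡0 a e with ℤₚ.i*j≡0⇒i≡0∨j≡0 a e
... | inj₁ p = p
... | inj₂ p = p

private module ℤΣ = RingSums ℤring

NonNeg-∑ : ∀ {m} (f : Fin m → ℤ) → (∀ i → NonNeg (f i)) → NonNeg (ℤΣ.∑ f)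
NonNeg-∑ {zero}  f h = pos 0
NonNeg-∑ {suc m} f h = NonNeg-+ (h Fin.zero) (NonNeg-∑ (f ∘ suc) (h ∘ suc))

NonNeg-∑≡0 : ∀ {m} (f : Fin m → ℤ) → (∀ i → NonNeg (f i)) → ℤΣ.∑ f ≡ + 0 → ∀ i → f i ≡ + 0
NonNeg-∑≡0 {suc m} f h e i with NonNeg-+≡0 (h Fin.zero) (NonNeg-∑ (f ∘ suc) (h ∘ suc)) e
NonNeg-∑≡0 {suc m} f h e zero    | p , q = p
NonNeg-∑≡0 {suc m} f h e (suc i) | p , q = NonNeg-∑≡0 (f ∘ suc) (h ∘ suc) q i

module Positivity {n : ℕ} (G : Graph n) where
  private module Z = TreeOps ℤring G idHom
  open Adjoint G ℤring idHom using (act-adjoint; sumSq-adjoint; pair-rootˡ)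

  Wec : ℕ → Set
  Wec m = Idx n m → ℤ

  infix 8 _·_
  _·_ : ∀ {m} → Wec m → Wec m → ℤ
  _·_ = Z.pair

  NonNeg-· : ∀ {m} (w : Wec m) → NonNeg (w · w)
  NonNeg-· {zero}  w = NonNeg-sq (w root)
  NonNeg-· {suc m} w = NonNeg-+ (NonNeg-sq (w root)) (NonNeg-∑ {n} _ (λ z → NonNeg-· (w ∘ child z)))

  ·-definite : ∀ {m} (w : Wec m) → w · w ≡ + 0 → ∀ i → w i ≡ + 0
  ·-definite {zero} w e root = sq≡0 (w root) e
  ·-definite {suc m} w e i with NonNeg-+≡0 (NonNeg-sq (w root)) (NonNeg-∑ {n} _ (λ z → NonNeg-· (w ∘ child z))) e
  ·-definite {suc m} w e root        | p , q = sq≡0 (w root) p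
  ·-definite {suc m} w e (child z i) | p , q = ·-definite (w ∘ child z) (NonNeg-∑≡0 {n} _ (λ z → NonNeg-· (w ∘ child z)) q z) i

  sumSq-form : ∀ {m} X u ps (w : Wec m) → NonNeg (w · Z.sumSq X u ps w)
  sumSq-form X u [] w = ≡-subst NonNeg (≡-sym (Z.pair-0ʳ w (λ _ → ≡-refl))) (pos 0)
  sumSq-form X u (p ∷ ps) w = ≡-subst NonNeg (≡-sym (Z.pair-+ʳ w (Z.act X u p (Z.act X u p w)) (Z.sumSq X u ps w)))
    (NonNeg-+ (≡-subst NonNeg (act-adjoint X u p w (Z.act X u p w)) (NonNeg-· (Z.act X u p w))) (sumSq-form X u ps w))

  -- By symmetry the form is the sum of the squared lengths of all p(A) w, and over ℤ such a sum
  -- vanishes only termwise.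
  sumSq-kernel : ∀ {m} X u ps (w : Wec m) → w · Z.sumSq X u ps w ≡ + 0 → ∀ {p} → p ∈ ps → ∀ i → Z.act X u p w i ≡ + 0
  sumSq-kernel X u (p ∷ ps) w e
    with NonNeg-+≡0 (≡-subst NonNeg (act-adjoint X u p w (Z.act X u p w)) (NonNeg-· (Z.act X u p w))) (sumSq-form X u ps w)
           (≡-trans (≡-sym (Z.pair-+ʳ w (Z.act X u p (Z.act X u p w)) (Z.sumSq X u ps w))) e)
  ... | a , b = λ where
    (here ≡-refl) → ·-definite (Z.act X u p w) (≡-trans (act-adjoint X u p w (Z.act X u p w)) a)
    (there q)     → sumSq-kernel X u ps w b q

  -- With S symmetric, the squared length of S^(k+1) w is the product of S^k w and S^(k+2) w, so the
  -- exponent can be lowered one step at a time.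
  iter-kernel : ∀ {m} X u ps k (w : Wec m) → (∀ i → Z.iter X u ps (suc k) w i ≡ + 0) → ∀ i → Z.sumSq X u ps w i ≡ + 0
  iter-kernel X u ps zero w e = e
  iter-kernel X u ps (suc k) w e = iter-kernel X u ps k w (·-definite (Z.iter X u ps (suc k) w)
    (≡-trans (sumSq-adjoint X u ps (Z.iter X u ps k w) (Z.iter X u ps (suc k) w)) (Z.pair-0ʳ (Z.iter X u ps k w) e)))

  δ₀ : ∀ {m} → Wec m
  δ₀ i = ℤΣ.on (isRoot i) (+ 1)

  embed : ∀ {m} → Fin n → Wec m → Wec (suc m)
  embed z e root         = + 0
  embed z e (child z′ i) = ℤΣ.on (does (z′ ≟ᶠ z)) (e i)

  basis : ∀ m → List (Wec m)
  basis zero    = δ₀ ∷ []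
  basis (suc m) = δ₀ ∷ concatFin (λ z → map (embed z) (basis m))

  embed-· : ∀ {m} z (e : Wec m) w → embed z e · w ≡ e · (w ∘ child z)
  embed-· {m} z e w = ≡-trans (ℤₚ.+-identityˡ (ℤΣ.∑ (λ z′ → (embed z e ∘ child z′) · (w ∘ child z′))))
    (≡-trans (ℤΣ.∑-single {n} z off) on′)
    where
    off : ∀ z′ → z′ ≢ z → (embed z e ∘ child z′) · (w ∘ child z′) ≡ + 0
    off z′ z′≢z with z′ ≟ᶠ z
    ... | yes p = ⊥-elim (z′≢z p)
    ... | no _  = Z.pair-0ˡ (w ∘ child z′) (λ _ → ≡-refl)
    on′ : (embed z e ∘ child z) · (w ∘ child z) ≡ e · (w ∘ child z)
    on′ with z ≟ᶠ z
    ... | yes _ = ≡-refl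
    ... | no p  = ⊥-elim (p ≡-refl)

  basis-separates : ∀ m (w : Wec m) → (∀ e → e ∈ basis m → e · w ≡ + 0) → ∀ i → w i ≡ + 0
  basis-separates m w h root = ≡-trans (≡-sym (≡-trans (pair-rootˡ (+ 1) w) (ℤₚ.*-identityˡ _))) (h δ₀ (δ₀∈ m))
    where
    δ₀∈ : ∀ m → δ₀ ∈ basis m
    δ₀∈ zero    = here ≡-refl
    δ₀∈ (suc m) = here ≡-refl
  basis-separates (suc m) w h (child z i) = basis-separates m (w ∘ child z)
    (λ e e∈ → ≡-trans (≡-sym (embed-· z e w)) (h (embed z e) (there (∈-concatFin _ z (∈-map⁺ (embed z) e∈))))) i

  module Fredholm {c ℓ k} (R : CommutativeRing c ℓ) (φ : Hom R) (K : CommutativeRing.Carrier R → Set k)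
    (K-cong : ∀ {a b} → CommutativeRing._≈_ R a b → K a → K b) (K-0 : K (CommutativeRing.0# R))
    (K-+ : ∀ {a b} → K a → K b → K (CommutativeRing._+_ R a b))
    (K-* : ∀ a {b} → K b → K (CommutativeRing._*_ R a b)) {m : ℕ} (v : Idx n m → CommutativeRing.Carrier R) where
    open CommutativeRing R hiding (zero)
    open Hom φ
    open TreeOps R G φ
    open RingSums R using (module Solver)
    open Solver using (solve; _:+_; _:*_; _:=_; :-_; _:-_)

    -- Stands for "a nonzero multiple of `r` is an integral combination of `ts`", through two
    -- consequences: the first drives the elimination, the second is the one applied to the
    -- eigenvector modulo the ideal `K`.
    Dependent : List (Wec m) → Wec m → Set k
    Dependent ts r = (∀ w → (∀ t → t ∈ ts → t · w ≡ + 0) → r · w ≡ + 0)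
                   × ((∀ t → t ∈ ts → K (pair t v)) → ∃[ d ] (d ≢ + 0 × K (hom d * pair r v)))

    Separated : List (Wec m) → Wec m → Set
    Separated ts r = ∃[ w ] ((∀ t → t ∈ ts → t · w ≡ + 0) × r · w ≢ + 0)

    combine : ℤ → Wec m → ℤ → Wec m → Wec m
    combine a w b w′ i = a ℤ.* w i ℤ.+ b ℤ.* w′ i

    ·-combineˡ : ∀ a w b w′ z → combine a w b w′ · z ≡ a ℤ.* (w · z) ℤ.+ b ℤ.* (w′ · z)
    ·-combineˡ a w b w′ z = ≡-trans (Z.pair-+ˡ (λ i → a ℤ.* w i) (λ i → b ℤ.* w′ i) z) (cong₂ ℤ._+_ (Z.pair-*ˡ a w z) (Z.pair-*ˡ b w′ z))

    ·-combineʳ : ∀ z a w b w′ → z · combine a w b w′ ≡ a ℤ.* (z · w) ℤ.+ b ℤ.* (z · w′)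
    ·-combineʳ z a w b w′ = ≡-trans (Z.pair-+ʳ z (λ i → a ℤ.* w i) (λ i → b ℤ.* w′ i)) (cong₂ ℤ._+_ (Z.pair-*ʳ z a w) (Z.pair-*ʳ z b w′))

    pair-combine : ∀ a w b w′ → pair (combine a w b w′) v ≈ hom a * pair w v + hom b * pair w′ v
    pair-combine a w b w′ = trans (pair-+ˡ (λ i → a ℤ.* w i) (λ i → b ℤ.* w′ i) v) (+-cong (pair-*ˡ a w v) (pair-*ˡ b w′ v))

    zero-comb : ∀ a b {y z} → y ≡ + 0 → z ≡ + 0 → a ℤ.* y ℤ.+ b ℤ.* z ≡ + 0
    zero-comb a b ≡-refl ≡-refl = ≡-trans (cong₂ ℤ._+_ (ℤₚ.*-zeroʳ a) (ℤₚ.*-zeroʳ b)) ≡-refl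

    -- Fraction-free elimination. A vector `w₀` killed by `ts` but not by `t` is the pivot, and `r`
    -- is replaced by (t·w₀) r - (r·w₀) t, which kills `w₀`. With no rows left, `r` separates itself
    -- unless it is 0.
    alternative : ∀ ts r → Separated ts r ⊎ Dependent ts r
    alternative [] r with r · r ℤ.≟ + 0
    ... | no ne = inj₁ (r , (λ _ ()) , ne)
    ... | yes e = inj₂ ((λ w _ → Z.pair-0ˡ w r≡0) , λ _ → + 1 , (λ ()) , K-* (hom (+ 1)) (K-cong (sym (pair-0ˡ v r≡0)) K-0))
      where r≡0 = ·-definite r e
    alternative (t ∷ ts) r with alternative ts t
    ... | inj₂ (t-dep , t-K) with alternative ts r
    ...   | inj₁ (w , h , ne) = inj₁ (w , (λ { _ (here ≡-refl) → t-dep w h ; s (there q) → h s q }) , ne)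
    ...   | inj₂ (r-dep , r-K) = inj₂ ((λ w h → r-dep w (λ s q → h s (there q))) , λ h → r-K (λ s q → h s (there q)))
    alternative (t ∷ ts) r | inj₁ (w₀ , h₀ , tw₀≢0) with alternative ts (combine (t · w₀) r (ℤ.- (r · w₀)) t)
    ...   | inj₁ (w₁ , h₁ , ne) = inj₁ (w , zeros , λ e → ne (≡-trans rw′ e))
      where
      w = combine (t · w₀) w₁ (ℤ.- (t · w₁)) w₀
      zeros : ∀ s → s ∈ t ∷ ts → s · w ≡ + 0
      zeros _ (here ≡-refl) = ≡-trans (·-combineʳ t (t · w₀) w₁ (ℤ.- (t · w₁)) w₀) (cancel (t · w₀) (t · w₁))
        where
        cancel : ∀ a b → a ℤ.* b ℤ.+ ℤ.- b ℤ.* a ≡ + 0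
        cancel = solve-∀ℤ
      zeros s (there q) = ≡-trans (·-combineʳ s (t · w₀) w₁ (ℤ.- (t · w₁)) w₀) (zero-comb (t · w₀) (ℤ.- (t · w₁)) (h₁ s q) (h₀ s q))
      rw′ : combine (t · w₀) r (ℤ.- (r · w₀)) t · w₁ ≡ r · w
      rw′ = ≡-trans (·-combineˡ (t · w₀) r (ℤ.- (r · w₀)) t w₁) (≡-trans (swap (t · w₀) (r · w₁) (r · w₀) (t · w₁))
              (≡-sym (·-combineʳ r (t · w₀) w₁ (ℤ.- (t · w₁)) w₀)))
        where
        swap : ∀ a b c d → a ℤ.* b ℤ.+ ℤ.- c ℤ.* d ≡ a ℤ.* b ℤ.+ ℤ.- d ℤ.* c
        swap = solve-∀ℤ
    ...   | inj₂ (dep , depK) = inj₂ (dep′ , depK′)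
      where
      dep′ : ∀ w → (∀ s → s ∈ t ∷ ts → s · w ≡ + 0) → r · w ≡ + 0
      dep′ w h with ℤₚ.i*j≡0⇒i≡0∨j≡0 (t · w₀) prod
        where
        prod : (t · w₀) ℤ.* (r · w) ≡ + 0
        prod = ≡-trans (≡-sym (≡-trans (cong (λ y → (t · w₀) ℤ.* (r · w) ℤ.+ ℤ.- (r · w₀) ℤ.* y) (h t (here ≡-refl)))
                  (≡-trans (cong (λ y → (t · w₀) ℤ.* (r · w) ℤ.+ y) (ℤₚ.*-zeroʳ (ℤ.- (r · w₀)))) (ℤₚ.+-identityʳ _))))
                (≡-trans (≡-sym (·-combineˡ (t · w₀) r (ℤ.- (r · w₀)) t w)) (dep w (λ s q → h s (there q))))
      ... | inj₁ p = ⊥-elim (tw₀≢0 p)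
      ... | inj₂ p = p
      depK′ : (∀ s → s ∈ t ∷ ts → K (pair s v)) → ∃[ d ] (d ≢ + 0 × K (hom d * pair r v))
      depK′ h with depK (λ s q → h s (there q))
      ... | d , d≢0 , kd = d ℤ.* (t · w₀) , nz , K-cong eq (K-+ kd (K-* (- (hom d * hom (ℤ.- (r · w₀)))) (h t (here ≡-refl))))
        where
        nz : d ℤ.* (t · w₀) ≢ + 0
        nz e with ℤₚ.i*j≡0⇒i≡0∨j≡0 d e
        ... | inj₁ p = d≢0 p
        ... | inj₂ p = tw₀≢0 p
        eq : hom d * pair (combine (t · w₀) r (ℤ.- (r · w₀)) t) v + - (hom d * hom (ℤ.- (r · w₀))) * pair t v
           ≈ hom (d ℤ.* (t · w₀)) * pair r v
        eq = trans (+-congʳ (*-congˡ (pair-combine (t · w₀) r (ℤ.- (r · w₀)) t)))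
          (trans (solve 5 (λ d a r b t → d :* (a :* r :+ b :* t) :+ (:- (d :* b)) :* t := (d :* a) :* r) refl _ _ _ _ _)
            (*-congʳ (sym (hom-* d (t · w₀)))))

  -- p(A)² summed over ps annihilates exactly the common kernel of the p(A), so a power of it lying in K forces each p into K.
  module Real {c ℓ k} (R : CommutativeRing c ℓ) (φ : Hom R) (K : CommutativeRing.Carrier R → Set k)
    (K-cong : ∀ {a b} → CommutativeRing._≈_ R a b → K a → K b) (K-0 : K (CommutativeRing.0# R))
    (K-+ : ∀ {a b} → K a → K b → K (CommutativeRing._+_ R a b))
    (K-* : ∀ a {b} → K b → K (CommutativeRing._*_ R a b))
    (x : CommutativeRing.Carrier R) {m : ℕ} (X : VSet n) (u : Fin n) (v : Idx n m → CommutativeRing.Carrier R)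
    (eigen : ∀ i → K (CommutativeRing._-_ R (TreeOps.A R G φ X u v i) (CommutativeRing._*_ R x (v i)))) where
    open CommutativeRing R hiding (zero)
    open Hom φ
    open TreeOps R G φ
    open RingSums R
    open Solver using (solve; _:+_; _:*_; _:=_; :-_; _:-_)
    open Adjoint G R φ using () renaming (act-adjoint to act-adjointᴿ; iter-adjoint to iter-adjointᴿ; pair-rootˡ to pair-rootˡᴿ)
    open Adjoint G ℤring idHom using () renaming (act-adjoint to act-adjointᶻ; iter-adjoint to iter-adjointᶻ)
    open Fredholm R φ K K-cong K-0 K-+ K-* v
    open PolyEval R φ x

    -- Congruence of `z` to β v modulo `K`. As A v is congruent to x v, a polynomial in A acts on
    -- `v` as multiplication by its value at x.
    Near : Vec m → Carrier → Set k
    Near z β = ∀ i → K (z i - β * v i)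

    K-on : ∀ b {a} → K a → K (on b a)
    K-on true  h = h
    K-on false h = K-0

    K-∑ : ∀ {m} (f : Fin m → Carrier) → (∀ i → K (f i)) → K (∑ f)
    K-∑ {zero}  f h = K-0
    K-∑ {suc m} f h = K-+ (h Fin.zero) (K-∑ (f ∘ suc) (h ∘ suc))

    K-pair : ∀ {m} (w : Wec m) (z : Vec m) → (∀ i → K (z i)) → K (pair w z)
    K-pair {zero} w z h = K-* _ (h root)
    K-pair {suc m} w z h = K-+ (K-* _ (h root)) (K-∑ {n} _ (λ y → K-pair (w ∘ child y) (z ∘ child y) (h ∘ child y)))

    A-K : ∀ {m} X u (z : Vec m) → (∀ i → K (z i)) → ∀ i → K (A X u z i)
    A-K {zero} X u z h root = K-0
    A-K {suc m} X u z h root = K-∑ {n} _ (λ y → K-on (nbr G X u y) (h (child y root)))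
    A-K {suc m} X u z h (child y i) = K-+ (K-on (isRoot i) (K-on (nbr G X u y) (h root))) (A-K (del₁ X u) y (z ∘ child y) (h ∘ child y) i)

    A-Near : ∀ {z β} → Near z β → Near (A X u z) (x * β)
    A-Near {z} {β} h i = K-cong eq (K-+ (A-K X u (λ i → z i - β * v i) h i) (K-* β (eigen i)))
      where
      eq : A X u (λ i → z i - β * v i) i + β * (A X u v i - x * v i) ≈ A X u z i - x * β * v i
      eq = trans (+-congʳ (trans (A-+ X u z (λ i → - (β * v i)) i)
             (+-congˡ (trans (A-cong X u (λ i → solve 2 (λ b v → :- (b :* v) := (:- b) :* v) refl β (v i)) i) (A-* X u (- β) v i)))))
           (solve 5 (λ a b c x v → (a :+ (:- b) :* c) :+ b :* (c :- x :* v) := a :- x :* b :* v) refl (A X u z i) β (A X u v i) x (v i))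

    0-0* : ∀ β i → 0# - 0# * β * v i ≈ 0#
    0-0* β i = trans (+-congˡ (-‿cong (trans (*-congʳ (zeroˡ β)) (zeroˡ (v i))))) (-‿inverseʳ 0#)

    act-Near : ∀ p {z β} → Near z β → Near (act X u p z) (eval p * β)
    act-Near [] {z} {β} h i = K-cong (sym (0-0* β i)) K-0
    act-Near (a ∷ p) {z} {β} h i = K-cong
      (solve 7 (λ a z b v y x e → a :* (z :- b :* v) :+ (y :- x :* (e :* b) :* v) := (a :* z :+ y) :- (a :+ x :* e) :* b :* v) refl
        (hom a) (z i) β (v i) (A X u (act X u p z) i) x (eval p))
      (K-+ (K-* (hom a) (h i)) (A-Near (act-Near p h) i))

    sumSq-Near : ∀ ps {z β} → Near z β → Near (sumSq X u ps z) (evalSq ps * β)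
    sumSq-Near [] {z} {β} h i = K-cong (sym (0-0* β i)) K-0
    sumSq-Near (p ∷ ps) {z} {β} h i = K-cong
      (solve 6 (λ y s e b v t → (y :- e :* (e :* b) :* v) :+ (t :- s :* b :* v) := (y :+ t) :- (e :* e :+ s) :* b :* v) refl
        (act X u p (act X u p z) i) (evalSq ps) (eval p) β (v i) (sumSq X u ps z i))
      (K-+ (act-Near p (act-Near p h) i) (sumSq-Near ps h i))

    iter-Near : ∀ ps k → Near (iter X u ps k v) (pow (evalSq ps) k)
    iter-Near ps zero i = K-cong (sym (trans (+-congˡ (-‿cong (*-identityˡ (v i)))) (-‿inverseʳ (v i)))) K-0
    iter-Near ps (suc k) = sumSq-Near ps (iter-Near ps k)

    Near-K : ∀ {z β} → K β → Near z β → ∀ i → K (z i)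
    Near-K {z} {β} kβ h i = K-cong (solve 3 (λ z b v → v :* b :+ (z :- b :* v) := z) refl (z i) β (v i)) (K-+ (K-* (v i) kβ) (h i))

    power-in-K⇒eval-in-K : ∀ ps k → K (pow (evalSq ps) (suc k)) → ∀ {p} → p ∈ ps → ∃[ d ] (d ≢ + 0 × K (hom d * (eval p * v root)))
    power-in-K⇒eval-in-K ps k kS {p} p∈ = by (alternative rows r)
      where
      rows : List (Wec m)
      -- By symmetry, pairing with these rows gives the coordinates of the image under S^(k+1), and
      -- pairing with `r` gives the root coordinate of the image under p(A).
      rows = map (Z.iter X u ps (suc k)) (basis m)
      r : Wec m
      r = Z.act X u p δ₀
      by : Separated rows r ⊎ Dependent rows r → ∃[ d ] (d ≢ + 0 × K (hom d * (eval p * v root)))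
      by (inj₁ (w , h , ne)) = ⊥-elim (ne (≡-trans (act-adjointᶻ X u p δ₀ w) (Z.pair-0ʳ δ₀ (sumSq-kernel X u ps w
          (Z.pair-0ʳ w (iter-kernel X u ps k w iter≡0)) p∈))))
        where
        iter≡0 : ∀ i → Z.iter X u ps (suc k) w i ≡ + 0
        iter≡0 = basis-separates m _ (λ e e∈ → ≡-trans (≡-sym (iter-adjointᶻ X u ps (suc k) e w)) (h _ (∈-map⁺ _ e∈)))
      by (inj₂ (_ , hK)) with hK rowsK
        where
        rowsK : ∀ t → t ∈ rows → K (pair t v)
        rowsK t t∈ with ∈-map⁻ (Z.iter X u ps (suc k)) t∈
        ... | e , _ , ≡-refl = K-cong (sym (iter-adjointᴿ X u ps (suc k) e v)) (K-pair e _ (Near-K kS (iter-Near ps (suc k))))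
      ... | d , d≢0 , kd = d , d≢0 , K-cong eq (K-+ kd (K-* (- hom d) (act-Near p v-Near root)))
        where
        v-Near : Near v 1#
        v-Near = iter-Near ps 0
        eq : hom d * pair r v + - hom d * (act X u p v root - eval p * 1# * v root) ≈ hom d * (eval p * v root)
        eq = trans (+-cong (*-congˡ (trans (act-adjointᴿ X u p δ₀ v) (trans (pair-rootˡᴿ (+ 1) (act X u p v)) (trans (*-congʳ hom-1) (*-identityˡ _)))))
                           (*-congˡ (+-congˡ (-‿cong (*-congʳ (*-identityʳ _))))))
             (solve 4 (λ d a e v → d :* a :+ (:- d) :* (a :- e :* v) := d :* (e :* v)) refl (hom d) (act X u p v root) (eval p) (v root))

-- The identities and the path-tree eigenvector for expansions at θ.

module SeriesIdentities {c ℓ} (F : CharZeroField c ℓ) (θ : CharZeroField.Carrier F) {n : ℕ} (G : Graph n) where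
  open CharZeroField F hiding (zero)
  open Taylor F θ
  open MatchingSeries F θ public using (M; M-cong; M-empty; M-rec; M-graph)
  open Identities seriesRing 𝕩 G (M G) (M-cong G) (M-empty G) (M-rec G) public
  open import Algebra.Properties.Ring ring using (-‿distribʳ-*)

  open Derivation D (λ e i → *-congˡ (e (suc i))) (λ _ _ _ → distribˡ _ _ _) (λ _ → zeroʳ _)
    (λ _ _ → sym (-‿distribʳ-* _ _)) (λ _ → zeroʳ _) D-𝕩 public

module Eigenvector {c ℓ} (F : CharZeroField c ℓ) (θ : CharZeroField.Carrier F) {n : ℕ} (G : Graph n) where
  open MatchingSeries F θ
  open Taylor F θ
  open TreeOps seriesRing G (ιHom seriesRing)
  open RingSums seriesRing
  open Solver using (solve; _:+_; _:*_; _:=_; :-_; _:-_)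
  open import Relation.Binary.Reasoning.Setoid S.setoid

  -- Godsil's eigenvector: the entry at a path P is M(X-P), and at a word that is not a path it is
  -- 0.
  vec : ∀ m → VSet n → Fin n → Vec m
  vec m X u root = M G (del₁ X u)
  vec (suc m) X u (child z i) = on (nbr G X u z) (vec m (del₁ X u) z i)

  A-on : ∀ {m} X u b (v : Vec m) i → A X u (λ i → on b (v i)) i ≋ on b (A X u v i)
  A-on X u true v i = S.refl
  A-on X u false v i = S.trans (A-cong X u {v′ = λ i → 𝟘 ⊛ v i} (λ i → S.sym (S.zeroˡ _)) i) (S.trans (A-* X u 𝟘 v i) (S.zeroˡ _))

  -- The root is the only place where the eigenvalue equation fails. The defect there is -M(X),
  -- which vanishes modulo y to the multiplicity. Depth `m` suffices because a path has at most |X|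
  -- vertices.
  eigen-root : ∀ m X u → card X ≤ suc m → u ∈ᵥ X → A X u (vec m X u) root S.- 𝕩 ⊛ vec m X u root ≋ S.- M G X
  eigen-root m X u le u∈X = begin
    A X u (vec m X u) root S.- 𝕩 ⊛ M G (del₁ X u) ≈⟨ S.+-congʳ (nbrs m le) ⟩
    ∑ (λ z → on (nbr G X u z) (M G (del₂ X u z))) S.- 𝕩 ⊛ M G (del₁ X u)
      ≈⟨ solve 2 (λ a b → a :- b := :- (b :- a)) S.refl _ _ ⟩
    S.- (𝕩 ⊛ M G (del₁ X u) S.- ∑ (λ z → on (nbr G X u z) (M G (del₂ X u z)))) ≈⟨ S.-‿cong (M-rec G X u u∈X) ⟨
    S.- M G X ∎
    where
    nbrs : ∀ m → card X ≤ suc m → A X u (vec m X u) root ≋ ∑ (λ z → on (nbr G X u z) (M G (del₂ X u z)))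
    nbrs zero le = S.sym (∑-zero {n} (λ z → on-false (cong (_∧ adj G u z) (card-empty (del₁ X u) c≡0 z))))
      where
      c≡0 : card (del₁ X u) ≡ 0
      c≡0 = ℕₚ.n≤0⇒n≡0 (ℕₚ.≤-pred (≡-subst (_≤ 1) (card-del₁ X u u∈X) le))
    nbrs (suc m) le = ∑-cong {n} (λ z → on-cong {nbr G X u z} (λ p → on-true p))

  eigen-child : ∀ m X u → card X ≤ suc (suc m) → u ∈ᵥ X → ∀ z i →
    A X u (vec (suc m) X u) (child z i) ≋ 𝕩 ⊛ vec (suc m) X u (child z i)
  eigen-child m X u le u∈X z i = S.trans (S.+-congˡ (A-on Y z (nbr G X u z) (vec m Y z) i)) (caseᵇ (nbr G X u z) yesNbr noNbr)
    where
    Y = del₁ X u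
    leY : card Y ≤ suc m
    leY = ℕₚ.≤-pred (≡-subst (_≤ suc (suc m)) (card-del₁ X u u∈X) le)
    Goal : Set _
    Goal = (on (isRoot i) (on (nbr G X u z) (M G Y)) ⊞ on (nbr G X u z) (A Y z (vec m Y z) i)) ≋ 𝕩 ⊛ on (nbr G X u z) (vec m Y z i)
    noNbr : nbr G X u z ≡ false → Goal
    noNbr p rewrite p = S.trans (S.+-identityʳ _) (S.trans (zz (isRoot i)) (S.sym (S.zeroʳ 𝕩)))
      where
      zz : ∀ b → on b 𝟘 ≋ 𝟘
      zz true  = S.refl
      zz false = S.refl
    yesNbr : nbr G X u z ≡ true → Goal
    yesNbr p rewrite p = by m leY i
      where
      z∈Y = proj₁ (∧-true⁻ {Y z} p)
      by : ∀ m → card Y ≤ suc m → ∀ i → (on (isRoot i) (M G Y) ⊞ A Y z (vec m Y z) i) ≋ 𝕩 ⊛ vec m Y z i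
      by m le root = begin
        M G Y ⊞ A Y z (vec m Y z) root
          ≈⟨ solve 3 (λ a b c → a :+ b := c :+ (a :+ (b :- c))) S.refl _ _ (𝕩 ⊛ vec m Y z root) ⟩
        𝕩 ⊛ vec m Y z root ⊞ (M G Y ⊞ (A Y z (vec m Y z) root S.- 𝕩 ⊛ vec m Y z root))
          ≈⟨ S.+-congˡ (S.trans (S.+-congˡ (eigen-root m Y z le z∈Y)) (S.-‿inverseʳ _)) ⟩
        𝕩 ⊛ vec m Y z root ⊞ 𝟘 ≈⟨ S.+-identityʳ _ ⟩
        𝕩 ⊛ vec m Y z root ∎
      by (suc m) le (child z′ i) = S.trans (S.+-identityˡ _) (eigen-child m Y z le z∈Y z′ i)

-- Sums of squares in ℤ[θ].

module Reality {c ℓ} (F : CharZeroField c ℓ) (θ : CharZeroField.Carrier F) where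
  open CharZeroField F hiding (zero)
  open Taylor F θ
  open CRing cring using (ι; ι-+; ι-neg; ι-1; module Solver)
  open Solver using (solve; _:+_; _:*_; _:=_; :-_; _:-_)
  module Sι = CRing seriesRing

  evalF : List ℤ → Carrier
  evalF []      = 0#
  evalF (a ∷ p) = ι a + θ * evalF p

  sqF : List Carrier → Carrier
  sqF []       = 0#
  sqF (a ∷ as) = a * a + sqF as

  -- Elements of ℤ[θ].
  IsInt : Carrier → Set ℓ
  IsInt a = ∃[ p ] (evalF p ≈ a)

  IsInt-cong : ∀ {a b} → a ≈ b → IsInt a → IsInt b
  IsInt-cong e (p , h) = p , trans h e

  IsInt-0 : IsInt 0#
  IsInt-0 = [] , refl

  IsInt-1 : IsInt 1#
  IsInt-1 = (+ 1 ∷ []) , trans (+-cong ι-1 (zeroʳ θ)) (+-identityʳ 1#)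

  _+ℤ_ : List ℤ → List ℤ → List ℤ
  []      +ℤ q       = q
  (a ∷ p) +ℤ []      = a ∷ p
  (a ∷ p) +ℤ (b ∷ q) = (a ℤ.+ b) ∷ (p +ℤ q)

  evalF-+ : ∀ p q → evalF (p +ℤ q) ≈ evalF p + evalF q
  evalF-+ [] q = sym (+-identityˡ _)
  evalF-+ (a ∷ p) [] = sym (+-identityʳ _)
  evalF-+ (a ∷ p) (b ∷ q) = trans (+-cong (ι-+ a b) (*-congˡ (evalF-+ p q)))
    (solve 5 (λ a b t p q → (a :+ b) :+ t :* (p :+ q) := (a :+ t :* p) :+ (b :+ t :* q)) refl _ _ _ _ _)

  IsInt-+ : ∀ {a b} → IsInt a → IsInt b → IsInt (a + b)
  IsInt-+ (p , h) (q , h′) = p +ℤ q , trans (evalF-+ p q) (+-cong h h′)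

  IsInt-neg : ∀ {a} → IsInt a → IsInt (- a)
  IsInt-neg (p , h) = map ℤ.-_ p , trans (neg p) (-‿cong h)
    where
    open import Algebra.Properties.AbelianGroup +-abelianGroup using (ε⁻¹≈ε)
    neg : ∀ p → evalF (map ℤ.-_ p) ≈ - evalF p
    neg [] = sym ε⁻¹≈ε
    neg (a ∷ p) = trans (+-cong (ι-neg a) (*-congˡ (neg p)))
      (solve 3 (λ a t p → (:- a) :+ t :* (:- p) := :- (a :+ t :* p)) refl _ _ _)

  IsInt-θ : ∀ {a} → IsInt a → IsInt (θ * a)
  IsInt-θ (p , h) = (+ 0 ∷ p) , trans (+-identityˡ _) (*-congˡ h)

  module _ {n : ℕ} (Γ : Graph n) where
    open SeriesIdentities F θ Γ using (M; M-cong; M-empty; M-rec)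
    open RingSums seriesRing

    IntSer : Ser → Set ℓ
    IntSer f = ∀ i → IsInt (f i)

    IntSer-∑ : ∀ {m} (f : Fin m → Ser) → (∀ w → IntSer (f w)) → IntSer (∑ f)
    IntSer-∑ {zero}  f h i = IsInt-0
    IntSer-∑ {suc m} f h i = IsInt-+ (h Fin.zero i) (IntSer-∑ (f ∘ suc) (h ∘ suc) i)

    IntSer-𝕩 : ∀ {f} → IntSer f → IntSer (𝕩 ⊛ f)
    IntSer-𝕩 {f} h zero = IsInt-cong (sym (𝕩⊛-zero f)) (IsInt-θ (h 0))
    IntSer-𝕩 {f} h (suc i) = IsInt-cong (sym (𝕩⊛-suc f i)) (IsInt-+ (IsInt-θ (h (suc i))) (h i))

    IntSer-M : ∀ k X → card X ≤ k → IntSer (M Γ X)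
    IntSer-M-del : ∀ k X u w → card (del₁ X u) ≤ k → nbr Γ X u w ≡ true → IntSer (M Γ (del₂ X u w))

    IntSer-M k X le = by (card X) ≡-refl k le
      where
      by : ∀ c → card X ≡ c → ∀ k → card X ≤ k → IntSer (M Γ X)
      by zero e k le i = IsInt-cong (sym (M-empty Γ X e i)) (one i)
        where
        one : IntSer (const 1#)
        one zero    = IsInt-1
        one (suc i) = IsInt-0
      by (suc c) e zero le with ≡-trans (≡-sym e) (ℕₚ.n≤0⇒n≡0 le)
      ... | ()
      by (suc c) e (suc k) le i with card-positive X c e
      ... | u , u∈X = IsInt-cong (sym (M-rec Γ X u u∈X i)) (IsInt-+ (IntSer-𝕩 (IntSer-M k (del₁ X u) le′) i)
              (IsInt-neg (IntSer-∑ {n} _ nbrs i)))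
        where
        le′ : card (del₁ X u) ≤ k
        le′ = ℕₚ.≤-pred (≡-subst (_≤ suc k) (card-del₁ X u u∈X) le)
        nbrs : ∀ w → IntSer (on (nbr Γ X u w) (M Γ (del₂ X u w)))
        nbrs w with nbr Γ X u w in p
        ... | false = λ _ → IsInt-0
        ... | true = IntSer-M-del k X u w le′ p

    IntSer-M-del zero X u w le p with ≡-trans (≡-sym (ℕₚ.n≤0⇒n≡0 le)) (card-del₁ (del₁ X u) w (proj₁ (∧-true⁻ {del₁ X u w} p)))
    ... | ()
    IntSer-M-del (suc k) X u w le p = IntSer-M k (del₂ X u w)
      (ℕₚ.≤-pred (≡-subst (_≤ suc k) (card-del₁ (del₁ X u) w (proj₁ (∧-true⁻ {del₁ X u w} p))) le))

  ι-const : ∀ a → Sι.ι a ≋ const (ι a)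
  ι-const (+ k) = nat k
    where
    nat : ∀ k → natR seriesRing k ≋ const (natR cring k)
    nat zero = S.sym const-0
    nat (suc k) = S.trans (S.+-congˡ (nat k)) (S.sym (const-⊞ 1# (natR cring k)))
  ι-const -[1+ k ] zero = -‿cong (ι-const (+ suc k) 0)
  ι-const -[1+ k ] (suc i) = trans (-‿cong (ι-const (+ suc k) (suc i))) ε⁻¹≈ε
    where open import Algebra.Properties.AbelianGroup +-abelianGroup using (ε⁻¹≈ε)

  ι≉0 : ∀ a → a ≢ + 0 → ¬ (ι a ≈ 0#)
  ι≉0 (+ zero) ne = λ _ → ne ≡-refl
  ι≉0 (+ suc k) ne = charZero k
  ι≉0 -[1+ k ] ne e = charZero k (trans (sym (⁻¹-involutive _)) (trans (-‿cong e) ε⁻¹≈ε))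
    where open import Algebra.Properties.AbelianGroup +-abelianGroup using (⁻¹-involutive; ε⁻¹≈ε)

  *-nonzero : ∀ {a b} → ¬ (a ≈ 0#) → ¬ (b ≈ 0#) → ¬ (a * b ≈ 0#)
  *-nonzero {a} {b} a≉0 b≉0 e with inverse a a≉0
  ... | a⁻¹ , h = b≉0 (trans (sym (*-identityˡ b)) (trans (*-congʳ (sym h))
        (trans (solve 3 (λ a i b → (a :* i) :* b := i :* (a :* b)) refl a a⁻¹ b) (trans (*-congˡ e) (zeroʳ _)))))

  module _ (σ : Carrier) where

    Div : Carrier → Set (c ⊔ ℓ)
    Div a = ∃[ z ] (a ≈ σ * z)

    Div-cong : ∀ {a b} → a ≈ b → Div a → Div b
    Div-cong e (z , h) = z , trans (sym e) h

    Div-0 : Div 0#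
    Div-0 = 0# , sym (zeroʳ σ)

    Div-+ : ∀ {a b} → Div a → Div b → Div (a + b)
    Div-+ (z , h) (z′ , h′) = z + z′ , trans (+-cong h h′) (sym (distribˡ σ z z′))

    Div-* : ∀ a {b} → Div b → Div (a * b)
    Div-* a (z , h) = a * z , trans (*-congˡ h) (solve 3 (λ a s z → a :* (s :* z) := s :* (a :* z)) refl a σ z)

    -- The ideal (σ , y ^ k).
    DivBelow : ℕ → Ser → Set (c ⊔ ℓ)
    DivBelow k f = ∀ i → i < k → Div (f i)

    DivBelow-⊛ : ∀ {k} a {f} → DivBelow k f → DivBelow k (a ⊛ f)
    DivBelow-⊛ a h zero p = Div-* (a 0) (h 0 p)
    DivBelow-⊛ a h (suc i) p = Div-+ (Div-* (a 0) (h (suc i) p)) (DivBelow-⊛ (a ∘ suc) h i (ℕₚ.<-trans (ℕₚ.n<1+n i) p))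

    -- A series with constant term σ lies in (σ, y), so its j-th power lies in (σ, y)^j and hence in
    -- (σ, y^j).
    DivBelow-pow : ∀ (pow : Ser → ℕ → Ser) s → s 0 ≈ σ → (∀ j → pow s (suc j) ≡ s ⊛ pow s j) → ∀ j → DivBelow j (pow s j)
    DivBelow-pow pow s e eq zero i ()
    DivBelow-pow pow s e eq (suc j) i p rewrite eq j with i | p
    ... | zero | _ = pow s j 0 , *-congʳ e
    ... | suc i | s≤s q = Div-+ (pow s j (suc i) , *-congʳ e) (DivBelow-⊛ (s ∘ suc) (DivBelow-pow pow s e eq j) i q)

  module FromRoot {n : ℕ} (G : Graph n) (κ : ℕ) (mult : Taylor.HasVal F θ (MatchingSeries.M F θ G full) (suc κ)) where
    open SeriesIdentities F θ G
    open Eigenvector F θ G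

    open PolyEval seriesRing (ιHom seriesRing) 𝕩

    eval-0 : ∀ p → eval p 0 ≈ evalF p
    eval-0 [] = refl
    eval-0 (a ∷ p) = +-cong (ι-const a 0) (trans (𝕩⊛-zero (eval p)) (*-congˡ (eval-0 p)))

    evalSq-0 : ∀ qs → evalSq qs 0 ≈ sqF (map evalF qs)
    evalSq-0 [] = refl
    evalSq-0 (q ∷ qs) = +-cong (*-cong (eval-0 q) (eval-0 q)) (evalSq-0 qs)

    module _ (ps : List (List ℤ)) where
      private
        σ = sqF (map evalF ps)
        N = card {n} full

        K : Ser → Set (c ⊔ ℓ)
        K = DivBelow σ (suc κ)

        open import Algebra.Properties.AbelianGroup +-abelianGroup using (ε⁻¹≈ε)

        MK : K (λ i → - M G full i)
        MK i p = Div-cong σ (sym (trans (-‿cong (proj₁ mult i p)) ε⁻¹≈ε)) (Div-0 σ)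

        eigenK : ∀ u m → card {n} full ≤ suc m → ∀ i → K (TreeOps.A seriesRing G (ιHom seriesRing) full u (vec m full u) i S.- 𝕩 ⊛ vec m full u i)
        eigenK u m le root = λ i p → Div-cong σ (sym (eigen-root m full u le ≡-refl i)) (MK i p)
        eigenK u (suc m) le (child z i) = λ j p → Div-cong σ (sym (trans (+-congʳ (eigen-child m full u le ≡-refl z i j)) (-‿inverseʳ _))) (Div-0 σ)

        -- The root entry of the eigenvector started at `u` is M(G-u). The exponent κ + 1 brings the
        -- power of the sum of squares, evaluated at x, into the ideal (σ, y^(κ+1)).
        multiple : ∀ {p} → p ∈ ps → ∀ u → ∃[ d ] (d ≢ + 0 × K (Sι.ι d ⊛ (eval p ⊛ M G (del₁ full u))))
        multiple p∈ u = Positivity.Real.power-in-K⇒eval-in-K G seriesRing (ιHom seriesRing) K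
          (λ e h i p → Div-cong σ (e i) (h i p)) (λ _ _ → Div-0 σ) (λ h h′ i p → Div-+ σ (h i p) (h′ i p)) (λ a {f} → DivBelow-⊛ σ a {f})
          𝕩 {N} full u (vec N full u) (eigenK u N (ℕₚ.n≤1+n N)) ps κ
          (DivBelow-pow σ pow (evalSq ps) (evalSq-0 ps) (λ _ → ≡-refl) (suc κ)) p∈

        cancel-ι : ∀ d → d ≢ + 0 → ∀ f → K (Sι.ι d ⊛ f) → K f
        cancel-ι d d≢0 f h = go (inverse (ι d) (ι≉0 d d≢0))
          where
          go : ∃[ y ] (ι d * y ≈ 1#) → K f
          go (d⁻¹ , inv) i q = Div-cong σ eq (Div-* σ d⁻¹ (h i q))
            where
            eq : d⁻¹ * (Sι.ι d ⊛ f) i ≈ f i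
            eq = trans (*-congˡ (trans (⊛-cong {g = f} {g′ = f} (ι-const d) (λ _ → refl) i) (const-⊛ (ι d) f i)))
              (trans (solve 3 (λ a b c → a :* (b :* c) := (b :* a) :* c) refl d⁻¹ (ι d) (f i)) (trans (*-congʳ inv) (*-identityˡ _)))

        divides-at : ∀ {p} → p ∈ ps → ∀ u → K (eval p ⊛ M G (del₁ full u))
        divides-at {p} p∈ u = let (d , d≢0 , h) = multiple p∈ u in cancel-ι d d≢0 (eval p ⊛ M G (del₁ full u)) h

        divides-D : ∀ {p} → p ∈ ps → K (eval p ⊛ D (M G full))
        divides-D {p} p∈ i q = Div-cong σ
          (sym (trans (⊛-cong {f = eval p} (λ _ → refl) (D-M (card {n} full) full ≡-refl) i) (RingSums.∑-*ˡ seriesRing {n} (eval p) (λ z → M G (del₁ full z)) i)))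
          (sums (λ z → eval p ⊛ M G (del₁ full z)) (divides-at p∈) i q)
          where
          sums : ∀ {m} (f : Fin m → Ser) → (∀ z → K (f z)) → K (RingSums.∑ seriesRing f)
          sums {zero}  f h i q = Div-0 σ
          sums {suc m} f h i q = Div-+ σ (h Fin.zero i q) (sums (f ∘ suc) (h ∘ suc) i q)

      -- Since D (M full) has order exactly κ, its coefficient there is a unit.
      regular : ∀ {p} → p ∈ ps → Div σ (evalF p)
      regular {p} p∈ = go (inverse (D (M G full) κ) (*-nonzero (charZero κ) (proj₂ mult)))
        where
        go : ∃[ y ] (D (M G full) κ * y ≈ 1#) → Div σ (evalF p)
        go (e⁻¹ , inv) = Div-cong σ eq (Div-* σ e⁻¹ (divides-D p∈ κ ℕₚ.≤-refl))
          where
          eq : e⁻¹ * (eval p ⊛ D (M G full)) κ ≈ evalF p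
          eq = trans (*-congˡ (trans (⊛-lead {0} {κ} (λ _ ()) (Ord-D (proj₁ mult))) (*-congʳ (eval-0 p))))
            (trans (solve 3 (λ a b c → a :* (b :* c) := (c :* a) :* b) refl e⁻¹ (evalF p) (D (M G full) κ)) (trans (*-congʳ inv) (*-identityˡ _)))

    -- A single square gives a = a² z, that is a (1 - a z) = 0. If a cannot be nonzero, then 1 - a z
    -- is not 0, hence invertible, and a = 0.
    IsInt-stable : ∀ {a} → IsInt a → ¬ ¬ (a ≈ 0#) → a ≈ 0#
    IsInt-stable {a} (p , e) ¬¬0 = go (regular (p ∷ []) (here ≡-refl))
      where
      open import Algebra.Properties.AbelianGroup +-abelianGroup using (ε⁻¹≈ε)
      go : Div (sqF (evalF p ∷ [])) (evalF p) → a ≈ 0#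
      go (z , h) = cancel (inverse (1# - a * z) unit)
        where
        unit : ¬ (1# - a * z ≈ 0#)
        unit e′ = ¬¬0 (λ a≈0 → 0≉1 (trans (sym e′)
          (trans (+-congˡ (-‿cong (trans (*-congʳ a≈0) (zeroˡ z)))) (trans (+-congˡ ε⁻¹≈ε) (+-identityʳ 1#)))))
        a≈ : a ≈ a * a * z
        a≈ = trans (sym e) (trans h (*-congʳ (trans (+-identityʳ _) (*-cong e e))))
        ann : a * (1# - a * z) ≈ 0#
        ann = trans (solve 3 (λ a o z → a :* (o :- a :* z) := a :* o :- a :* a :* z) refl a 1# z)
          (trans (+-cong (*-identityʳ a) (-‿cong (sym a≈))) (-‿inverseʳ a))
        cancel : ∃[ y ] ((1# - a * z) * y ≈ 1#) → a ≈ 0#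
        cancel (y , inv) = trans (sym (*-identityʳ a)) (trans (*-congˡ (sym inv)) (trans (sym (*-assoc _ _ _)) (trans (*-congʳ ann) (zeroˡ y))))

    -- Every entry is a multiple of the sum of the squares.
    sqF-zero : ∀ as → (∀ {a} → a ∈ as → IsInt a) → sqF as ≈ 0# → ∀ {a} → a ∈ as → a ≈ 0#
    sqF-zero as h e {a} a∈ = conclude (polys as h)
      where
      Polys : List Carrier → Set (c ⊔ ℓ)
      Polys as = ∃[ ps ] ((sqF (map evalF ps) ≈ sqF as) × (∀ {a} → a ∈ as → ∃[ p ] (p ∈ ps × evalF p ≈ a)))
      polys : ∀ as → (∀ {a} → a ∈ as → IsInt a) → Polys as
      polys [] h = [] , refl , λ ()
      polys (a ∷ as) h = let (ps , eq , f) = polys as (λ q → h (there q)) ; (p , ep) = h (here ≡-refl) in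
        p ∷ ps , +-cong (*-cong ep ep) eq ,
        λ { (here ≡-refl) → p , here ≡-refl , ep ; (there q) → let (p′ , m , e′) = f q in p′ , there m , e′ }
      conclude : Polys as → a ≈ 0#
      conclude (ps , eq , f) = let (p , p∈ , ep) = f a∈ ; (z , h′) = regular ps p∈ in
        trans (sym ep) (trans h′ (trans (*-congʳ (trans eq e)) (zeroˡ z)))

≤-suc-pred : ∀ k → k ≤ suc (ℕ.pred k)
≤-suc-pred zero    = z≤n
≤-suc-pred (suc k) = ℕₚ.≤-refl

-- This is the form in which reality of θ is handed on, so that it can be established from one graph
-- and used for another.
record Real {c ℓ} (F : CharZeroField c ℓ) (θ : CharZeroField.Carrier F) : Set (c ⊔ ℓ) where
  open CharZeroField F
  field
    sqF-zero : ∀ as → (∀ {a} → a ∈ as → Reality.IsInt F θ a) → Reality.sqF F θ as ≈ 0# → ∀ {a} → a ∈ as → a ≈ 0#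

-- Comparing orders: the laws of multiplicities.

module Valuation {c ℓ} (F : CharZeroField c ℓ) (θ : CharZeroField.Carrier F) (real : Real F θ) {n : ℕ} (G : Graph n)
  (val : VSet n → ℕ) (hasVal : ∀ X → Taylor.HasVal F θ (MatchingSeries.M F θ G X) (val X)) where
  open CharZeroField F hiding (zero)
  open Real real
  open Taylor F θ
  open Reality F θ using (sqF; IntSer-M; *-nonzero)
  open SeriesIdentities F θ G
  open CRing cring using (module Solver)
  open Solver using (solve; _:+_; _:*_; _:=_; :-_; _:-_)
  open import Algebra.Properties.AbelianGroup +-abelianGroup using (ε⁻¹≈ε; x∙y⁻¹≈ε⇒x≈y)

  private
    m : VSet n → Ser
    m = M G

  val-Ord : ∀ {k} X → k ≤ val X → Ord k (m X)
  val-Ord X le = Ord-≤ le (proj₁ (hasVal X))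

  Ord⇒≤ : ∀ {k f v} → HasVal f v → Ord k f → k ≤ v
  Ord⇒≤ {k} {v = v} (_ , ne) o with k ℕ.≤? v
  ... | yes p = p
  ... | no p  = ⊥-elim (ne (o v (ℕₚ.≰⇒> p)))

  Ord⇒≤val : ∀ {k} X → Ord k (m X) → k ≤ val X
  Ord⇒≤val X = Ord⇒≤ (hasVal X)

  val-≗ : ∀ {X Y} → X ≗ Y → val X ≡ val Y
  val-≗ {X} {Y} e = ℕₚ.≤-antisym (Ord⇒≤val Y (Ord-cong (M-cong G e) (val-Ord X ℕₚ.≤-refl)))
    (Ord⇒≤val X (Ord-cong (S.sym (M-cong G e)) (val-Ord Y ℕₚ.≤-refl)))

  HasVal-⊛ : ∀ {f g a b} → HasVal f a → HasVal g b → HasVal (f ⊛ g) (a ℕ.+ b)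
  HasVal-⊛ {a = a} {b} (o , ne) (o′ , ne′) = Ord-⊛ {a} {b} o o′ , λ e → *-nonzero ne ne′ (trans (sym (⊛-lead {a} {b} o o′)) e)

  val-⊛ : ∀ X Y → HasVal (m X ⊛ m Y) (val X ℕ.+ val Y)
  val-⊛ X Y = HasVal-⊛ (hasVal X) (hasVal Y)

  Ord-m⊛ : ∀ {k} X Y → k ≤ val X ℕ.+ val Y → Ord k (m X ⊛ m Y)
  Ord-m⊛ X Y le = Ord-≤ le (proj₁ (val-⊛ X Y))

  val-∩∖ : ∀ C X → NoEdges C X → val X ≡ val (X ∩ᵥ C) ℕ.+ val (X ∖ C)
  val-∩∖ C X h = ℕₚ.≤-antisym
    (Ord⇒≤ (val-⊛ (X ∩ᵥ C) (X ∖ C)) (Ord-cong (M-∩∖ (card (X ∩ᵥ C)) C X ℕₚ.≤-refl h) (val-Ord X ℕₚ.≤-refl)))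
    (Ord⇒≤val X (Ord-cong (S.sym (M-∩∖ (card (X ∩ᵥ C)) C X ℕₚ.≤-refl h)) (proj₁ (val-⊛ (X ∩ᵥ C) (X ∖ C)))))

  Ord-- : ∀ {k f g} → Ord k f → Ord k g → Ord k (f S.- g)
  Ord-- o o′ = Ord-⊞ o (Ord-neg o′)

  Ord--ʳ : ∀ {k f g} → Ord k f → Ord k (f S.- g) → Ord k g
  Ord--ʳ o o′ i p = trans (sym (x∙y⁻¹≈ε⇒x≈y _ _ (o′ i p))) (o i p)

  coeffs : ℕ → List (VSet n) → List Carrier
  coeffs k Zs = map (λ Z → m Z k) Zs

  sqs-coeff : ∀ k Zs → (∀ {Z} → Z ∈ Zs → Ord k (m Z)) → sqs Zs (k ℕ.+ k) ≈ sqF (coeffs k Zs)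
  sqs-coeff k [] h = refl
  sqs-coeff k (Z ∷ Zs) h = +-cong (⊛-lead {k} {k} (h (here ≡-refl)) (h (here ≡-refl))) (sqs-coeff k Zs (λ q → h (there q)))

  coeffs-int : ∀ k Zs {a} → a ∈ coeffs k Zs → Reality.IsInt F θ a
  coeffs-int k Zs a∈ with ∈-map⁻ (λ Z → m Z k) a∈
  ... | Z , _ , ≡-refl = IntSer-M G (card Z) Z ℕₚ.≤-refl k

  -- If all series have order at least k, the coefficient of y^(2k) in the sum of their squares is
  -- the sum of the squares of their k-th coefficients, so it vanishes only if all of these do.
  -- Hence a bound of 2k - 1 does as well as 2k.
  sqs-Ord : ∀ k Zs → Ord (ℕ.pred (k ℕ.+ k)) (sqs Zs) → ∀ {Z} → Z ∈ Zs → Ord k (m Z)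
  sqs-Ord zero Zs o Z∈ i ()
  sqs-Ord (suc k) Zs o {Z} Z∈ = Ord-suc (ih Z∈) (sqF-zero (coeffs k Zs) (coeffs-int k Zs)
      (trans (sym (sqs-coeff k Zs ih)) (o (k ℕ.+ k) (ℕₚ.≤-reflexive (≡-sym (ℕₚ.+-suc k k))))) (∈-map⁺ (λ Z → m Z k) Z∈))
    where
    ih : ∀ {Z} → Z ∈ Zs → Ord k (m Z)
    ih = sqs-Ord k Zs (Ord-≤ (ℕₚ.≤-trans ℕₚ.pred[n]≤n (ℕₚ.+-monoʳ-≤ k (ℕₚ.n≤1+n k))) o)

  Ord-sqs : ∀ k Zs → (∀ {Z} → Z ∈ Zs → Ord k (m Z)) → Ord (k ℕ.+ k) (sqs Zs)
  Ord-sqs k [] h i p = refl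
  Ord-sqs k (Z ∷ Zs) h = Ord-⊞ (Ord-⊛ {k} {k} (h (here ≡-refl)) (h (here ≡-refl))) (Ord-sqs k Zs (λ q → h (there q)))

  -- Let s be the value of X-u. If M(X) had order at least s + 2, the Wronskian would have order at
  -- least 2s + 1; but it is a sum of squares in which that of M(X-u), of order 2s, occurs.
  val≤1+val-del : ∀ X u → u ∈ᵥ X → val X ≤ suc (val (del₁ X u))
  val≤1+val-del X u u∈X with val X ℕ.≤? suc (val (del₁ X u))
  ... | yes p = p
  ... | no p  = ⊥-elim (proj₂ (hasVal Y) (sqs-Ord (suc s) (Y ∷ walkRests (card X) X u) ordW (here ≡-refl) s ℕₚ.≤-refl))
    where
    Y = del₁ X u
    s = val Y
    ordX : Ord (suc (suc s)) (m X)
    ordX = val-Ord X (ℕₚ.≰⇒> p)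
    Ord-Dg : Ord (ℕ.pred s) (D (m Y))
    Ord-Dg i q = trans (*-congˡ (proj₁ (hasVal Y) (suc i) (below s i q))) (zeroʳ _)
      where
      below : ∀ s i → i < ℕ.pred s → suc i < s
      below (suc s) i q = s≤s q
    -- The derivative of M(X-u) has order s - 1; for s = 0 this is truncated to 0, and the order of
    -- M(X) still suffices.
    second : s ℕ.+ suc s ≤ suc (suc s) ℕ.+ ℕ.pred s
    second = ℕₚ.≤-trans (ℕₚ.≤-reflexive (ℕₚ.+-comm s (suc s))) (lem s)
      where
      lem : ∀ s → suc s ℕ.+ s ≤ suc (suc s) ℕ.+ ℕ.pred s
      lem zero = s≤s z≤n
      lem (suc s) = ℕₚ.≤-reflexive (cong (λ x → suc (suc x)) (ℕₚ.+-suc s s))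
    ordW : Ord (s ℕ.+ suc s) (sqs (Y ∷ walkRests (card X) X u))
    ordW = Ord-cong (wronskian-sqs (card X) X u ℕₚ.≤-refl u∈X) (Ord--
      (Ord-≤ (ℕₚ.≤-reflexive (ℕₚ.+-comm s (suc s))) (Ord-⊛ {suc s} {s} (Ord-D ordX) (proj₁ (hasVal Y))))
      (Ord-≤ second (Ord-⊛ {suc (suc s)} {ℕ.pred s} ordX Ord-Dg)))

  Ord-∑ : ∀ {k l} (f : Fin l → Ser) → (∀ i → Ord k (f i)) → Ord k (RingSums.∑ seriesRing f)
  Ord-∑ {l = zero}  f h i p = refl
  Ord-∑ {l = suc l} f h = Ord-⊞ (h Fin.zero) (Ord-∑ (f ∘ suc) (h ∘ suc))

  Ord-on : ∀ {k f} b → (b ≡ true → Ord k f) → Ord k (RingSums.on seriesRing b f)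
  Ord-on true  h = h ≡-refl
  Ord-on false h i p = refl

  Ord-nbrs : ∀ X w {k} → k ≤ ℕ.pred (val (del₁ X w)) → Ord k (RingSums.∑ seriesRing (λ z → RingSums.on seriesRing (nbr G X w z) (m (del₂ X w z))))
  Ord-nbrs X w le = Ord-∑ {l = n} _ (λ z → Ord-on (nbr G X w z) (λ p → val-Ord (del₂ X w z)
    (ℕₚ.≤-trans le (ℕₚ.pred-mono-≤ (val≤1+val-del (del₁ X w) z (proj₁ (∧-true⁻ {del₁ X w z} p)))))))

  -- All terms of the recursion at `u` have order at least val(X-u) - 1, those of the neighbours by
  -- the opposite bound.
  val-del≤1+val : ∀ X u → u ∈ᵥ X → val (del₁ X u) ≤ suc (val X)
  val-del≤1+val X u u∈X = ℕₚ.≤-trans (≤-suc-pred (val (del₁ X u))) (s≤s (Ord⇒≤val X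
    (Ord-cong (S.sym (M-rec G X u u∈X)) (Ord-- (Ord-⊛ {0} (λ _ ()) (val-Ord (del₁ X u) ℕₚ.pred[n]≤n)) (Ord-nbrs X u ℕₚ.≤-refl)))))

  -- Otherwise every term of the recursion at `w` would have a larger order than M(X).
  positive⇒essential-nbr : ∀ X w → w ∈ᵥ X → val (del₁ X w) ≡ suc (val X) →
    ∃[ z ] (nbr G X w z ≡ true × val (del₂ X w z) ≡ val X)
  positive⇒essential-nbr X w w∈X e with any? (λ z → (nbr G X w z ≟ᵇ true) ×-dec (val (del₂ X w z) ℕ.≟ val X))
  ... | yes p = p
  ... | no np = ⊥-elim (ℕₚ.<-irrefl ≡-refl (Ord⇒≤val X (Ord-cong (S.sym (M-rec G X w w∈X))
          (Ord-- (Ord-⊛ {0} (λ _ ()) (val-Ord (del₁ X w) (ℕₚ.≤-reflexive (≡-sym e)))) (Ord-∑ {l = n} _ big)))))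
    where
    big : ∀ z → Ord (suc (val X)) (RingSums.on seriesRing (nbr G X w z) (m (del₂ X w z)))
    big z = Ord-on (nbr G X w z) (λ p → val-Ord (del₂ X w z) (ℕₚ.≤∧≢⇒<
      (ℕₚ.≤-pred (≡-subst (_≤ suc (val (del₂ X w z))) e (val≤1+val-del (del₁ X w) z (proj₁ (∧-true⁻ {del₁ X w z} p)))))
      (λ q → np (z , p , ≡-sym q))))

  module _ (X : VSet n) (u v : Fin n) (u∈X : u ∈ᵥ X) (v∈X : v ∈ᵥ X) (u≢v : u ≢ v) where
    private
      a = val (del₁ X u) ℕ.+ val (del₁ X v)
      b = val X ℕ.+ val (del₂ X u v)
      rests = pathRests (card X) X u v

      Ord-rayleigh : ∀ {k} → k ≤ a → k ≤ b → Ord k (sqs rests)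
      Ord-rayleigh p q = Ord-cong (rayleigh-sqs (card X) X u v ℕₚ.≤-refl u∈X v∈X u≢v) (Ord-- (Ord-m⊛ (del₁ X u) (del₁ X v) p) (Ord-m⊛ X (del₂ X u v) q))

    -- The difference is a sum of squares, so the odd bound 2k - 1 improves to 2k.
    rayleigh-even : ∀ k → ℕ.pred (k ℕ.+ k) ≤ a → ℕ.pred (k ℕ.+ k) ≤ b → Ord (k ℕ.+ k) (rayleigh X u v)
    rayleigh-even k p q = Ord-cong (S.sym (rayleigh-sqs (card X) X u v ℕₚ.≤-refl u∈X v∈X u≢v))
      (Ord-sqs k rests (sqs-Ord k rests (Ord-rayleigh p q)))

    rayleigh-paths : ∀ k → ℕ.pred (k ℕ.+ k) ≤ a → ℕ.pred (k ℕ.+ k) ≤ b → ∀ {Z} → PathTo G X u v Z → k ≤ val Z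
    rayleigh-paths k p q pth = Ord⇒≤val _ (sqs-Ord k rests (Ord-rayleigh p q) (PathTo⇒∈ (card X) ℕₚ.≤-refl u∈X pth))

    -- If the first product had odd order a and the second a larger one, their difference would have
    -- the odd order a.
    odd-a⇒b≤a : ∀ k → a ≡ suc (k ℕ.+ k) → b ≤ a
    odd-a⇒b≤a k e with b ℕ.≤? a
    ... | yes p = p
    ... | no p = ⊥-elim (proj₂ (val-⊛ (del₁ X u) (del₁ X v)) (trans
            (x∙y⁻¹≈ε⇒x≈y _ _ (rayleigh-even (suc k) (ℕₚ.≤-reflexive e′) (ℕₚ.≤-trans (ℕₚ.≤-reflexive e′) (ℕₚ.<⇒≤ (ℕₚ.≰⇒> p))) a a<))
            (proj₁ (val-⊛ X (del₂ X u v)) a (ℕₚ.≰⇒> p))))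
      where
      e′ : k ℕ.+ suc k ≡ a
      e′ = ≡-trans (ℕₚ.+-suc k k) (≡-sym e)
      a< : a < suc k ℕ.+ suc k
      a< = s≤s (ℕₚ.≤-reflexive (≡-sym e′))

    odd-b⇒a≤b : ∀ k → b ≡ suc (k ℕ.+ k) → a ≤ b
    odd-b⇒a≤b k e with a ℕ.≤? b
    ... | yes p = p
    ... | no p = ⊥-elim (proj₂ (val-⊛ X (del₂ X u v)) (trans
            (sym (x∙y⁻¹≈ε⇒x≈y _ _ (rayleigh-even (suc k) (ℕₚ.≤-trans (ℕₚ.≤-reflexive e′) (ℕₚ.<⇒≤ (ℕₚ.≰⇒> p))) (ℕₚ.≤-reflexive e′) b b<)))
            (proj₁ (val-⊛ (del₁ X u) (del₁ X v)) b (ℕₚ.≰⇒> p))))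
      where
      e′ : k ℕ.+ suc k ≡ b
      e′ = ≡-trans (ℕₚ.+-suc k k) (≡-sym e)
      b< : b < suc k ℕ.+ suc k
      b< = s≤s (ℕₚ.≤-reflexive (≡-sym e′))

  -- "Parallel" essential vertices form an equivalence relation: otherwise rayleigh′ would have too small an order.
  parallel-trans : ∀ X u v w τ → u ∈ᵥ X → v ∈ᵥ X → w ∈ᵥ X → u ≢ v → u ≢ w → v ≢ w →
    val X ≡ suc τ → val (del₁ X u) ≡ τ → val (del₁ X v) ≡ τ → val (del₁ X w) ≡ τ →
    τ ≤ val (del₂ X u w) → τ ≤ val (del₂ X v w) → τ ≤ val (del₂ X u v)
  parallel-trans X u v w τ u∈X v∈X w∈X u≢v u≢w v≢w eX eu ev ew uw vw =
    ℕₚ.+-cancelˡ-≤ τ _ _ (≡-subst (λ t → τ ℕ.+ τ ≤ t ℕ.+ val (del₂ X u v)) ew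
      (Ord⇒≤ (val-⊛ (del₁ X w) (del₂ X u v)) (Ord--ʳ
        (Ord-- (Ord-⊞ (Ord-m⊛ (del₁ X u) (del₂ X v w) (ℕₚ.+-mono-≤ (ℕₚ.≤-reflexive (≡-sym eu)) vw))
                      (Ord-m⊛ (del₂ X u w) (del₁ X v) (ℕₚ.+-mono-≤ uw (ℕₚ.≤-reflexive (≡-sym ev)))))
               (Ord-m⊛ X (del₁ (del₂ X u v) w) (ℕₚ.+-mono-≤ (ℕₚ.≤-trans (ℕₚ.n≤1+n τ) (ℕₚ.≤-reflexive (≡-sym eX))) z≥τ)))
        total)))
    where
    W = del₁ X w
    u∈W = ∈-del₁ X u∈X u≢w
    v∈W = ∈-del₁ X v∈X v≢w
    pτ : ∀ {a b} → τ ≤ a → τ ≤ suc b → ℕ.pred (τ ℕ.+ τ) ≤ a ℕ.+ b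
    pτ {a} {b} p q = ℕₚ.pred-mono-≤ (ℕₚ.≤-trans (ℕₚ.+-mono-≤ p q) (ℕₚ.≤-reflexive (ℕₚ.+-suc a b)))
    uw′ : τ ≤ val (del₁ W u)
    uw′ = ≡-subst (τ ≤_) (val-≗ (del₂-comm X u w)) uw
    vw′ : τ ≤ val (del₁ W v)
    vw′ = ≡-subst (τ ≤_) (val-≗ (del₂-comm X v w)) vw
    z-eq : del₂ W u v ≗ del₁ (del₂ X u v) w
    z-eq a = ≡-trans (del₁-≗ (del₂-comm X w u) v a) (del₂-comm (del₁ X u) w v a)
    z≥τ-1 : τ ≤ suc (val (del₂ W u v))
    z≥τ-1 = ℕₚ.≤-trans uw′ (val≤1+val-del (del₁ W u) v (∈-del₁ W v∈W (λ e → u≢v (≡-sym e))))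
    boundW₁ : ℕ.pred (τ ℕ.+ τ) ≤ val (del₁ W u) ℕ.+ val (del₁ W v)
    boundW₁ = pτ uw′ (ℕₚ.m≤n⇒m≤1+n vw′)
    boundW₂ : ℕ.pred (τ ℕ.+ τ) ≤ val W ℕ.+ val (del₂ W u v)
    boundW₂ = pτ (ℕₚ.≤-reflexive (≡-sym ew)) z≥τ-1
    -- In W the product for W-u and W-v and the sum of squares both have order at least 2τ, so M(W)
    -- M(W-u-v) has too; its first factor accounts for exactly τ.
    z≥τ : τ ≤ val (del₁ (del₂ X u v) w)
    z≥τ = ≡-subst (τ ≤_) (val-≗ z-eq) (ℕₚ.+-cancelˡ-≤ τ _ _ (≡-subst (λ t → τ ℕ.+ τ ≤ t ℕ.+ val (del₂ W u v)) ew
      (Ord⇒≤ (val-⊛ W (del₂ W u v)) (Ord--ʳ (Ord-m⊛ (del₁ W u) (del₁ W v) (ℕₚ.+-mono-≤ uw′ vw′))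
        (rayleigh-even W u v u∈W v∈W u≢v τ boundW₁ boundW₂)))))
    uv≥τ-1 : τ ≤ suc (val (del₂ X u v))
    uv≥τ-1 = ≡-subst (_≤ suc (val (del₂ X u v))) eu (val≤1+val-del (del₁ X u) v (∈-del₁ X v∈X (λ e → u≢v (≡-sym e))))
    -- Each rest of a path from `u` to `v`, in X or in X-w, has order at least τ, so each product of
    -- two has order at least 2τ. What remains of `rayleigh′` is then M(X-w) M(X-u-v).
    total : Ord (τ ℕ.+ τ) (rayleigh′ X u v w)
    total = rayleigh′-J (Ord (τ ℕ.+ τ)) Ord-cong (λ _ _ → refl) Ord-⊞ (card X) X u v w ℕₚ.≤-refl u∈X v∈X w∈X u≢v u≢w v≢w
      (λ p q → Ord-m⊛ _ _ (ℕₚ.+-mono-≤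
        (rayleigh-paths X u v u∈X v∈X u≢v τ (pτ (ℕₚ.≤-reflexive (≡-sym eu)) (ℕₚ.≤-trans (ℕₚ.n≤1+n τ) (s≤s (ℕₚ.≤-reflexive (≡-sym ev)))))
          (pτ (ℕₚ.≤-trans (ℕₚ.n≤1+n τ) (ℕₚ.≤-reflexive (≡-sym eX))) uv≥τ-1) p)
        (rayleigh-paths W u v u∈W v∈W u≢v τ boundW₁ boundW₂ q)))

  -- The derivative of M(X) has order exactly τ and is the sum of all M(X-z), so these cannot all
  -- have order above τ.
  essential-exists : ∀ X τ → val X ≡ suc τ → ∃[ u ] (u ∈ᵥ X × val (del₁ X u) ≡ τ)
  essential-exists X τ e with any? (λ z → (X z ≟ᵇ true) ×-dec (val (del₁ X z) ℕ.≟ τ))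
  ... | yes p = p
  ... | no np = ⊥-elim (*-nonzero (charZero τ) (≡-subst (λ k → ¬ (m X k ≈ 0#)) e (proj₂ (hasVal X)))
          (trans (D-M (card X) X ≡-refl τ) (Ord-∑ {l = n} _ big τ ℕₚ.≤-refl)))
    where
    big : ∀ z → Ord (suc τ) (RingSums.on seriesRing (X z) (m (del₁ X z)))
    big z = Ord-on (X z) (λ p → val-Ord (del₁ X z) (ℕₚ.≤∧≢⇒<
      (ℕₚ.≤-pred (≡-subst (_≤ suc (val (del₁ X z))) e (val≤1+val-del X z p))) (λ q → np (z , p , ≡-sym q))))

  module _ (X : VSet n) (τ : ℕ) (eX : val X ≡ suc τ) (z : Fin n) (z∈X : z ∈ᵥ X) where
    private
      g = m (del₁ X z)
      d = m X (suc τ)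
      ordX : Ord (suc τ) (m X)
      ordX = val-Ord X (ℕₚ.≤-reflexive (≡-sym eX))
      ordg : Ord τ g
      ordg = val-Ord (del₁ X z) (ℕₚ.≤-pred (≡-subst (_≤ suc (val (del₁ X z))) eX (val≤1+val-del X z z∈X)))
      yD : ∀ i → (𝕪 ⊛ D g) i ≈ natR cring i * g i
      yD zero = trans (𝕪⊛-zero (D g)) (sym (zeroˡ _))
      yD (suc i) = 𝕪⊛-suc (D g) i
      shifted : m X ≋ 𝕪 ⊛ (m X ∘ suc)
      shifted zero = trans (ordX 0 (s≤s z≤n)) (sym (𝕪⊛-zero (m X ∘ suc)))
      shifted (suc i) = sym (𝕪⊛-suc (m X ∘ suc) i)
      ordS : Ord τ (m X ∘ suc)
      ordS i p = ordX (suc i) (s≤s p)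
      ordyD : Ord τ (𝕪 ⊛ D g)
      ordyD i p = trans (yD i) (trans (*-congˡ (ordg i p)) (zeroʳ _))
      -- A factor y moves from M(X) to the derivative, whose order would be τ - 1, which makes no
      -- sense for τ = 0.
      second : m X ⊛ D g ≋ (m X ∘ suc) ⊛ (𝕪 ⊛ D g)
      second = S.trans (S.*-congʳ shifted) (S.trans (S.*-congʳ (S.*-comm 𝕪 (m X ∘ suc))) (S.*-assoc (m X ∘ suc) 𝕪 (D g)))

    wronskian-Ord : Ord (τ ℕ.+ τ) (wronskian X z)
    wronskian-Ord = Ord-- (Ord-⊛ {τ} {τ} (Ord-D ordX) ordg) (Ord-cong (S.sym second) (Ord-⊛ {τ} {τ} ordS ordyD))

    wronskian-lead : wronskian X z (τ ℕ.+ τ) ≈ d * g τ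
    wronskian-lead = trans (+-cong (⊛-lead {τ} {τ} (Ord-D ordX) ordg)
        (-‿cong (trans (second (τ ℕ.+ τ)) (trans (⊛-lead {τ} {τ} ordS ordyD) (*-congˡ (yD τ))))))
      (trans (solve 4 (λ o k d g → ((o :+ k) :* d) :* g :- d :* (k :* g) := o :* (d :* g)) refl 1# (natR cring τ) d (g τ)) (*-identityˡ _))

    -- Substitutes for a statement about signs: the coefficient of M(X-z) at τ is either 0 or has
    -- the sign of the leading coefficient of M(X). Its own square is among the summands.
    wronskian-squares : ∃[ Zs ] (del₁ X z ∈ Zs × d * g τ ≈ sqF (coeffs τ Zs))
    wronskian-squares = Zs , here ≡-refl , trans (sym wronskian-lead) (trans (wronskian-sqs (card X) X z ℕₚ.≤-refl z∈X (τ ℕ.+ τ))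
      (sqs-coeff τ Zs (sqs-Ord τ Zs (Ord-≤ ℕₚ.pred[n]≤n (Ord-cong (wronskian-sqs (card X) X z ℕₚ.≤-refl z∈X) wronskian-Ord)))))
      where
      Zs = del₁ X z ∷ walkRests (card X) X z

  -- The leading coefficients at the essential neighbours all have the sign of that of M (X ∖ w), so they cannot cancel.
  essential-nbr⇒positive : ∀ X w z τ → w ∈ᵥ X → nbr G X w z ≡ true → val (del₁ X w) ≡ suc τ → val (del₂ X w z) ≡ τ → val X ≡ τ
  essential-nbr⇒positive X w z τ w∈X wz eY ez = ℕₚ.≤-antisym (ℕₚ.≮⇒≥ notbig) (ℕₚ.≤-pred (≡-subst (_≤ suc (val X)) eY (val-del≤1+val X w w∈X)))
    where
    Y = del₁ X w
    d = m Y (suc τ)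
    open RingSums seriesRing using (∑; on)
    ∑F = CRing.∑ cring
    nb : Fin n → Ser
    nb z′ = on (nbr G X w z′) (m (del₁ Y z′))
    notbig : ¬ (suc τ ≤ val X)
    notbig big = proj₂ (hasVal (del₁ Y z)) (≡-subst (λ k → m (del₁ Y z) k ≈ 0#) (≡-sym ez) (sqF-zero all-coeffs ints total z-coeff))
      where
      ∑-coeff : ∀ {l} (f : Fin l → Ser) i → ∑ f i ≈ ∑F (λ z′ → f z′ i)
      ∑-coeff {zero} f i = refl
      ∑-coeff {suc l} f i = +-congˡ (∑-coeff (f ∘ suc) i)
      -- M(X) and x M(X-w) both have order above τ, so the coefficients of the neighbour terms at τ
      -- add up to 0. Multiplied by `d` this is a vanishing sum of squares.
      sum0 : ∑F (λ z′ → nb z′ τ) ≈ 0#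
      sum0 = trans (sym (∑-coeff nb τ)) (Ord--ʳ (Ord-⊛ {0} (λ _ ()) (val-Ord Y (ℕₚ.≤-reflexive (≡-sym eY))))
        (Ord-cong (M-rec G X w w∈X) (val-Ord X big)) τ ℕₚ.≤-refl)
      lists : ∀ z′ → nbr G X w z′ ≡ true → ∃[ Zs ] (del₁ Y z′ ∈ Zs × d * m (del₁ Y z′) τ ≈ sqF (coeffs τ Zs))
      lists z′ p = wronskian-squares Y τ eY z′ (proj₁ (∧-true⁻ {Y z′} p))
      listsᵇ : ∀ z′ b → nbr G X w z′ ≡ b → ∃[ Zs ] ((b ≡ true → del₁ Y z′ ∈ Zs) × d * on b (m (del₁ Y z′)) τ ≈ sqF (coeffs τ Zs))
      listsᵇ z′ false p = [] , (λ ()) , zeroʳ d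
      listsᵇ z′ true p = let (Zs , i , e) = lists z′ p in Zs , (λ _ → i) , e
      Zsf : Fin n → List (VSet n)
      Zsf z′ = proj₁ (listsᵇ z′ (nbr G X w z′) ≡-refl)
      all-coeffs = coeffs τ (concatFin Zsf)
      ints : ∀ {a} → a ∈ all-coeffs → Reality.IsInt F θ a
      ints = coeffs-int τ (concatFin Zsf)
      sqF-++ : ∀ as bs → sqF (as ++ bs) ≈ sqF as + sqF bs
      sqF-++ [] bs = sym (+-identityˡ _)
      sqF-++ (a ∷ as) bs = trans (+-congˡ (sqF-++ as bs)) (sym (+-assoc _ _ _))
      sqF-concat : ∀ {l} (f : Fin l → List (VSet n)) → sqF (coeffs τ (concatFin f)) ≈ ∑F (λ z′ → sqF (coeffs τ (f z′)))
      sqF-concat {zero} f = refl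
      sqF-concat {suc l} f = trans (reflexive (cong sqF (map-++ (λ Z → m Z τ) (f Fin.zero) (concatFin (f ∘ suc)))))
        (trans (sqF-++ (coeffs τ (f Fin.zero)) _) (+-congˡ (sqF-concat (f ∘ suc))))
      total : sqF all-coeffs ≈ 0#
      total = trans (sqF-concat Zsf) (trans (CRing.∑-cong cring {n} (λ z′ → sym (proj₂ (proj₂ (listsᵇ z′ (nbr G X w z′) ≡-refl)))))
        (trans (sym (RingSums.∑-*ˡ cring {n} d (λ z′ → nb z′ τ))) (trans (*-congˡ sum0) (zeroʳ d))))
      z-coeff : m (del₁ Y z) τ ∈ all-coeffs
      z-coeff = ∈-map⁺ (λ Z → m Z τ) (∈-concatFin Zsf z (proj₁ (proj₂ (listsᵇ z (nbr G X w z) ≡-refl)) wz))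

nbr⁻ : ∀ {n} (G : Graph n) {X u w} → nbr G X u w ≡ true → w ∈ᵥ X × w ≢ u × adj G u w ≡ true
nbr⁻ G {X} {u} {w} p = let (q , a) = ∧-true⁻ {del₁ X u w} p ; (x , d) = ∧-true⁻ {X w} q in x , ≢-≠ᵇ d , a

nbr⁺ : ∀ {n} (G : Graph n) {X u w} → w ∈ᵥ X → w ≢ u → adj G u w ≡ true → nbr G X u w ≡ true
nbr⁺ G {X} x ne a = ∧-true⁺ (∈-del₁ X x ne) a

-- The stability lemma uses the polynomials only through these numerical laws. They are stated for
-- all vertex sets because the argument moves between X, X-w, X-v and X-x.
record MultiplicityLaws {n : ℕ} (G : Graph n) (val : VSet n → ℕ) : Set where
  field
    val-≗ : ∀ {X Y} → X ≗ Y → val X ≡ val Y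
    val≤1+val-del : ∀ X u → u ∈ᵥ X → val X ≤ suc (val (del₁ X u))
    val-del≤1+val : ∀ X u → u ∈ᵥ X → val (del₁ X u) ≤ suc (val X)
    essential-exists : ∀ X τ → val X ≡ suc τ → ∃[ u ] (u ∈ᵥ X × val (del₁ X u) ≡ τ)
    positive⇒essential-nbr : ∀ X w → w ∈ᵥ X → val (del₁ X w) ≡ suc (val X) →
      ∃[ z ] (nbr G X w z ≡ true × val (del₂ X w z) ≡ val X)
    essential-nbr⇒positive : ∀ X w z τ → w ∈ᵥ X → nbr G X w z ≡ true → val (del₁ X w) ≡ suc τ → val (del₂ X w z) ≡ τ → val X ≡ τ
    odd-a⇒b≤a : ∀ X u v → u ∈ᵥ X → v ∈ᵥ X → u ≢ v → ∀ k → val (del₁ X u) ℕ.+ val (del₁ X v) ≡ suc (k ℕ.+ k) →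
      val X ℕ.+ val (del₂ X u v) ≤ val (del₁ X u) ℕ.+ val (del₁ X v)
    odd-b⇒a≤b : ∀ X u v → u ∈ᵥ X → v ∈ᵥ X → u ≢ v → ∀ k → val X ℕ.+ val (del₂ X u v) ≡ suc (k ℕ.+ k) →
      val (del₁ X u) ℕ.+ val (del₁ X v) ≤ val X ℕ.+ val (del₂ X u v)
    rayleigh-paths : ∀ X u v → u ∈ᵥ X → v ∈ᵥ X → u ≢ v → ∀ k → ℕ.pred (k ℕ.+ k) ≤ val (del₁ X u) ℕ.+ val (del₁ X v) →
      ℕ.pred (k ℕ.+ k) ≤ val X ℕ.+ val (del₂ X u v) → ∀ {Z} → PathTo G X u v Z → k ≤ val Z
    parallel-trans : ∀ X u v w τ → u ∈ᵥ X → v ∈ᵥ X → w ∈ᵥ X → u ≢ v → u ≢ w → v ≢ w →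
      val X ≡ suc τ → val (del₁ X u) ≡ τ → val (del₁ X v) ≡ τ → val (del₁ X w) ≡ τ →
      τ ≤ val (del₂ X u w) → τ ≤ val (del₂ X v w) → τ ≤ val (del₂ X u v)
    val-∩∖ : ∀ C X → (∀ w z → w ∈ᵥ X → z ∈ᵥ X → C w ≡ true → C z ≡ false → adj G w z ≡ false) →
      val X ≡ val (X ∩ᵥ C) ℕ.+ val (X ∖ C)

multiplicityLaws : ∀ {c ℓ} (F : CharZeroField c ℓ) (θ : CharZeroField.Carrier F) (real : Real F θ) {n : ℕ} (G : Graph n)
  (val : VSet n → ℕ) (hasVal : ∀ X → Taylor.HasVal F θ (MatchingSeries.M F θ G X) (val X)) → MultiplicityLaws G val
multiplicityLaws F θ real G val hasVal = record
  { val-≗ = val-≗ ; val≤1+val-del = val≤1+val-del ; val-del≤1+val = val-del≤1+val ; essential-exists = essential-exists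
  ; positive⇒essential-nbr = positive⇒essential-nbr ; essential-nbr⇒positive = essential-nbr⇒positive
  ; odd-a⇒b≤a = odd-a⇒b≤a ; odd-b⇒a≤b = odd-b⇒a≤b ; rayleigh-paths = rayleigh-paths ; parallel-trans = parallel-trans
  ; val-∩∖ = val-∩∖ }
  where open Valuation F θ real G val hasVal

-- The stability lemma for special vertices.

module Stability {n : ℕ} (G : Graph n) (val : VSet n → ℕ) (laws : MultiplicityLaws G val) where
  open MultiplicityLaws laws

  val-swap : ∀ X u v → val (del₂ X u v) ≡ val (del₂ X v u)
  val-swap X u v = val-≗ (del₂-comm X u v)

  near : ∀ X u k b → u ∈ᵥ X → val X ≡ suc k ℕ.+ b →
    (val (del₁ X u) ≡ k ℕ.+ b) ⊎ (val (del₁ X u) ≡ suc k ℕ.+ b) ⊎ (val (del₁ X u) ≡ suc (suc k) ℕ.+ b)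
  near X u k b u∈X e = split (ℕₚ.≤-pred (≡-subst (_≤ suc (val (del₁ X u))) e (val≤1+val-del X u u∈X)))
      (≡-subst (λ t → val (del₁ X u) ≤ suc t) e (val-del≤1+val X u u∈X))
    where
    split : ∀ {a c} → a ≤ c → c ≤ suc (suc a) → (c ≡ a) ⊎ (c ≡ suc a) ⊎ (c ≡ suc (suc a))
    split {zero} {zero} _ _ = inj₁ ≡-refl
    split {zero} {suc zero} _ _ = inj₂ (inj₁ ≡-refl)
    split {zero} {suc (suc zero)} _ _ = inj₂ (inj₂ ≡-refl)
    split {zero} {suc (suc (suc c))} _ (s≤s (s≤s ()))
    split {suc a} {suc c} (s≤s p) (s≤s q) with split p q
    ... | inj₁ e = inj₁ (cong suc e)
    ... | inj₂ (inj₁ e) = inj₂ (inj₁ (cong suc e))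
    ... | inj₂ (inj₂ e) = inj₂ (inj₂ (cong suc e))

  -- Values are written i + b with numerals i, so that the numerical side conditions below are decided by evaluation.
  far : ∀ X u b i j → u ∈ᵥ X → val X ≡ i ℕ.+ b → val (del₁ X u) ≡ j ℕ.+ b → T (suc i ℕ.<ᵇ j) → ⊥
  far X u b i j u∈X e e′ t = ℕₚ.<⇒≱ (ℕₚ.+-monoˡ-< b (ℕₚ.<ᵇ⇒< (suc i) j t))
    (≡-subst (λ s → s ≤ suc (i ℕ.+ b)) e′ (≡-subst (λ s → val (del₁ X u) ≤ suc s) e (val-del≤1+val X u u∈X)))

  private
    double : ∀ b i j h → i ℕ.+ j ≡ suc (h ℕ.+ h) → (i ℕ.+ b) ℕ.+ (j ℕ.+ b) ≡ suc ((h ℕ.+ b) ℕ.+ (h ℕ.+ b))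
    double b i j h e = ≡-trans (regroup i j b) (≡-trans (cong (ℕ._+ (b ℕ.+ b)) e) (regroup′ h b))
      where
      regroup : ∀ i j b → (i ℕ.+ b) ℕ.+ (j ℕ.+ b) ≡ (i ℕ.+ j) ℕ.+ (b ℕ.+ b)
      regroup = solve-∀ℕ
      regroup′ : ∀ h b → suc (h ℕ.+ h) ℕ.+ (b ℕ.+ b) ≡ suc ((h ℕ.+ b) ℕ.+ (h ℕ.+ b))
      regroup′ = solve-∀ℕ

    offset-< : ∀ b i j k l → i ℕ.+ j < k ℕ.+ l → (i ℕ.+ b) ℕ.+ (j ℕ.+ b) < (k ℕ.+ b) ℕ.+ (l ℕ.+ b)
    offset-< b i j k l p = ≡-subst₂ _<_ (regroup i j b) (regroup k l b) (ℕₚ.+-monoˡ-< (b ℕ.+ b) p)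
      where
      regroup : ∀ i j b → (i ℕ.+ j) ℕ.+ (b ℕ.+ b) ≡ (i ℕ.+ b) ℕ.+ (j ℕ.+ b)
      regroup = solve-∀ℕ

  odd-deleted : ∀ X u v b i j k l h → u ∈ᵥ X → v ∈ᵥ X → u ≢ v →
    val (del₁ X u) ≡ i ℕ.+ b → val (del₁ X v) ≡ j ℕ.+ b → val X ≡ k ℕ.+ b → val (del₂ X u v) ≡ l ℕ.+ b →
    i ℕ.+ j ≡ suc (h ℕ.+ h) → T (i ℕ.+ j ℕ.<ᵇ k ℕ.+ l) → ⊥
  odd-deleted X u v b i j k l h u∈X v∈X u≢v eu ev eX euv odd t = ℕₚ.<⇒≱
    (≡-subst₂ _<_ (≡-sym (cong₂ ℕ._+_ eu ev)) (≡-sym (cong₂ ℕ._+_ eX euv)) (offset-< b i j k l (ℕₚ.<ᵇ⇒< (i ℕ.+ j) (k ℕ.+ l) t)))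
    (odd-a⇒b≤a X u v u∈X v∈X u≢v (h ℕ.+ b) (≡-trans (cong₂ ℕ._+_ eu ev) (double b i j h odd)))

  odd-undeleted : ∀ X u v b i j k l h → u ∈ᵥ X → v ∈ᵥ X → u ≢ v →
    val (del₁ X u) ≡ i ℕ.+ b → val (del₁ X v) ≡ j ℕ.+ b → val X ≡ k ℕ.+ b → val (del₂ X u v) ≡ l ℕ.+ b →
    k ℕ.+ l ≡ suc (h ℕ.+ h) → T (k ℕ.+ l ℕ.<ᵇ i ℕ.+ j) → ⊥
  odd-undeleted X u v b i j k l h u∈X v∈X u≢v eu ev eX euv odd t = ℕₚ.<⇒≱
    (≡-subst₂ _<_ (≡-sym (cong₂ ℕ._+_ eX euv)) (≡-sym (cong₂ ℕ._+_ eu ev)) (offset-< b k l i j (ℕₚ.<ᵇ⇒< (k ℕ.+ l) (i ℕ.+ j) t)))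
    (odd-b⇒a≤b X u v u∈X v∈X u≢v (h ℕ.+ b) (≡-trans (cong₂ ℕ._+_ eX euv) (double b k l h odd)))

  -- An edge is a path from `u` to `v`, with rest X-u-v.
  edge-≥ : ∀ X u v k → u ∈ᵥ X → nbr G X u v ≡ true → ℕ.pred (k ℕ.+ k) ≤ val (del₁ X u) ℕ.+ val (del₁ X v) →
    ℕ.pred (k ℕ.+ k) ≤ val X ℕ.+ val (del₂ X u v) → k ≤ val (del₂ X u v)
  edge-≥ X u v k u∈X p q r = let (v∈X , v≢u , _) = nbr⁻ G {X} p in
    rayleigh-paths X u v u∈X v∈X (λ e → v≢u (≡-sym e)) k q r (last p)

  -- The values of X-w and X-v have the odd sum 2b + 1, so by parity X and X-w-v cannot exceed it,
  -- which leaves b for X-w-v. Then the edge, seen as a path, demands at least b + 1.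
  not-neutral : ∀ X w v b → w ∈ᵥ X → nbr G X w v ≡ true → val X ≡ suc b → val (del₁ X v) ≡ b → val (del₁ X w) ≡ suc b → ⊥
  not-neutral X w v b w∈X wv eX ev ew with nbr⁻ G {X} wv
  ... | v∈X , v≢w , _ with near (del₁ X w) v 0 b (∈-del₁ X v∈X v≢w) ew
  ...   | inj₁ e₀ = ℕₚ.<-irrefl ≡-refl (≡-subst (suc b ≤_) e₀ (edge-≥ X w v (suc b) w∈X wv
          (≡-subst₂ (λ s t → b ℕ.+ suc b ≤ s ℕ.+ t) (≡-sym ew) (≡-sym ev) (ℕₚ.≤-reflexive (ℕₚ.+-comm b (suc b))))
          (≡-subst₂ (λ s t → b ℕ.+ suc b ≤ s ℕ.+ t) (≡-sym eX) (≡-sym e₀) (ℕₚ.≤-reflexive (ℕₚ.+-comm b (suc b))))))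
  ...   | inj₂ (inj₁ e₁) = odd-deleted X w v b 1 0 1 1 0 w∈X v∈X (λ e → v≢w (≡-sym e)) ew ev eX e₁ ≡-refl _
  ...   | inj₂ (inj₂ e₂) = odd-deleted X w v b 1 0 1 2 0 w∈X v∈X (λ e → v≢w (≡-sym e)) ew ev eX e₂ ≡-refl _

  special⇒positive : ∀ X w v b → w ∈ᵥ X → nbr G X w v ≡ true → val X ≡ suc b → val (del₁ X v) ≡ b → val (del₁ X w) ≢ b →
    val (del₁ X w) ≡ suc (suc b)
  special⇒positive X w v b w∈X wv eX ev ne with near X w 0 b w∈X eX
  ... | inj₁ e₀ = ⊥-elim (ne e₀)
  ... | inj₂ (inj₁ e₁) = ⊥-elim (not-neutral X w v b w∈X wv eX ev e₁)
  ... | inj₂ (inj₂ e₂) = e₂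

  module _ (X : VSet n) (w : Fin n) (b : ℕ) (w∈X : w ∈ᵥ X) (eX : val X ≡ suc b) (ew : val (del₁ X w) ≡ suc (suc b)) where

    essential-stays : ∀ x → x ∈ᵥ X → x ≢ w → val (del₁ X x) ≡ b → val (del₂ X w x) ≡ suc b
    essential-stays x x∈X x≢w ex with near (del₁ X w) x 1 b (∈-del₁ X x∈X x≢w) ew
    ... | inj₁ e₁ = e₁
    ... | inj₂ (inj₁ e₂) = ⊥-elim (far (del₁ X x) w b 0 2 (∈-del₁ X w∈X (λ e → x≢w (≡-sym e))) ex (≡-trans (val-swap X x w) e₂) _)
    ... | inj₂ (inj₂ e₃) = ⊥-elim (far (del₁ X x) w b 0 3 (∈-del₁ X w∈X (λ e → x≢w (≡-sym e))) ex (≡-trans (val-swap X x w) e₃) _)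

    EssNbr : Fin n → Set
    EssNbr v = nbr G X w v ≡ true × val (del₁ X v) ≡ b

    -- Here `x` would turn from neutral to essential. If `v` is essential in X-x, then `w` is a
    -- neutral neighbour of it there; if not, the values of X and X-x-v exceed the odd sum of those
    -- of X-x and X-v.
    neutral-stays : ∀ v → EssNbr v → ∀ x → x ∈ᵥ X → x ≢ w → val (del₁ X x) ≡ suc b → val (del₂ X w x) ≡ suc b → ⊥
    neutral-stays v (wv , ev) x x∈X x≢w ex ewx = contra (near (del₁ X x) v 0 b (∈-del₁ X v∈X v≢x) ex)
      where
      v∈X = proj₁ (nbr⁻ G {X} wv)
      v≢x : v ≢ x
      v≢x ≡-refl = ℕₚ.1+n≢n (≡-trans (≡-sym ex) ev)
      contra : (val (del₂ X x v) ≡ b) ⊎ (val (del₂ X x v) ≡ suc b) ⊎ (val (del₂ X x v) ≡ suc (suc b)) → ⊥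
      contra (inj₁ e₀) = not-neutral (del₁ X x) w v b (∈-del₁ X w∈X (λ e → x≢w (≡-sym e)))
        (≡-trans (nbr-del₁ G X x w v) (∧-true⁺ wv (≠ᵇ-≢ v≢x))) ex e₀ (≡-trans (val-swap X x w) ewx)
      contra (inj₂ (inj₁ e₁)) = odd-deleted X x v b 1 0 1 1 0 x∈X v∈X (λ e → v≢x (≡-sym e)) ex ev eX e₁ ≡-refl _
      contra (inj₂ (inj₂ e₂)) = odd-deleted X x v b 1 0 1 2 0 x∈X v∈X (λ e → v≢x (≡-sym e)) ex ev eX e₂ ≡-refl _

    -- Here `x` would turn from positive to essential, and the conclusion makes it parallel to `v`
    -- in X-w. The value b is excluded by the edge from `w` to `v` in X-x, and b + 1 by parity in
    -- X-v.
    positive-parallel : ∀ v → EssNbr v → ∀ x → x ∈ᵥ X → x ≢ w → val (del₁ X x) ≡ suc (suc b) → val (del₂ X w x) ≡ suc b →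
      val (del₂ (del₁ X w) v x) ≡ suc (suc b)
    positive-parallel v (wv , ev) x x∈X x≢w ex ewx = ≡-trans (val-≗ perm) (pick (near (del₂ X x w) v 0 b v∈ (≡-trans (val-swap X x w) ewx)))
      where
      v∈X = proj₁ (nbr⁻ G {X} wv)
      v≢w = proj₁ (proj₂ (nbr⁻ G {X} wv))
      v≢x : v ≢ x
      v≢x ≡-refl = ℕₚ.<⇒≢ (ℕₚ.<-trans (ℕₚ.n<1+n b) (ℕₚ.n<1+n (suc b))) (≡-trans (≡-sym ev) ex)
      w≢x : w ≢ x
      w≢x e = x≢w (≡-sym e)
      v∈ : v ∈ᵥ del₂ X x w
      v∈ = ∈-del₁ (del₁ X x) (∈-del₁ X v∈X v≢x) v≢w
      perm : del₂ (del₁ X w) v x ≗ del₁ (del₂ X x w) v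
      perm a = ≡-trans (del₂-comm (del₁ X w) v x a) (del₁-≗ (del₂-comm X w x) v a)
      y≡ : val (del₂ X x v) ≡ suc b
      y≡ with near (del₁ X x) v 1 b (∈-del₁ X v∈X v≢x) ex
      ... | inj₁ e₁ = e₁
      ... | inj₂ (inj₁ e₂) = ⊥-elim (far (del₁ X v) x b 0 2 (∈-del₁ X x∈X (λ e → v≢x (≡-sym e))) ev (≡-trans (val-swap X v x) e₂) _)
      ... | inj₂ (inj₂ e₃) = ⊥-elim (far (del₁ X v) x b 0 3 (∈-del₁ X x∈X (λ e → v≢x (≡-sym e))) ev (≡-trans (val-swap X v x) e₃) _)
      pick : (val (del₁ (del₂ X x w) v) ≡ b) ⊎ (val (del₁ (del₂ X x w) v) ≡ suc b) ⊎ (val (del₁ (del₂ X x w) v) ≡ suc (suc b)) →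
        val (del₁ (del₂ X x w) v) ≡ suc (suc b)
      pick (inj₁ e₀) = ⊥-elim (ℕₚ.<-irrefl ≡-refl (≡-subst (suc b ≤_) e₀ (edge-≥ (del₁ X x) w v (suc b) (∈-del₁ X w∈X w≢x)
          (≡-trans (nbr-del₁ G X x w v) (∧-true⁺ wv (≠ᵇ-≢ v≢x)))
          (≡-subst₂ (λ s t → b ℕ.+ suc b ≤ s ℕ.+ t) (≡-sym (≡-trans (val-swap X x w) ewx)) (≡-sym y≡) (ℕₚ.n≤1+n _))
          (≡-subst₂ (λ s t → b ℕ.+ suc b ≤ s ℕ.+ t) (≡-sym ex) (≡-sym e₀)
            (ℕₚ.≤-trans (ℕₚ.≤-reflexive (ℕₚ.+-comm b (suc b))) (ℕₚ.n≤1+n _))))))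
      pick (inj₂ (inj₁ e₁)) = ⊥-elim (odd-undeleted (del₁ X v) w x b 1 1 0 1 0 (∈-del₁ X w∈X (λ e → v≢w (≡-sym e)))
          (∈-del₁ X x∈X (λ e → v≢x (≡-sym e))) w≢x (≡-trans (val-swap X v w) (essential-stays v v∈X v≢w ev))
          (≡-trans (val-swap X v x) y≡) ev (≡-trans (val-≗ perm′) e₁) ≡-refl _)
        where
        perm′ : del₂ (del₁ X v) w x ≗ del₁ (del₂ X x w) v
        perm′ a = ≡-trans (del₁-≗ (del₂-comm X v w) x a) (perm a)
      pick (inj₂ (inj₂ e₂)) = e₂

    -- In X-v the vertex `w` is positive, so it has a neighbour `t` that is essential in X-v-w.
    -- Hence `v` and `t` are not parallel in X-w, although `x` is parallel to both.
    positive-stays : ∀ v → EssNbr v → ∀ x → x ∈ᵥ X → x ≢ w → val (del₁ X x) ≡ suc (suc b) → val (del₂ X w x) ≡ suc b → ⊥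
    positive-stays v (wv , ev) x x∈X x≢w ex ewx = ℕₚ.<-irrefl ≡-refl (≡-subst (suc b ≤_) evt
        (parallel-trans W v t x (suc b) (∈-del₁ X v∈X v≢w) (∈-del₁ X t∈X t≢w) (∈-del₁ X x∈X x≢w) (λ e → t≢v (≡-sym e)) v≢x t≢x
          ew ewv ewt ewx
          (ℕₚ.≤-trans (ℕₚ.n≤1+n _) (ℕₚ.≤-reflexive (≡-sym (positive-parallel v (wv , ev) x x∈X x≢w ex ewx))))
          (ℕₚ.≤-trans (ℕₚ.n≤1+n _) (ℕₚ.≤-reflexive (≡-sym (positive-parallel t (wt , et) x x∈X x≢w ex ewx))))))
      where
      W = del₁ X w
      v∈X = proj₁ (nbr⁻ G {X} wv)
      v≢w = proj₁ (proj₂ (nbr⁻ G {X} wv))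
      ≢-by-val : ∀ {y} → val (del₁ X y) ≡ b → y ≢ x
      ≢-by-val ey ≡-refl = ℕₚ.<⇒≢ (ℕₚ.<-trans (ℕₚ.n<1+n b) (ℕₚ.n<1+n (suc b))) (≡-trans (≡-sym ey) ex)
      v≢x = ≢-by-val ev
      ewv : val (del₁ W v) ≡ suc b
      ewv = essential-stays v v∈X v≢w ev
      found = positive⇒essential-nbr (del₁ X v) w (∈-del₁ X w∈X (λ e → v≢w (≡-sym e)))
        (≡-trans (val-swap X v w) (≡-trans ewv (cong suc (≡-sym ev))))
      t = proj₁ found
      t-nbr = ∧-true⁻ {nbr G X w t} (≡-trans (≡-sym (nbr-del₁ G X v w t)) (proj₁ (proj₂ found)))
      wt : nbr G X w t ≡ true
      wt = proj₁ t-nbr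
      t≢v : t ≢ v
      t≢v = ≢-≠ᵇ (proj₂ t-nbr)
      t∈X = proj₁ (nbr⁻ G {X} wt)
      t≢w = proj₁ (proj₂ (nbr⁻ G {X} wt))
      evt : val (del₂ W v t) ≡ b
      evt = ≡-trans (val-≗ (del₁-≗ (del₂-comm X w v) t)) (≡-trans (proj₂ (proj₂ found)) ev)
      ewt : val (del₁ W t) ≡ suc b
      ewt with near W t 1 b (∈-del₁ X t∈X t≢w) ew
      ... | inj₁ e₁ = e₁
      ... | inj₂ (inj₁ e₂) = ⊥-elim (below 2 e₂ ℕₚ.≤-refl)
        where
        below : ∀ i → val (del₁ W t) ≡ i ℕ.+ b → 2 ≤ i → ⊥
        below i e p = ℕₚ.<⇒≱ (ℕₚ.+-monoˡ-< b p) (≡-subst₂ _≤_ e (cong suc (≡-trans (val-swap W t v) evt))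
          (val≤1+val-del (del₁ W t) v (∈-del₁ W (∈-del₁ X v∈X v≢w) (λ e → t≢v (≡-sym e)))))
      ... | inj₂ (inj₂ e₃) = ⊥-elim (below 3 e₃ (s≤s (s≤s z≤n)))
        where
        below : ∀ i → val (del₁ W t) ≡ i ℕ.+ b → 2 ≤ i → ⊥
        below i e p = ℕₚ.<⇒≱ (ℕₚ.+-monoˡ-< b p) (≡-subst₂ _≤_ e (cong suc (≡-trans (val-swap W t v) evt))
          (val≤1+val-del (del₁ W t) v (∈-del₁ W (∈-del₁ X v∈X v≢w) (λ e → t≢v (≡-sym e)))))
      -- A neutral `t` would become essential in X-w, and a positive one would be parallel to `v`;
      -- both are excluded.
      et : val (del₁ X t) ≡ b
      et with near X t 0 b t∈X eX
      ... | inj₁ e₀ = e₀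
      ... | inj₂ (inj₁ e₁) = ⊥-elim (neutral-stays v (wv , ev) t t∈X t≢w e₁ ewt)
      ... | inj₂ (inj₂ e₂) = ⊥-elim (ℕₚ.<⇒≢ (ℕₚ.<-trans (ℕₚ.n<1+n b) (ℕₚ.n<1+n (suc b)))
              (≡-trans (≡-sym evt) (positive-parallel v (wv , ev) t t∈X t≢w e₂ ewt)))
      t≢x = ≢-by-val et

    -- Since X-w has a value one larger than X, this says that `x` keeps its type. Of the
    -- transitions not treated above, neutral to positive would need a jump by 2, and positive to
    -- neutral fails by parity.
    types-stable : ∀ v → EssNbr v → ∀ x → x ∈ᵥ X → x ≢ w → val (del₂ X w x) ≡ suc (val (del₁ X x))
    types-stable v ess x x∈X x≢w with near X x 0 b x∈X eX
    ... | inj₁ e₀ = ≡-trans (essential-stays x x∈X x≢w e₀) (cong suc (≡-sym e₀))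
    ... | inj₂ (inj₁ e₁) with near (del₁ X w) x 1 b (∈-del₁ X x∈X x≢w) ew
    ...   | inj₁ f₁ = ⊥-elim (neutral-stays v ess x x∈X x≢w e₁ f₁)
    ...   | inj₂ (inj₁ f₂) = ≡-trans f₂ (cong suc (≡-sym e₁))
    ...   | inj₂ (inj₂ f₃) = ⊥-elim (far (del₁ X x) w b 1 3 (∈-del₁ X w∈X (λ e → x≢w (≡-sym e))) e₁ (≡-trans (val-swap X x w) f₃) _)
    types-stable v ess x x∈X x≢w | inj₂ (inj₂ e₂) with near (del₁ X w) x 1 b (∈-del₁ X x∈X x≢w) ew
    ...   | inj₁ f₁ = ⊥-elim (positive-stays v ess x x∈X x≢w e₂ f₁)
    ...   | inj₂ (inj₁ f₂) = ⊥-elim (odd-undeleted X w x b 2 2 1 2 1 w∈X x∈X (λ e → x≢w (≡-sym e)) ew e₂ eX f₂ ≡-refl _)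
    ...   | inj₂ (inj₂ f₃) = ≡-trans f₃ (cong suc (≡-sym e₂))

-- Deleting the special vertices and putting them back as joined vertices.

∩-empty⇒∖ : ∀ {n} (X A : VSet n) → card (X ∩ᵥ A) ≡ 0 → X ≗ (X ∖ A)
∩-empty⇒∖ X A e w with X w | A w | card-empty (X ∩ᵥ A) e w
... | false | _     | _ = ≡-refl
... | true  | false | _ = ≡-refl

card-∩-del₁ : ∀ {n} (X A : VSet n) w → w ∈ᵥ (X ∩ᵥ A) → card (X ∩ᵥ A) ≡ suc (card (del₁ X w ∩ᵥ A))
card-∩-del₁ X A w w∈ = ≡-trans (card-del₁ (X ∩ᵥ A) w w∈) (cong suc (card-≗ (λ z → ≡-sym (del₁-∩ X A w z))))

module DeleteSpecial {n : ℕ} (G : Graph n) (val : VSet n → ℕ) (laws : MultiplicityLaws G val) (A : VSet n) where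
  open MultiplicityLaws laws
  open Stability G val laws

  AllSpecial : VSet n → ℕ → Set
  AllSpecial X b = ∀ x → x ∈ᵥ X → x ∈ᵥ A → val (del₁ X x) ≢ b × ∃[ v ] (nbr G X x v ≡ true × val (del₁ X v) ≡ b)

  -- Deleting one special vertex `w` raises all other values by one. The remaining vertices of `A`
  -- therefore stay special: they are still not essential, and their essential neighbours, which
  -- differ from the positive `w`, are still essential.
  delete-special : ∀ a X b → card (X ∩ᵥ A) ≡ a → val X ≡ suc b → AllSpecial X b →
    val (X ∖ A) ≡ a ℕ.+ val X × (∀ x → x ∈ᵥ X → A x ≡ false → val (del₁ (X ∖ A) x) ≡ a ℕ.+ val (del₁ X x))
  delete-special zero X b e eX sp = val-≗ (λ w → ≡-sym (∩-empty⇒∖ X A e w)) ,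
    λ x _ _ → val-≗ (del₁-≗ (λ w → ≡-sym (∩-empty⇒∖ X A e w)) x)
  delete-special (suc a) X b e eX sp = go (card-positive (X ∩ᵥ A) a e)
    where
    go : ∃[ w ] w ∈ᵥ (X ∩ᵥ A) → val (X ∖ A) ≡ suc a ℕ.+ val X × (∀ x → x ∈ᵥ X → A x ≡ false → val (del₁ (X ∖ A) x) ≡ suc a ℕ.+ val (del₁ X x))
    go (w , w∈XA) = ≡-trans (val-≗ (λ z → ≡-sym (same z))) (≡-trans (proj₁ IH) (≡-trans (cong (a ℕ.+_) (≡-trans ew (cong suc (≡-sym eX)))) (ℕₚ.+-suc a (val X)))) ,
      λ x x∈X x∉A → ≡-trans (val-≗ (del₁-≗ (λ z → ≡-sym (same z)) x)) (≡-trans (proj₂ IH x (∈-del₁ X x∈X (x≢w x∉A)) x∉A)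
        (≡-trans (cong (a ℕ.+_) (stable x x∈X (x≢w x∉A))) (ℕₚ.+-suc a _)))
      where
      w∈X = proj₁ (∧-true⁻ {X w} w∈XA)
      w∈A = proj₂ (∧-true⁻ {X w} w∈XA)
      v = proj₁ (proj₂ (sp w w∈X w∈A))
      wv = proj₁ (proj₂ (proj₂ (sp w w∈X w∈A)))
      ev = proj₂ (proj₂ (proj₂ (sp w w∈X w∈A)))
      ew : val (del₁ X w) ≡ suc (suc b)
      ew = special⇒positive X w v b w∈X wv eX ev (proj₁ (sp w w∈X w∈A))
      stable : ∀ x → x ∈ᵥ X → x ≢ w → val (del₂ X w x) ≡ suc (val (del₁ X x))
      stable = types-stable X w b w∈X eX ew v (wv , ev)
      x≢w : ∀ {x} → A x ≡ false → x ≢ w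
      x≢w x∉A ≡-refl = true≢false w∈A x∉A
      same : (del₁ X w ∖ A) ≗ (X ∖ A)
      same = del₁-∖ X A w w∈A
      sp′ : AllSpecial (del₁ X w) (suc b)
      sp′ x x∈ x∈A = let (x∈X , x≠w) = ∧-true⁻ {X x} x∈ ; x≢w = ≢-≠ᵇ x≠w ; (ne , y , xy , ey) = sp x x∈X x∈A
                         (y∈X , y≢x , xy-adj) = nbr⁻ G {X} xy in
        (λ e → ne (ℕₚ.suc-injective (≡-trans (≡-sym (stable x x∈X x≢w)) e))) ,
        y , ≡-trans (nbr-del₁ G X w x y) (∧-true⁺ xy (≠ᵇ-≢ (y≢w y ey))) , ≡-trans (stable y y∈X (y≢w y ey)) (cong suc ey)
        where
        y≢w : ∀ y → val (del₁ X y) ≡ b → y ≢ w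
        y≢w y ey ≡-refl = ℕₚ.<⇒≢ (ℕₚ.<-trans (ℕₚ.n<1+n b) (ℕₚ.n<1+n (suc b))) (≡-trans (≡-sym ey) ew)
      IH = delete-special a (del₁ X w) (suc b) (ℕₚ.suc-injective (≡-trans (≡-sym (card-∩-del₁ X A w w∈XA)) e)) ew sp′

module AddJoined {n : ℕ} (G : Graph n) (A : VSet n) (valG valS : VSet n → ℕ)
  (lawsG : MultiplicityLaws G valG) (lawsS : MultiplicityLaws (sGraph G A) valS)
  (agree : ∀ X → card (X ∩ᵥ A) ≡ 0 → valS X ≡ valG X) where
  open MultiplicityLaws lawsS
  private module G = MultiplicityLaws lawsG

  adj-joined : ∀ w z → w ∈ᵥ A → w ≢ z → adj (sGraph G A) w z ≡ true
  adj-joined w z w∈A w≢z rewrite w∈A | ≠ᵇ-≢ w≢z with adj G w z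
  ... | true  = ≡-refl
  ... | false = ≡-refl

  -- If X-w has positive multiplicity, it has an essential vertex, and `w` is adjacent to it; this
  -- forces `w` to be positive in X. The bound on `a` keeps the multiplicity positive before each
  -- vertex is put back.
  add-joined : ∀ a X → card (X ∩ᵥ A) ≡ a → a ≤ valG (X ∖ A) → a ℕ.+ valS X ≡ valG (X ∖ A)
  add-joined zero X e le = ≡-trans (agree X e) (G.val-≗ (∩-empty⇒∖ X A e))
  add-joined (suc a) X e le = go (card-positive (X ∩ᵥ A) a e)
    where
    go : ∃[ w ] w ∈ᵥ (X ∩ᵥ A) → suc a ℕ.+ valS X ≡ valG (X ∖ A)
    go (w , w∈XA) = positive (valS (del₁ X w)) ≡-refl
      where
      w∈X = proj₁ (∧-true⁻ {X w} w∈XA)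
      w∈A = proj₂ (∧-true⁻ {X w} w∈XA)
      same : valG (del₁ X w ∖ A) ≡ valG (X ∖ A)
      same = G.val-≗ (del₁-∖ X A w w∈A)
      IH : a ℕ.+ valS (del₁ X w) ≡ valG (X ∖ A)
      IH = ≡-trans (add-joined a (del₁ X w) (ℕₚ.suc-injective (≡-trans (≡-sym (card-∩-del₁ X A w w∈XA)) e))
             (≡-subst (a ≤_) (≡-sym same) (ℕₚ.≤-trans (ℕₚ.n≤1+n a) le))) same
      positive : ∀ t → valS (del₁ X w) ≡ t → suc a ℕ.+ valS X ≡ valG (X ∖ A)
      positive zero et = ⊥-elim (ℕₚ.<⇒≱ le (ℕₚ.≤-reflexive (≡-trans (≡-sym IH) (≡-trans (cong (a ℕ.+_) et) (ℕₚ.+-identityʳ a)))))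
      positive (suc τ) et = let (z , z∈ , ez) = essential-exists (del₁ X w) τ et ; (z∈X , z≠w) = ∧-true⁻ {X z} z∈ in
        ≡-trans (cong (suc a ℕ.+_) (essential-nbr⇒positive X w z τ w∈X
            (nbr⁺ (sGraph G A) {X} z∈X (≢-≠ᵇ z≠w) (adj-joined w z w∈A (λ e → ≢-≠ᵇ z≠w (≡-sym e)))) et ez))
          (≡-trans (≡-sym (ℕₚ.+-suc a τ)) (≡-trans (cong (a ℕ.+_) (≡-sym et)) IH))

-- Additivity over connected components.

module Components {n : ℕ} (G : Graph n) (val : VSet n → ℕ) (laws : MultiplicityLaws G val)
  (X C : VSet n) (comp : IsComponent G X C) where
  open MultiplicityLaws laws

  private
    C⊆X = proj₁ comp

    noEdges : ∀ Y → (∀ w → w ∈ᵥ Y → w ∈ᵥ X) → ∀ w z → w ∈ᵥ Y → z ∈ᵥ Y → C w ≡ true → C z ≡ false → adj G w z ≡ false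
    noEdges Y ⊆ w z _ z∈ w∈C z∉C = caseᵇ (adj G w z) (λ e → true≢false (proj₂ (proj₂ comp) w z w∈C (⊆ z z∈) e) z∉C) id

    ⊆del : ∀ {Y : VSet n} {u} → (∀ w → w ∈ᵥ Y → w ∈ᵥ X) → ∀ w → w ∈ᵥ del₁ Y u → w ∈ᵥ X
    ⊆del {Y} ⊆ w p = ⊆ w (proj₁ (∧-true⁻ {Y w} p))

    cap : (X ∩ᵥ C) ≗ C
    cap w = caseᵇ (C w) (λ p → ≡-trans (cong₂ _∧_ (C⊆X w p) p) (≡-sym p)) (λ p → ≡-trans (cong (X w ∧_) p) (≡-trans (∧-zeroʳ (X w)) (≡-sym p)))

    outside-∩ : ∀ v → C v ≡ false → ∀ Y → (del₁ Y v ∩ᵥ C) ≗ (Y ∩ᵥ C)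
    outside-∩ v v∉C Y w with w ≟ᶠ v
    ... | yes ≡-refl rewrite v∉C = ≡-trans (∧-zeroʳ (Y w ∧ false)) (≡-sym (∧-zeroʳ (Y w)))
    ... | no _ = cong (_∧ C w) (∧-identityʳ (Y w))

    outside-∖ : ∀ v Y → (del₁ Y v ∖ C) ≗ del₁ (Y ∖ C) v
    outside-∖ v Y w = ∧-rotate (Y w) (w ≠ᵇ v) (not (C w))

  val-split : val X ≡ val C ℕ.+ val (X ∖ C)
  val-split = ≡-trans (val-∩∖ C X (noEdges X (λ _ → id))) (cong (ℕ._+ val (X ∖ C)) (val-≗ cap))

  val-split-del₁ : ∀ u → u ∈ᵥ C → val (del₁ X u) ≡ val (del₁ C u) ℕ.+ val (X ∖ C)
  val-split-del₁ u u∈C = ≡-trans (val-∩∖ C (del₁ X u) (noEdges _ (⊆del {X} (λ _ → id))))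
    (cong₂ ℕ._+_ (val-≗ (λ w → ≡-trans (del₁-∩ X C u w) (del₁-≗ cap u w))) (val-≗ (del₁-∖ X C u u∈C)))

  val-split-del₂ : ∀ u v → u ∈ᵥ C → v ∈ᵥ C → val (del₂ X u v) ≡ val (del₂ C u v) ℕ.+ val (X ∖ C)
  val-split-del₂ u v u∈C v∈C = ≡-trans (val-∩∖ C (del₂ X u v) (noEdges _ (⊆del {del₁ X u} (⊆del {X} (λ _ → id)))))
    (cong₂ ℕ._+_ (val-≗ (λ w → ≡-trans (del₁-∩ (del₁ X u) C v w) (del₁-≗ (λ w → ≡-trans (del₁-∩ X C u w) (del₁-≗ cap u w)) v w)))
      (val-≗ (λ w → ≡-trans (del₁-∖ (del₁ X u) C v v∈C w) (del₁-∖ X C u u∈C w))))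

  -- Deletions inside and outside a component change different summands, so the two changes add.
  val-across : ∀ u v → u ∈ᵥ C → C v ≡ false → val (del₂ X u v) ℕ.+ val X ≡ val (del₁ X u) ℕ.+ val (del₁ X v)
  val-across u v u∈C v∉C = ≡-trans (cong₂ ℕ._+_ uv val-split) (≡-trans (swap (val (del₁ C u)) _ (val C) _) (cong₂ ℕ._+_ (≡-sym (val-split-del₁ u u∈C)) (≡-sym vv)))
    where
    swap : ∀ p q r s → (p ℕ.+ q) ℕ.+ (r ℕ.+ s) ≡ (p ℕ.+ s) ℕ.+ (r ℕ.+ q)
    swap = solve-∀ℕ
    vv : val (del₁ X v) ≡ val C ℕ.+ val (del₁ (X ∖ C) v)
    vv = ≡-trans (val-∩∖ C (del₁ X v) (noEdges _ (⊆del {X} (λ _ → id))))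
      (cong₂ ℕ._+_ (val-≗ (λ w → ≡-trans (outside-∩ v v∉C X w) (cap w))) (val-≗ (outside-∖ v X)))
    uv : val (del₂ X u v) ≡ val (del₁ C u) ℕ.+ val (del₁ (X ∖ C) v)
    uv = ≡-trans (val-∩∖ C (del₂ X u v) (noEdges _ (⊆del {del₁ X u} (⊆del {X} (λ _ → id)))))
      (cong₂ ℕ._+_ (val-≗ (λ w → ≡-trans (outside-∩ v v∉C (del₁ X u) w) (≡-trans (del₁-∩ X C u w) (del₁-≗ cap u w))))
        (val-≗ (λ w → ≡-trans (outside-∖ v (del₁ X u) w) (del₁-≗ (del₁-∖ X C u u∈C) v w))))

-- Reading off the multiplicities in S_θ(G).

module Cases {n : ℕ} (G : Graph n) (A : VSet n) (valG valS : VSet n → ℕ)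
  (lawsG : MultiplicityLaws G valG) (lawsS : MultiplicityLaws (sGraph G A) valS)
  (agree : ∀ X → card (X ∩ᵥ A) ≡ 0 → valS X ≡ valG X)
  (k : ℕ) (eG : valG full ≡ suc (suc k))
  (special : ∀ x → x ∈ᵥ A → valG (del₁ full x) ≢ suc k × ∃[ v ] (nbr G full x v ≡ true × valG (del₁ full v) ≡ suc k)) where
  open MultiplicityLaws lawsG
  open DeleteSpecial G valG lawsG A
  open AddJoined G A valG valS lawsG lawsS agree

  X₀ : VSet n
  X₀ = full ∖ A

  private
    a K : ℕ
    a = card (full ∩ᵥ A)
    K = suc (suc k)

    deleted = delete-special a full (suc k) ≡-refl eG (λ x _ → special x)

    ∈X₀ : ∀ {x} → A x ≡ false → x ∈ᵥ X₀
    ∈X₀ e rewrite e = ≡-refl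

    eX₀ : valG X₀ ≡ a ℕ.+ K
    eX₀ = ≡-trans (proj₁ deleted) (cong (a ℕ.+_) eG)

  val-X₀-del₁ : ∀ x → A x ≡ false → valG (del₁ X₀ x) ≡ a ℕ.+ valG (del₁ full x)
  val-X₀-del₁ x = proj₂ deleted x ≡-refl

  X₀⇒full : ∀ x e → A x ≡ false → valG (del₁ X₀ x) ≡ e ℕ.+ valG X₀ → valG (del₁ full x) ≡ e ℕ.+ K
  X₀⇒full x e x∉A h = ℕₚ.+-cancelˡ-≡ a _ _ (≡-trans (≡-sym (val-X₀-del₁ x x∉A)) (≡-trans h (≡-trans (cong (e ℕ.+_) eX₀) (swap e a K))))
    where
    swap : ∀ e a k → e ℕ.+ (a ℕ.+ k) ≡ a ℕ.+ (e ℕ.+ k)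
    swap = solve-∀ℕ

  X₀⇒full⁻ : ∀ x → A x ≡ false → suc (valG (del₁ X₀ x)) ≡ valG X₀ → valG (del₁ full x) ≡ suc k
  X₀⇒full⁻ x x∉A h = ℕₚ.suc-injective (ℕₚ.+-cancelˡ-≡ a _ _ (≡-trans (ℕₚ.+-suc a _) (≡-trans (cong suc (≡-sym (val-X₀-del₁ x x∉A))) (≡-trans h eX₀))))

  full⇒X₀ : ∀ x e → A x ≡ false → valG (del₁ full x) ≡ e ℕ.+ K → valG (del₁ X₀ x) ≡ e ℕ.+ valG X₀
  full⇒X₀ x e x∉A h = ≡-trans (val-X₀-del₁ x x∉A) (≡-trans (cong (a ℕ.+_) h) (≡-trans (swap e a K) (cong (e ℕ.+_) (≡-sym eX₀))))
    where
    swap : ∀ e a k → a ℕ.+ (e ℕ.+ k) ≡ e ℕ.+ (a ℕ.+ k)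
    swap = solve-∀ℕ

  full⇒X₀⁻ : ∀ x → A x ≡ false → valG (del₁ full x) ≡ suc k → suc (valG (del₁ X₀ x)) ≡ valG X₀
  full⇒X₀⁻ x x∉A h = ≡-trans (cong suc (≡-trans (val-X₀-del₁ x x∉A) (cong (a ℕ.+_) h))) (≡-trans (≡-sym (ℕₚ.+-suc a (suc k))) (≡-sym eX₀))

  valS-full : valS full ≡ K
  valS-full = ℕₚ.+-cancelˡ-≡ a _ _ (≡-trans (add-joined a full ≡-refl (≡-subst (a ≤_) (≡-sym eX₀) (ℕₚ.m≤m+n a K))) eX₀)

  private
    cap-in : ∀ u (Y : VSet n) → A u ≡ false → card (del₁ Y u ∩ᵥ A) ≡ card (Y ∩ᵥ A)
    cap-in u Y u∉A = card-≗ eq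
      where
      eq : (del₁ Y u ∩ᵥ A) ≗ (Y ∩ᵥ A)
      eq w with w ≟ᶠ u
      ... | yes ≡-refl rewrite u∉A = ≡-trans (∧-zeroʳ (Y w ∧ false)) (≡-sym (∧-zeroʳ (Y w)))
      ... | no _ = cong (_∧ A w) (∧-identityʳ (Y w))
    rest-in : ∀ u (Y : VSet n) → (del₁ Y u ∖ A) ≗ del₁ (Y ∖ A) u
    rest-in u Y w = ∧-rotate (Y w) (w ≠ᵇ u) (not (A w))

  -- Two fewer special vertices are put back, so the multiplicity is that of G plus 2.
  both-special : ∀ u v → u ≢ v → u ∈ᵥ A → v ∈ᵥ A → valS (del₂ full u v) ≢ K
  both-special u v u≢v u∈A v∈A e = ℕₚ.<⇒≢ (ℕₚ.≤-trans (s≤s (ℕₚ.n≤1+n _)) ℕₚ.≤-refl) (≡-trans lhs (≡-trans (cong (ℕ._+ K) countA) ≡-refl))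
    where
    a₂ = card (del₂ full u v ∩ᵥ A)
    countA : a ≡ suc (suc a₂)
    countA = ≡-trans (card-∩-del₁ full A u u∈A) (cong suc (card-∩-del₁ (del₁ full u) A v (∧-true⁺ (∈-del₁ full ≡-refl (λ e → u≢v (≡-sym e))) v∈A)))
    same : valG (del₂ full u v ∖ A) ≡ a ℕ.+ K
    same = ≡-trans (val-≗ (λ w → ≡-trans (del₁-∖ (del₁ full u) A v v∈A w) (del₁-∖ full A u u∈A w))) eX₀
    lhs : a₂ ℕ.+ K ≡ a ℕ.+ K
    lhs = ≡-trans (cong (a₂ ℕ.+_) (≡-sym e)) (≡-trans (add-joined a₂ (del₂ full u v) ≡-refl
      (≡-subst (a₂ ≤_) (≡-sym same) (ℕₚ.≤-trans (ℕₚ.≤-trans (ℕₚ.n≤1+n a₂) (ℕₚ.n≤1+n _)) (ℕₚ.≤-trans (ℕₚ.≤-reflexive (≡-sym countA)) (ℕₚ.m≤m+n a K))))) same)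

  -- G-A-v has multiplicity |A| + mult(G-v), and all special vertices except one are put back. The
  -- result is mult(G) exactly if `v` is essential.
  one-special : ∀ u v → u ≢ v → u ∈ᵥ A → A v ≡ false → valS (del₂ full u v) ≡ suc (valG (del₁ full v))
  one-special u v u≢v u∈A v∉A = ℕₚ.+-cancelˡ-≡ a₁ _ _ (≡-trans (add-joined a₁ (del₂ full u v) ≡-refl bound) (≡-trans same (≡-trans (cong (ℕ._+ valG (del₁ full v)) countA) (≡-sym (ℕₚ.+-suc a₁ _)))))
    where
    a₁ = card (del₂ full u v ∩ᵥ A)
    countA : a ≡ suc a₁
    countA = ≡-trans (card-∩-del₁ full A u u∈A) (cong suc (≡-sym (cap-in v (del₁ full u) v∉A)))
    same : valG (del₂ full u v ∖ A) ≡ a ℕ.+ valG (del₁ full v)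
    same = ≡-trans (val-≗ (λ w → ≡-trans (rest-in v (del₁ full u) w) (del₁-≗ (del₁-∖ full A u u∈A) v w))) (val-X₀-del₁ v v∉A)
    bound : a₁ ≤ valG (del₂ full u v ∖ A)
    bound = ≡-subst (a₁ ≤_) (≡-sym same) (ℕₚ.≤-trans (ℕₚ.≤-trans (ℕₚ.n≤1+n a₁) (ℕₚ.≤-reflexive (≡-sym countA))) (ℕₚ.m≤m+n a _))

  none-special : ∀ u v → u ≢ v → A u ≡ false → A v ≡ false → a ℕ.+ valS (del₂ full u v) ≡ valG (del₂ X₀ u v)
  none-special u v u≢v u∉A v∉A = ≡-trans (add-joined a (del₂ full u v) countA (≡-subst (a ≤_) (≡-sym same) bound)) same
    where
    countA : card (del₂ full u v ∩ᵥ A) ≡ a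
    countA = ≡-trans (cap-in v (del₁ full u) v∉A) (cap-in u full u∉A)
    same : valG (del₂ full u v ∖ A) ≡ valG (del₂ X₀ u v)
    same = val-≗ (λ w → ≡-trans (rest-in v (del₁ full u) w) (del₁-≗ (rest-in u full) v w))
    -- Two deletions cost at most 2, which mult(G) = k + 2 can pay, so that |A| vertices can still
    -- be put back. This is where a multiplicity of at least 2 enters.
    bound : a ≤ valG (del₂ X₀ u v)
    bound = ℕₚ.≤-trans (ℕₚ.m≤m+n a k) (ℕₚ.≤-pred (ℕₚ.≤-pred (ℕₚ.≤-trans (ℕₚ.≤-reflexive (≡-trans (two a k) (≡-sym eX₀)))
      (ℕₚ.≤-trans (val≤1+val-del X₀ u (∈X₀ u∉A)) (s≤s (val≤1+val-del (del₁ X₀ u) v (∈-del₁ X₀ (∈X₀ v∉A) (λ e → u≢v (≡-sym e)))))))))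
      where
      two : ∀ a k → suc (suc (a ℕ.+ k)) ≡ a ℕ.+ suc (suc k)
      two = solve-∀ℕ

  none-special-⇒ : ∀ u v → u ≢ v → A u ≡ false → A v ≡ false → valS (del₂ full u v) ≡ K → valG (del₂ X₀ u v) ≡ valG X₀
  none-special-⇒ u v u≢v u∉A v∉A e = ≡-trans (≡-sym (none-special u v u≢v u∉A v∉A)) (≡-trans (cong (a ℕ.+_) e) (≡-sym eX₀))

  none-special-⇐ : ∀ u v → u ≢ v → A u ≡ false → A v ≡ false → valG (del₂ X₀ u v) ≡ valG X₀ → valS (del₂ full u v) ≡ K
  none-special-⇐ u v u≢v u∉A v∉A e = ℕₚ.+-cancelˡ-≡ a _ _ (≡-trans (none-special u v u≢v u∉A v∉A) (≡-trans e eX₀))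

-- All multiplicities at once, under double negation.

open import Data.Vec using (Vec; []; _∷_; lookup; tabulate)
open import Data.Vec.Properties using (lookup∘tabulate)

module _ {p} {P : Set p} where

  ¬¬-map : ∀ {q} {Q : Set q} → (P → Q) → ¬ ¬ P → ¬ ¬ Q
  ¬¬-map f h g = h (λ x → g (f x))

  ¬¬-em : ¬ ¬ (P ⊎ ¬ P)
  ¬¬-em h = h (inj₂ (λ x → h (inj₁ x)))

¬¬-∀Fin : ∀ {p n} {P : Fin n → Set p} → (∀ z → ¬ ¬ P z) → ¬ ¬ (∀ z → P z)
¬¬-∀Fin {n = zero}  h g = g (λ ())
¬¬-∀Fin {n = suc n} h g = h Fin.zero (λ a → ¬¬-∀Fin (h ∘ suc) (λ b → g (λ { zero → a ; (suc z) → b z })))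

-- Double negation commutes with finite universal quantification; Boolean vectors serve as a finite
-- list of the vertex sets, up to pointwise equality.
¬¬-∀Vec : ∀ {p n} {P : Vec Bool n → Set p} → (∀ x → ¬ ¬ P x) → ¬ ¬ (∀ x → P x)
¬¬-∀Vec {n = zero}  h g = h [] (λ a → g (λ { [] → a }))
¬¬-∀Vec {n = suc n} h g = ¬¬-∀Vec (h ∘ (true ∷_)) (λ a → ¬¬-∀Vec (h ∘ (false ∷_)) (λ b →
  g (λ { (true ∷ x) → a x ; (false ∷ x) → b x })))

module Existence {c ℓ} (F : CharZeroField c ℓ) (θ : CharZeroField.Carrier F) {n : ℕ} (G : Graph n) where
  open CharZeroField F hiding (zero)
  open Taylor F θ
  open MatchingSeries F θ using (M; M-cong; M-empty; M-rec)
  open RingSums seriesRing using (∑; on)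
  open import Algebra.Properties.AbelianGroup +-abelianGroup using (ε⁻¹≈ε)

  ∑-coeff-zero : ∀ {m} (f : Fin m → Ser) i → (∀ w → f w i ≈ 0#) → ∑ f i ≈ 0#
  ∑-coeff-zero {zero}  f i h = refl
  ∑-coeff-zero {suc m} f i h = trans (+-cong (h Fin.zero) (∑-coeff-zero (f ∘ suc) i (h ∘ suc))) (+-identityˡ _)

  degree : ∀ k X → card X ≤ k → ∀ i → k < i → M G X i ≈ 0#
  nbrs-degree : ∀ k X u → card (del₁ X u) ≤ k → ∀ i → k < i → - ∑ (λ w → on (nbr G X u w) (M G (del₂ X u w))) i ≈ 0#

  degree zero X le (suc i) _ = M-empty G X (ℕₚ.n≤0⇒n≡0 le) (suc i)
  degree (suc k) X le (suc i) (s≤s k<i) = by (card X) ≡-refl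
    where
    by : ∀ c → card X ≡ c → M G X (suc i) ≈ 0#
    by zero e = M-empty G X e (suc i)
    by (suc c) e with card-positive X c e
    ... | u , u∈X = trans (M-rec G X u u∈X (suc i)) (trans (+-cong
        (trans (𝕩⊛-suc (M G (del₁ X u)) i) (trans (+-cong (trans (*-congˡ (degree k (del₁ X u) le′ (suc i) (ℕₚ.m<n⇒m<1+n k<i))) (zeroʳ θ))
          (degree k (del₁ X u) le′ i k<i)) (+-identityˡ _)))
        (nbrs-degree k X u le′ (suc i) (ℕₚ.m<n⇒m<1+n k<i))) (+-identityˡ _))
      where
      le′ : card (del₁ X u) ≤ k
      le′ = ℕₚ.≤-pred (≡-subst (_≤ suc k) (card-del₁ X u u∈X) le)

  nbrs-degree k X u le i k<i = trans (-‿cong (∑-coeff-zero {n} _ i (λ w → each w k le k<i))) ε⁻¹≈ε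
    where
    each : ∀ w k → card (del₁ X u) ≤ k → k < i → on (nbr G X u w) (M G (del₂ X u w)) i ≈ 0#
    each w k le k<i with nbr G X u w in p
    ... | false = refl
    each w zero le k<i | true with ≡-trans (≡-sym (ℕₚ.n≤0⇒n≡0 le)) (card-del₁ (del₁ X u) w (proj₁ (∧-true⁻ {del₁ X u w} p)))
    ... | ()
    each w (suc k) le k<i | true = degree k (del₂ X u w)
      (ℕₚ.≤-pred (≡-subst (_≤ suc k) (card-del₁ (del₁ X u) w (proj₁ (∧-true⁻ {del₁ X u w} p))) le)) i (ℕₚ.<-trans (ℕₚ.n<1+n k) k<i)

  monic : ∀ k X → card X ≡ k → M G X k ≈ 1#
  monic zero X e = M-empty G X e 0
  monic (suc k) X e with card-positive X k e
  ... | u , u∈X = trans (M-rec G X u u∈X (suc k)) (trans (+-cong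
        (trans (𝕩⊛-suc (M G (del₁ X u)) k) (trans (+-cong (trans (*-congˡ (degree k (del₁ X u) (ℕₚ.≤-reflexive eY) (suc k) ℕₚ.≤-refl)) (zeroʳ θ))
          (monic k (del₁ X u) eY)) (+-identityˡ _)))
        (nbrs-degree k X u (ℕₚ.≤-reflexive eY) (suc k) ℕₚ.≤-refl)) (+-identityʳ _))
    where
    eY : card (del₁ X u) ≡ k
    eY = ℕₚ.suc-injective (≡-trans (≡-sym (card-del₁ X u u∈X)) e)

  -- An upward search from `j`, bounded by a coefficient known to be nonzero; each test for zero is
  -- available only under double negation.
  ¬¬HasVal : ∀ f d j → Ord j f → ¬ (f (d ℕ.+ j) ≈ 0#) → ¬ ¬ (∃[ m ] HasVal f m)
  ¬¬HasVal f zero j o ne h = h (j , o , ne)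
  ¬¬HasVal f (suc d) j o ne h = ¬¬-em λ where
    (inj₁ e)  → ¬¬HasVal f d (suc j) (Ord-suc o e) (≡-subst (λ k → ¬ (f k ≈ 0#)) (≡-sym (ℕₚ.+-suc d j)) ne) h
    (inj₂ ne′) → h (j , o , ne′)

  -- The coefficient of index |X| is 1, which bounds the search for each X.
  ¬¬val : ¬ ¬ (∃[ val ] (∀ X → HasVal (M G X) (val X)))
  ¬¬val = ¬¬-map build (¬¬-∀Vec (λ x → ¬¬HasVal (M G (lookup x)) (card (lookup x)) 0 (λ _ ())
      (λ e → 0≉1 (trans (sym e) (≡-subst (λ k → M G (lookup x) k ≈ 1#) (≡-sym (ℕₚ.+-identityʳ _)) (monic _ (lookup x) ≡-refl))))))
    where
    build : (∀ x → ∃[ m ] HasVal (M G (lookup x)) m) → ∃[ val ] (∀ X → HasVal (M G X) (val X))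
    build f = (λ X → proj₁ (f (tabulate X))) , λ X → let (m , o , ne) = f (tabulate X) ; e = M-cong G (lookup∘tabulate X) in
      Ord-cong e o , λ z → ne (trans (e m) z)

-- Reachability and connected components.

module _ {n : ℕ} (G : Graph n) where

  Reach-start : ∀ {X u v} → Reach G X u v → u ∈ᵥ X
  Reach-start (here p)      = p
  Reach-start (there p _ _) = p

  Reach-end : ∀ {X u v} → Reach G X u v → v ∈ᵥ X
  Reach-end (here p)      = p
  Reach-end (there _ _ r) = Reach-end r

  Reach-trans : ∀ {X u v w} → Reach G X u v → Reach G X v w → Reach G X u w
  Reach-trans (here _)      s = s
  Reach-trans (there p a r) s = there p a (Reach-trans r s)

  Reach-sym : ∀ {X u v} → Reach G X u v → Reach G X v u
  Reach-sym (here p) = here p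
  Reach-sym (there {u} {w} p a r) = Reach-trans (Reach-sym r) (there (Reach-start r) (≡-trans (adj-sym G w u) a) (here p))

  component-closed : ∀ {X C} → IsComponent G X C → ∀ {Y u v} → (∀ w → w ∈ᵥ Y → w ∈ᵥ X) → u ∈ᵥ C → Reach G Y u v → v ∈ᵥ C
  component-closed comp ⊆ u∈C (here _) = u∈C
  component-closed comp ⊆ u∈C (there {u} {w} _ a r) =
    component-closed comp ⊆ (proj₂ (proj₂ comp) u w u∈C (⊆ w (Reach-start r)) a) r

  component-⊆ : ∀ {X C C′} → IsComponent G X C → IsComponent G X C′ → ∀ {v} → v ∈ᵥ C → v ∈ᵥ C′ → ∀ w → w ∈ᵥ C → w ∈ᵥ C′
  component-⊆ comp comp′ {v} v∈C v∈C′ w w∈C =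
    component-closed comp′ (proj₁ comp) v∈C′ (proj₂ (proj₂ (proj₁ (proj₂ comp))) v w v∈C w∈C)

  component-≗ : ∀ {X C C′} → IsComponent G X C → IsComponent G X C′ → ∀ {v} → v ∈ᵥ C → v ∈ᵥ C′ → C ≗ C′
  component-≗ {X} {C} {C′} comp comp′ v∈C v∈C′ w = caseᵇ (C w)
    (λ p → ≡-trans p (≡-sym (component-⊆ comp comp′ v∈C v∈C′ w p)))
    (λ p → ≡-trans p (≡-sym (caseᵇ (C′ w) (λ q → ⊥-elim (true≢false (component-⊆ comp′ comp v∈C′ v∈C w q) p)) id)))

  -- Reachability is decided only under double negation here, which is enough for `locate`, where a
  -- contradiction is derived from the component.
  ¬¬component : ∀ X x → x ∈ᵥ X → ¬ ¬ (∃[ C ] (IsComponent G X C × x ∈ᵥ C))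
  ¬¬component X x x∈X = ¬¬-map build (¬¬-∀Fin (λ z → ¬¬-em))
    where
    build : (∀ z → Reach G X x z ⊎ ¬ Reach G X x z) → ∃[ C ] (IsComponent G X C × x ∈ᵥ C)
    build f = C , ((λ w p → Reach-end (C⇒ w p)) , (x , x∈C , conn) , closed) , x∈C
      where
      decide : ∀ {z} → Reach G X x z ⊎ ¬ Reach G X x z → Bool
      decide (inj₁ _) = true
      decide (inj₂ _) = false
      C : VSet n
      C z = decide (f z)
      C⇒ : ∀ z → z ∈ᵥ C → Reach G X x z
      C⇒ z p with f z
      ... | inj₁ r = r
      ⇒C : ∀ z → Reach G X x z → z ∈ᵥ C
      ⇒C z r with f z
      ... | inj₁ _ = ≡-refl
      ... | inj₂ h = ⊥-elim (h r)
      x∈C : x ∈ᵥ C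
      x∈C = ⇒C x (here x∈X)
      closed : ∀ w z → w ∈ᵥ C → z ∈ᵥ X → adj G w z ≡ true → z ∈ᵥ C
      closed w z w∈C z∈X a = ⇒C z (Reach-trans (C⇒ w w∈C) (there (Reach-end (C⇒ w w∈C)) a (here z∈X)))
      inside : ∀ {u v} → u ∈ᵥ C → Reach G X u v → Reach G C u v
      inside u∈C (here _) = here u∈C
      inside u∈C (there {u} {w} _ a r) = there u∈C a (inside (closed u w u∈C (Reach-start r) a) r)
      conn : ∀ u v → u ∈ᵥ C → v ∈ᵥ C → Reach G C u v
      conn u v u∈C v∈C = inside u∈C (Reach-trans (Reach-sym (C⇒ u u∈C)) (C⇒ v v∈C))

-- From numerical values back to the types and edges of the theorem.

module Main {c ℓ} (F : CharZeroField c ℓ) (θ : CharZeroField.Carrier F) {n : ℕ} (G : Graph n)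
  (k : ℕ) (multG : Theta.MultIs F θ G full (suc (suc k)))
  (A : VSet n) (A⇔ : ∀ v → v ∈ᵥ A ⇔ Theta.Special F θ G full v) where
  open CharZeroField F using (Carrier; _≈_; 0#)
  open Theta F θ
  open Poly F using (μ)
  open Taylor F θ using (HasVal; HasVal⇒IsMult; IsMult⇒HasVal; Ord; Ord-cong)
  open MatchingSeries F θ using (M; M-cong; M-graph)

  private
    S : Graph n
    S = sGraph G A

    module Root = Reality.FromRoot F θ G (suc k) (IsMult⇒HasVal (μ G full) (suc (suc k)) multG)

    real : Real F θ
    real = record { sqF-zero = Root.sqF-zero }

  -- A multiplicity says that some elements of ℤ[θ] vanish and that another does not; the first is
  -- stable because θ is a root for G, the second because it is a negation.
  MultIs-stable : ∀ Γ X m → ¬ ¬ MultIs {n} Γ X m → MultIs Γ X m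
  MultIs-stable Γ X m h = HasVal⇒IsMult (μ Γ X) m
    ( (λ i i<m → Root.IsInt-stable (Reality.IntSer-M F θ Γ (card X) X ℕₚ.≤-refl i)
        (¬¬-map (λ mult → proj₁ (IsMult⇒HasVal (μ Γ X) m mult) i i<m) h))
    , λ e → h (λ mult → proj₂ (IsMult⇒HasVal (μ Γ X) m mult) e) )

  record Vals : Set ℓ where
    field
      valG valS : VSet n → ℕ
      hasG : ∀ X → HasVal (M G X) (valG X)
      hasS : ∀ X → HasVal (M S X) (valS X)

  ¬¬Vals : ¬ ¬ Vals
  ¬¬Vals h = Existence.¬¬val F θ G (λ (vG , hG) → Existence.¬¬val F θ S (λ (vS , hS) →
    h (record { valG = vG ; valS = vS ; hasG = hG ; hasS = hS })))

  module At (vals : Vals) where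
    open Vals vals public

    lawsG : MultiplicityLaws G valG
    lawsG = multiplicityLaws F θ real G valG hasG

    lawsS : MultiplicityLaws S valS
    lawsS = multiplicityLaws F θ real S valS hasS

    unique : ∀ {f a b} → HasVal f a → HasVal f b → a ≡ b
    unique (o , ne) (o′ , ne′) = ℕₚ.≤-antisym (ℕₚ.≮⇒≥ (λ p → ne′ (o _ p))) (ℕₚ.≮⇒≥ (λ p → ne (o′ _ p)))

    valG≡ : ∀ X m → MultIs G X m → valG X ≡ m
    valG≡ X m mult = unique (hasG X) (IsMult⇒HasVal (μ G X) m mult)

    valS≡ : ∀ X m → MultIs S X m → valS X ≡ m
    valS≡ X m mult = unique (hasS X) (IsMult⇒HasVal (μ S X) m mult)

    MultG : ∀ X m → valG X ≡ m → MultIs G X m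
    MultG X m ≡-refl = HasVal⇒IsMult (μ G X) _ (hasG X)

    MultS : ∀ X m → valS X ≡ m → MultIs S X m
    MultS X m ≡-refl = HasVal⇒IsMult (μ S X) _ (hasS X)

    agree : ∀ X → card (X ∩ᵥ A) ≡ 0 → valS X ≡ valG X
    agree X e = unique (proj₁ h , proj₂ h) (hasG X)
      where
      same : ∀ i j → X i ∧ X j ∧ adj S i j ≡ X i ∧ X j ∧ adj G i j
      same i j with X i | card-empty (X ∩ᵥ A) e i
      ... | false | _ = ≡-refl
      ... | true | ei with X j | card-empty (X ∩ᵥ A) e j
      ...   | false | _ = ≡-refl
      ...   | true | ej rewrite ei | ej with i ≟ᶠ j
      ...     | yes ≡-refl rewrite irrefl G i = ≡-refl
      ...     | no _ with adj G i j
      ...       | true  = ≡-refl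
      ...       | false = ≡-refl
      eq = M-graph S G X same
      h : HasVal (M G X) (valS X)
      h = Ord-cong eq (proj₁ (hasS X)) , λ z → proj₂ (hasS X) (CharZeroField.trans F (eq (valS X)) z)

    eG : valG full ≡ suc (suc k)
    eG = valG≡ full (suc (suc k)) multG

    special : ∀ x → x ∈ᵥ A → valG (del₁ full x) ≢ suc k × ∃[ v ] (nbr G full x v ≡ true × valG (del₁ full v) ≡ suc k)
    special x x∈A = let (_ , ¬ess , w , _ , xw , ess) = Equivalence.to (A⇔ x) x∈A ; (_ , k′ , m , m′) = ess in
      (λ e → ¬ess (≡-refl , suc k , multG , MultG (del₁ full x) (suc k) e)) ,
      w , nbr⁺ G {full} ≡-refl (λ e → ¬ess (≡-subst (Essential G full) e ess)) xw ,
      ≡-trans (valG≡ (del₁ full w) k′ m′) (ℕₚ.suc-injective (≡-trans (≡-sym (valG≡ full (suc k′) m)) eG))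

    open Cases G A valG valS lawsG lawsS agree k eG special public

  by-vals : ∀ Γ X m → (Vals → MultIs Γ X m) → MultIs Γ X m
  by-vals Γ X m f = MultIs-stable Γ X m (¬¬-map f ¬¬Vals)

  essential : ∀ x → ((vals : Vals) → Vals.valG vals (del₁ full x) ≡ suc k) → Essential G full x
  essential x f = ≡-refl , suc k , multG , by-vals G (del₁ full x) (suc k) (λ vals → At.MultG vals (del₁ full x) (suc k) (f vals))

  neutral : ∀ x → ((vals : Vals) → Vals.valG vals (del₁ full x) ≡ suc (suc k)) → Neutral G full x
  neutral x f = ≡-refl , suc (suc k) , multG , by-vals G (del₁ full x) (suc (suc k)) (λ vals → At.MultG vals (del₁ full x) (suc (suc k)) (f vals))

  positive : ∀ x → ((vals : Vals) → Vals.valG vals (del₁ full x) ≡ suc (suc (suc k))) → Positive G full x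
  positive x f = ≡-refl , suc (suc k) , multG , by-vals G (del₁ full x) (suc (suc (suc k))) (λ vals → At.MultG vals (del₁ full x) (suc (suc (suc k))) (f vals))

  special-∈A : ∀ x → Special G full x → x ∈ᵥ A
  special-∈A x = Equivalence.from (A⇔ x)

  ∉A⇒¬special : ∀ x → A x ≡ false → ¬ Special G full x
  ∉A⇒¬special x x∉A sp = true≢false (special-∈A x sp) x∉A

  ¬special⇒∉A : ∀ x → ¬ Special G full x → A x ≡ false
  ¬special⇒∉A x h = caseᵇ (A x) (λ p → ⊥-elim (h (Equivalence.to (A⇔ x) p))) id

  essential⇒∉A : ∀ x → Essential G full x → A x ≡ false
  essential⇒∉A x ess = ¬special⇒∉A x (λ sp → proj₁ (proj₂ sp) ess)

  essential⁻ : ∀ x → Essential G full x → (vals : Vals) → Vals.valG vals (del₁ full x) ≡ suc k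
  essential⁻ x (_ , k′ , m , m′) vals = ≡-trans (At.valG≡ vals (del₁ full x) k′ m′)
    (ℕₚ.suc-injective (≡-trans (≡-sym (At.valG≡ vals full (suc k′) m)) (At.eG vals)))

  neutral⁻ : ∀ x → Neutral G full x → (vals : Vals) → Vals.valG vals (del₁ full x) ≡ suc (suc k)
  neutral⁻ x (_ , k′ , m , m′) vals = ≡-trans (At.valG≡ vals (del₁ full x) k′ m′) (≡-trans (≡-sym (At.valG≡ vals full k′ m)) (At.eG vals))

  positive⁻ : ∀ x → Positive G full x → (vals : Vals) → Vals.valG vals (del₁ full x) ≡ suc (suc (suc k))
  positive⁻ x (_ , k′ , m , m′) vals = ≡-trans (At.valG≡ vals (del₁ full x) (suc k′) m′) (cong suc (≡-trans (≡-sym (At.valG≡ vals full k′ m)) (At.eG vals)))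

  d0⁺ : ∀ u v → u ≢ v → ((vals : Vals) → Vals.valS vals (del₂ full u v) ≡ suc (suc k)) → D0Edge S full u v
  d0⁺ u v u≢v f = u≢v , ≡-refl , ≡-refl , suc (suc k) ,
    by-vals S full (suc (suc k)) (λ vals → At.MultS vals full (suc (suc k)) (At.valS-full vals)) ,
    by-vals S (del₂ full u v) (suc (suc k)) (λ vals → At.MultS vals (del₂ full u v) (suc (suc k)) (f vals))

  d0⁻ : ∀ u v → D0Edge S full u v → (vals : Vals) → Vals.valS vals (del₂ full u v) ≡ suc (suc k)
  d0⁻ u v (_ , _ , _ , k′ , m , m′) vals = ≡-trans (At.valS≡ vals (del₂ full u v) k′ m′)
    (≡-trans (≡-sym (At.valS≡ vals full k′ m)) (At.valS-full vals))

  module WithComponents (q m : ℕ) (H : Fin q → VSet n) (Q : Fin m → VSet n)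
    (compH : ∀ i → IsComponent G (full ∖ A) (H i)) (compQ : ∀ j → IsComponent G (full ∖ A) (Q j))
    (all : ∀ C → IsComponent G (full ∖ A) C → (∃[ i ] (C ≗ H i)) ⊎ (∃[ j ] (C ≗ Q j)))
    (injQ : ∀ j j′ → Q j ≗ Q j′ → j ≡ j′)
    (critical : ∀ i → Critical F θ G (H i)) (multQ : ∀ j → MultIs G (Q j) 0) where

    Located : Fin n → Set
    Located x = (∃[ i ] (x ∈ᵥ H i)) ⊎ (∃[ j ] (x ∈ᵥ Q j))

    locate : ∀ x → A x ≡ false → Located x
    locate x x∉A with any? (λ i → H i x ≟ᵇ true) | any? (λ j → Q j x ≟ᵇ true)
    ... | yes p | _     = inj₁ p
    ... | no _  | yes p = inj₂ p
    ... | no ¬h | no ¬q = ⊥-elim (¬¬component G (full ∖ A) x (cong not x∉A) λ where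
            (C , comp , x∈C) → case-all (all C comp) x∈C)
      where
      case-all : ∀ {C} → (∃[ i ] (C ≗ H i)) ⊎ (∃[ j ] (C ≗ Q j)) → x ∈ᵥ C → ⊥
      case-all (inj₁ (i , e)) x∈C = ¬h (i , ≡-trans (≡-sym (e x)) x∈C)
      case-all (inj₂ (j , e)) x∈C = ¬q (j , ≡-trans (≡-sym (e x)) x∈C)

    component-∉A : ∀ {C} → IsComponent G (full ∖ A) C → ∀ {x} → x ∈ᵥ C → A x ≡ false
    component-∉A comp {x} x∈C with A x | proj₁ comp x x∈C
    ... | false | _ = ≡-refl

    module Types (vals : Vals) where
      open At vals

      across : ∀ {C} → IsComponent G X₀ C → ∀ u v → u ∈ᵥ C → C v ≡ false →
        valG (del₂ X₀ u v) ℕ.+ valG X₀ ≡ valG (del₁ X₀ u) ℕ.+ valG (del₁ X₀ v)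
      across {C} comp = Components.val-across G valG lawsG X₀ C comp

      typeH : ∀ i x → x ∈ᵥ H i → suc (valG (del₁ X₀ x)) ≡ valG X₀
      typeH i x x∈ = let (_ , k′ , mH , mH′) = proj₂ (critical i) x x∈ in
        ≡-trans (cong suc (≡-trans (Components.val-split-del₁ G valG lawsG X₀ (H i) (compH i) x x∈)
            (cong (ℕ._+ valG (X₀ ∖ H i)) (valG≡ (del₁ (H i) x) k′ mH′))))
          (≡-sym (≡-trans (Components.val-split G valG lawsG X₀ (H i) (compH i)) (cong (ℕ._+ valG (X₀ ∖ H i)) (valG≡ (H i) (suc k′) mH))))

      typeQ : ∀ j x → x ∈ᵥ Q j → valG (del₁ X₀ x) ≡ valG (del₁ (Q j) x) ℕ.+ valG X₀
      typeQ j x x∈ = ≡-trans (Components.val-split-del₁ G valG lawsG X₀ (Q j) (compQ j) x x∈)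
        (cong (valG (del₁ (Q j) x) ℕ.+_) (≡-sym (≡-trans (Components.val-split G valG lawsG X₀ (Q j) (compQ j)) (cong (ℕ._+ valG (X₀ ∖ Q j)) (valG≡ (Q j) 0 (multQ j))))))

      same-⇒ : ∀ {C} → IsComponent G X₀ C → ∀ u v → u ∈ᵥ C → v ∈ᵥ C → valG (del₂ X₀ u v) ≡ valG X₀ → valG (del₂ C u v) ≡ valG C
      same-⇒ {C} comp u v u∈C v∈C e = ℕₚ.+-cancelʳ-≡ (valG (X₀ ∖ C)) _ _
        (≡-trans (≡-sym (Components.val-split-del₂ G valG lawsG X₀ C comp u v u∈C v∈C)) (≡-trans e (Components.val-split G valG lawsG X₀ C comp)))

      same-⇐ : ∀ {C} → IsComponent G X₀ C → ∀ u v → u ∈ᵥ C → v ∈ᵥ C → valG (del₂ C u v) ≡ valG C → valG (del₂ X₀ u v) ≡ valG X₀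
      same-⇐ {C} comp u v u∈C v∈C e = ≡-trans (Components.val-split-del₂ G valG lawsG X₀ C comp u v u∈C v∈C)
        (≡-trans (cong (ℕ._+ valG (X₀ ∖ C)) e) (≡-sym (Components.val-split G valG lawsG X₀ C comp)))

      -- Two essential vertices in different components lower the multiplicity by 2 together, so
      -- they cannot leave it unchanged.
      HH : ∀ u v → suc (valG (del₁ X₀ u)) ≡ valG X₀ → suc (valG (del₁ X₀ v)) ≡ valG X₀ →
        valG X₀ ℕ.+ valG X₀ ≡ valG (del₁ X₀ u) ℕ.+ valG (del₁ X₀ v) → ⊥
      HH u v eu ev e = ℕₚ.<⇒≢ (s≤s (ℕₚ.+-monoʳ-≤ (valG (del₁ X₀ u)) (ℕₚ.n≤1+n _))) (≡-trans (≡-sym e) (≡-sym (cong₂ ℕ._+_ eu ev)))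

      HQ : ∀ u v d → suc (valG (del₁ X₀ u)) ≡ valG X₀ → valG (del₁ X₀ v) ≡ d ℕ.+ valG X₀ →
        valG X₀ ℕ.+ valG X₀ ≡ valG (del₁ X₀ u) ℕ.+ valG (del₁ X₀ v) → valG (del₁ X₀ v) ≡ 1 ℕ.+ valG X₀
      HQ u v d eu ev e = ℕₚ.+-cancelˡ-≡ (valG (del₁ X₀ u)) _ _ (≡-trans (≡-sym e) (≡-trans (cong (ℕ._+ valG X₀) (≡-sym eu)) (≡-sym (ℕₚ.+-suc _ _))))

      -- As Q_j has multiplicity 0, deleting a vertex of it never lowers the multiplicity; two such
      -- changes with sum 0 are both 0.
      QQ : ∀ u v d d′ → valG (del₁ X₀ u) ≡ d ℕ.+ valG X₀ → valG (del₁ X₀ v) ≡ d′ ℕ.+ valG X₀ →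
        valG X₀ ℕ.+ valG X₀ ≡ valG (del₁ X₀ u) ℕ.+ valG (del₁ X₀ v) → d ≡ 0 × d′ ≡ 0
      QQ u v d d′ eu ev e = zeros d d′ (ℕₚ.+-cancelʳ-≡ (valG X₀ ℕ.+ valG X₀) _ _ (≡-trans (regroup d d′ (valG X₀)) (≡-trans (≡-sym (cong₂ ℕ._+_ eu ev)) (≡-sym e))))
        where
        regroup : ∀ d d′ x → (d ℕ.+ d′) ℕ.+ (x ℕ.+ x) ≡ (d ℕ.+ x) ℕ.+ (d′ ℕ.+ x)
        regroup = solve-∀ℕ
        zeros : ∀ d d′ → d ℕ.+ d′ ≡ 0 → d ≡ 0 × d′ ≡ 0
        zeros zero zero _ = ≡-refl , ≡-refl

    Result : Fin n → Fin n → Set (c ⊔ ℓ)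
    Result u v =
      ( ((PosNotSpecial G full u ⊎ Special G full u) × Essential G full v)
      ⊎ ((PosNotSpecial G full v ⊎ Special G full v) × Essential G full u))
      ⊎ (Neutral G full u × Neutral G full v × ∃[ j₁ ] ∃[ j₂ ] (j₁ ≢ j₂ × u ∈ᵥ Q j₁ × v ∈ᵥ Q j₂))
      ⊎ (∃[ i₀ ] D0Edge G (H i₀) u v)
      ⊎ (∃[ j₀ ] D0Edge G (Q j₀) u v)

    module _ (u v : Fin n) (u≢v : u ≢ v) where

      module _ (d0 : (vals : Vals) → Vals.valS vals (del₂ full u v) ≡ suc (suc k)) where

        one-special⇒ : u ∈ᵥ A → A v ≡ false → Essential G full v
        one-special⇒ u∈A v∉A = essential v (λ vals → ℕₚ.suc-injective (≡-trans (≡-sym (At.one-special vals u v u≢v u∈A v∉A)) (d0 vals)))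

        module _ (u∉A : A u ≡ false) (v∉A : A v ≡ false) where

          in-X₀ : (vals : Vals) → Vals.valG vals (del₂ (full ∖ A) u v) ≡ Vals.valG vals (full ∖ A)
          in-X₀ vals = At.none-special-⇒ vals u v u≢v u∉A v∉A (d0 vals)

          twice : (vals : Vals) → ∀ {C} → IsComponent G (full ∖ A) C → u ∈ᵥ C → C v ≡ false →
            Vals.valG vals (full ∖ A) ℕ.+ Vals.valG vals (full ∖ A) ≡ Vals.valG vals (del₁ (full ∖ A) u) ℕ.+ Vals.valG vals (del₁ (full ∖ A) v)
          twice vals comp u∈C v∉C = ≡-trans (cong (ℕ._+ Vals.valG vals (full ∖ A)) (≡-sym (in-X₀ vals))) (Types.across vals comp u v u∈C v∉C)

          same-component : ∀ {C} → IsComponent G (full ∖ A) C → ∀ d → MultIs G C d → u ∈ᵥ C → v ∈ᵥ C → D0Edge G C u v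
          same-component {C} comp d mC u∈C v∈C = u≢v , u∈C , v∈C , d , mC , by-vals G (del₂ C u v) d (λ vals →
            At.MultG vals (del₂ C u v) d (≡-trans (Types.same-⇒ vals comp u v u∈C v∈C (in-X₀ vals)) (At.valG≡ vals C d mC)))

          essentialH : ∀ i x → A x ≡ false → x ∈ᵥ H i → Essential G full x
          essentialH i x x∉A x∈ = essential x (λ vals → At.X₀⇒full⁻ vals x x∉A (Types.typeH vals i x x∈))

          located : Located u → Located v → Result u v
          located (inj₁ (i , u∈)) lv = caseᵇ (H i v)
            (λ v∈ → let (_ , k′ , mH , _) = proj₂ (critical i) u u∈ in inj₂ (inj₂ (inj₁ (i , same-component (compH i) (suc k′) mH u∈ v∈))))
            (λ v∉ → apart lv v∉)
            where
            apart : Located v → H i v ≡ false → Result u v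
            apart (inj₁ (i′ , v∈)) v∉ = ⊥-elim (¬¬Vals (λ vals → Types.HH vals u v (Types.typeH vals i u u∈) (Types.typeH vals i′ v v∈)
              (twice vals (compH i) u∈ v∉)))
            apart (inj₂ (j , v∈)) v∉ = inj₁ (inj₂ (inj₁ (positive v (λ vals → At.X₀⇒full vals v 1 v∉A
                (Types.HQ vals u v _ (Types.typeH vals i u u∈) (Types.typeQ vals j v v∈) (twice vals (compH i) u∈ v∉))) , ∉A⇒¬special v v∉A)
              , essentialH i u u∉A u∈))
          located (inj₂ (j , u∈)) lv = caseᵇ (Q j v)
            (λ v∈ → inj₂ (inj₂ (inj₂ (j , same-component (compQ j) 0 (multQ j) u∈ v∈))))
            (λ v∉ → apart lv v∉)
            where
            apart : Located v → Q j v ≡ false → Result u v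
            apart (inj₁ (i , v∈)) v∉ = inj₁ (inj₁ (inj₁ (positive u (λ vals → At.X₀⇒full vals u 1 u∉A
                (Types.HQ vals v u _ (Types.typeH vals i v v∈) (Types.typeQ vals j u u∈)
                  (≡-trans (twice vals (compQ j) u∈ v∉) (ℕₚ.+-comm (Vals.valG vals (del₁ (full ∖ A) u)) _)))) , ∉A⇒¬special u u∉A)
              , essentialH i v v∉A v∈))
            apart (inj₂ (j′ , v∈)) v∉ = inj₂ (inj₁ (neutral u (λ vals → zeroQ vals j u u∉A u∈ (proj₁ (zz vals)))
              , neutral v (λ vals → zeroQ vals j′ v v∉A v∈ (proj₂ (zz vals)))
              , j , j′ , (λ { ≡-refl → true≢false v∈ v∉ }) , u∈ , v∈))
              where
              zz : (vals : Vals) → Vals.valG vals (del₁ (Q j) u) ≡ 0 × Vals.valG vals (del₁ (Q j′) v) ≡ 0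
              zz vals = Types.QQ vals u v _ _ (Types.typeQ vals j u u∈) (Types.typeQ vals j′ v v∈) (twice vals (compQ j) u∈ v∉)
              zeroQ : (vals : Vals) → ∀ j x → A x ≡ false → x ∈ᵥ Q j → Vals.valG vals (del₁ (Q j) x) ≡ 0 → Vals.valG vals (del₁ full x) ≡ suc (suc k)
              zeroQ vals j x x∉A x∈ e = At.X₀⇒full vals x 0 x∉A (≡-trans (Types.typeQ vals j x x∈) (cong (ℕ._+ Vals.valG vals (full ∖ A)) e))

      one-special⇐ : u ∈ᵥ A → Essential G full v → D0Edge S full u v
      one-special⇐ u∈A ess = d0⁺ u v u≢v (λ vals → ≡-trans (At.one-special vals u v u≢v u∈A (essential⇒∉A v ess)) (cong suc (essential⁻ v ess vals)))

      from-X₀ : A u ≡ false → A v ≡ false → ((vals : Vals) → Vals.valG vals (del₂ (full ∖ A) u v) ≡ Vals.valG vals (full ∖ A)) → D0Edge S full u v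
      from-X₀ u∉A v∉A f = d0⁺ u v u≢v (λ vals → At.none-special-⇐ vals u v u≢v u∉A v∉A (f vals))

      from-across : ∀ {C} → IsComponent G (full ∖ A) C → u ∈ᵥ C → C v ≡ false → A v ≡ false →
        ((vals : Vals) → Vals.valG vals (del₁ (full ∖ A) u) ℕ.+ Vals.valG vals (del₁ (full ∖ A) v) ≡ Vals.valG vals (full ∖ A) ℕ.+ Vals.valG vals (full ∖ A)) →
        D0Edge S full u v
      from-across comp u∈C v∉C v∉A f = from-X₀ (component-∉A comp u∈C) v∉A
        (λ vals → ℕₚ.+-cancelʳ-≡ (Vals.valG vals (full ∖ A)) _ _ (≡-trans (Types.across vals comp u v u∈C v∉C) (f vals)))

      from-same : ∀ {C} → IsComponent G (full ∖ A) C → D0Edge G C u v → D0Edge S full u v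
      from-same {C} comp (_ , u∈C , v∈C , d , mC , mC′) = from-X₀ (component-∉A comp u∈C) (component-∉A comp v∈C)
        (λ vals → Types.same-⇐ vals comp u v u∈C v∈C (≡-trans (At.valG≡ vals (del₂ C u v) d mC′) (≡-sym (At.valG≡ vals C d mC))))

      -- A positive vertex outside `A` lies in some Q_j, and an essential one cannot lie in it. The
      -- two are thus in different components, where the changes +1 and -1 cancel.
      positive-essential⇒ : A u ≡ false → Positive G full u → Essential G full v → D0Edge S full u v
      positive-essential⇒ u∉A posu ess = by (locate u u∉A)
        where
        v∉A = essential⇒∉A v ess
        pu : (vals : Vals) → Vals.valG vals (del₁ (full ∖ A) u) ≡ 1 ℕ.+ Vals.valG vals (full ∖ A)
        pu vals = At.full⇒X₀ vals u 1 u∉A (positive⁻ u posu vals)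
        ev : (vals : Vals) → suc (Vals.valG vals (del₁ (full ∖ A) v)) ≡ Vals.valG vals (full ∖ A)
        ev vals = At.full⇒X₀⁻ vals v v∉A (essential⁻ v ess vals)
        by : Located u → D0Edge S full u v
        by (inj₁ (i , u∈)) = ⊥-elim (¬¬Vals (λ vals → ℕₚ.<⇒≢ (ℕₚ.m≤n⇒m≤1+n (ℕₚ.n<1+n _))
          (≡-sym (≡-trans (cong suc (≡-sym (pu vals))) (Types.typeH vals i u u∈)))))
        by (inj₂ (j , u∈)) = caseᵇ (Q j v)
          (λ v∈ → ⊥-elim (¬¬Vals (λ vals → ℕₚ.<⇒≢ (s≤s (ℕₚ.m≤n+m (Vals.valG vals (full ∖ A)) _))
            (≡-sym (≡-trans (cong suc (≡-sym (Types.typeQ vals j v v∈))) (ev vals))))))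
          (λ v∉ → from-across (compQ j) u∈ v∉ v∉A (λ vals → ≡-trans (cong (ℕ._+ Vals.valG vals (del₁ (full ∖ A) v)) (pu vals))
            (≡-trans (≡-sym (ℕₚ.+-suc (Vals.valG vals (full ∖ A)) _)) (cong (Vals.valG vals (full ∖ A) ℕ.+_) (ev vals)))))

      -- Different indices name different components, which are disjoint, so the two changes, both
      -- 0, add.
      neutral-neutral⇒ : Neutral G full u → Neutral G full v → ∀ j₁ j₂ → j₁ ≢ j₂ → u ∈ᵥ Q j₁ → v ∈ᵥ Q j₂ → D0Edge S full u v
      neutral-neutral⇒ nu nv j₁ j₂ ne u∈ v∈ = from-across (compQ j₁) u∈
        (caseᵇ (Q j₁ v) (λ v∈′ → ⊥-elim (ne (injQ j₁ j₂ (component-≗ G (compQ j₁) (compQ j₂) v∈′ v∈)))) id)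
        (component-∉A (compQ j₂) v∈)
        (λ vals → cong₂ ℕ._+_ (At.full⇒X₀ vals u 0 (component-∉A (compQ j₁) u∈) (neutral⁻ u nu vals))
                              (At.full⇒X₀ vals v 0 (component-∉A (compQ j₂) v∈) (neutral⁻ v nv vals)))

    D0Edge-sym : ∀ u v → D0Edge S full u v → D0Edge S full v u
    D0Edge-sym u v d0@(u≢v , _) = d0⁺ v u (λ e → u≢v (≡-sym e))
      (λ vals → ≡-trans (MultiplicityLaws.val-≗ (At.lawsS vals) (del₂-comm full v u)) (d0⁻ u v d0 vals))

    forward : ∀ u v → u ≢ v → D0Edge S full u v → Result u v
    forward u v u≢v d0 = caseᵇ (A u)
      (λ u∈A → caseᵇ (A v)
        (λ v∈A → ⊥-elim (¬¬Vals (λ vals → At.both-special vals u v u≢v u∈A v∈A (d0⁻ u v d0 vals))))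
        (λ v∉A → inj₁ (inj₁ (inj₂ (Equivalence.to (A⇔ u) u∈A) , one-special⇒ u v u≢v (d0⁻ u v d0) u∈A v∉A))))
      (λ u∉A → caseᵇ (A v)
        (λ v∈A → inj₁ (inj₂ (inj₂ (Equivalence.to (A⇔ v) v∈A)
          , one-special⇒ v u (λ e → u≢v (≡-sym e)) (d0⁻ v u (D0Edge-sym u v d0)) v∈A u∉A)))
        (λ v∉A → located u v u≢v (d0⁻ u v d0) u∉A v∉A (locate u u∉A) (locate v v∉A)))

    caseA⇒ : ∀ u v → u ≢ v → PosNotSpecial G full u ⊎ Special G full u → Essential G full v → D0Edge S full u v
    caseA⇒ u v u≢v (inj₁ (posu , ¬sp)) ess = positive-essential⇒ u v u≢v (¬special⇒∉A u ¬sp) posu ess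
    caseA⇒ u v u≢v (inj₂ sp) ess = one-special⇐ u v u≢v (special-∈A u sp) ess

    backward : ∀ u v → u ≢ v → Result u v → D0Edge S full u v
    backward u v u≢v (inj₁ (inj₁ (pu , ess))) = caseA⇒ u v u≢v pu ess
    backward u v u≢v (inj₁ (inj₂ (pv , ess))) = D0Edge-sym v u (caseA⇒ v u (λ e → u≢v (≡-sym e)) pv ess)
    backward u v u≢v (inj₂ (inj₁ (nu , nv , j₁ , j₂ , ne , u∈ , v∈))) = neutral-neutral⇒ u v u≢v nu nv j₁ j₂ ne u∈ v∈
    backward u v u≢v (inj₂ (inj₂ (inj₁ (i , d0)))) = from-same u v u≢v (compH i) d0
    backward u v u≢v (inj₂ (inj₂ (inj₂ (j , d0)))) = from-same u v u≢v (compQ j) d0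

theorem5p9 : ∀ {c ℓ : Level} (F : CharZeroField c ℓ) (θ : CharZeroField.Carrier F)
    {n : ℕ} (G : Graph n)
    → ∃[ k ] (2 ≤ k × Theta.MultIs F θ G full k)
    → (A : VSet n) → (∀ v → v ∈ᵥ A ⇔ Theta.Special F θ G full v)
    → (q m : ℕ) (H : Fin q → VSet n) (Q : Fin m → VSet n)
    → (∀ i → IsComponent G (full ∖ A) (H i))
    → (∀ j → IsComponent G (full ∖ A) (Q j))
    → (∀ C → IsComponent G (full ∖ A) C → (∃[ i ] (C ≗ H i)) ⊎ (∃[ j ] (C ≗ Q j)))
    → (∀ i i′ → H i ≗ H i′ → i ≡ i′)
    → (∀ j j′ → Q j ≗ Q j′ → j ≡ j′)
    → (∀ i j → ¬ (H i ≗ Q j))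
    → (∀ i → Critical F θ G (H i))
    → (∀ j → Theta.MultIs F θ G (Q j) 0)
    → ∀ u v → u ≢ v
    → Theta.D0Edge F θ (sGraph G A) full u v
    ⇔ ( ( ((Theta.PosNotSpecial F θ G full u ⊎ Theta.Special F θ G full u)
    × Theta.Essential F θ G full v)
    ⊎ ((Theta.PosNotSpecial F θ G full v ⊎ Theta.Special F θ G full v)
    × Theta.Essential F θ G full u))
    ⊎ (Theta.Neutral F θ G full u × Theta.Neutral F θ G full v
    × ∃[ j₁ ] ∃[ j₂ ] (j₁ ≢ j₂ × u ∈ᵥ Q j₁ × v ∈ᵥ Q j₂))
    ⊎ (∃[ i₀ ] Theta.D0Edge F θ G (H i₀) u v)
    ⊎ (∃[ j₀ ] Theta.D0Edge F θ G (Q j₀) u v))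
theorem5p9 F θ G (suc (suc k) , s≤s (s≤s _) , mult) A A⇔ q m H Q compH compQ all _ injQ _ critical multQ u v u≢v =
  mk⇔ (forward u v u≢v) (backward u v u≢v)
  where
  open Main F θ G k mult A A⇔
  open WithComponents q m H Q compH compQ all injQ critical multQ
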